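{- Let $p\ge 3$ be any odd integer and let $k=2p$. There is a $(2k+1)$-regular class $1$ graph $G$ such that $\phi_c(G)>2+\frac{2}{k}$.
   Context: Graphs are finite and may contain multiple edges but no loops. The chromatic index $\chi'(G)$ is the minimum $m$ such that $G$ has a proper $m$-edge-coloring (adjacent edges, including parallel edges, receive different colors). A graph $G$ with maximum degree $\Delta(G)$ is class $1$ if $\chi'(G)=\Delta(G)$ and class $2$ otherwise. For a real number $r\ge 2$, a nowhere-zero $r$-flow in $G$ is a pair $(D,f)$ where $D$ is an orientation of $G$ and $f\colon E(G)\to[1,r-1]$ is a function such that $\sum_{e\in E^+(v)}f(e)=\sum_{e\in E^-(v)}f(e)$ for every vertex $v$, where $E^+(v)$ and $E^-(v)$ are the sets of outgoing and incoming arcs at $v$. The circular flow number is $\phi_c(G)=\inf\{r : G \text{ has a nowhere-zero } r\text{ -flow}\}$. -}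

module Defs where

open import Algebra.Bundles using (CommutativeMonoid)
import Algebra.Properties.CommutativeSemigroup as CommutativeSemigroupProperties
open import Data.Bool.Base using (Bool; if_then_else_)
open import Data.Fin.Base using (Fin)
open import Data.Fin.Properties using (_≟_)
open import Data.List.Base using (List; allFin; filter; foldr; length; map)
open import Data.List.Extrema.Nat using (max)
open import Data.Nat.Base as ℕ using (ℕ)
import Data.Nat.Properties as ℕ
open import Data.Product.Base using (Σ-syntax; ∃-syntax; _×_; _,_)
open import Data.Rational.Base as ℚ using (ℚ; 0ℚ; 1ℚ; ½)
import Data.Rational.Properties as ℚ
open import Data.Sum.Base using (_⊎_)
open import Relation.Binary.PropositionalEquality
open import Relation.Nullary using (¬_; Dec)
open import Relation.Nullary.Decidable using (_⊎-dec_)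

open CommutativeSemigroupProperties
  (CommutativeMonoid.commutativeSemigroup ℚ.+-0-commutativeMonoid) using (interchange)

half : ℚ → ℚ
half ε = ½ ℚ.* ε

half>0 : ∀ {ε} → 0ℚ ℚ.< ε → 0ℚ ℚ.< half ε
half>0 {ε} ε>0 = subst (ℚ._< half ε) (ℚ.*-zeroʳ ½) (ℚ.*-monoʳ-<-pos ½ ε>0)

half+half : ∀ ε → half ε ℚ.+ half ε ≡ ε
half+half ε = trans (sym (ℚ.*-distribʳ-+ ε ½ ½)) (ℚ.*-identityˡ ε)

-- The reals are Cauchy sequences of rationals; a modulus of convergence is part
-- of the data, and equality is the setoid equality _≈ᴿ_.
IsCauchy : (ℕ → ℚ) → Set
IsCauchy s = ∀ ε → 0ℚ ℚ.< ε → ∃[ N ] (∀ m n → N ℕ.≤ m → N ℕ.≤ n → s m ℚ.≤ s n ℚ.+ ε)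

record ℝ : Set where
  constructor mkℝ
  field
    seq    : ℕ → ℚ
    cauchy : IsCauchy seq
open ℝ public

infix  4 _≤ᴿ_ _<ᴿ_ _≈ᴿ_
infixl 6 _+ᴿ_

_≤ᴿ_ : ℝ → ℝ → Set
x ≤ᴿ y = ∀ ε → 0ℚ ℚ.< ε → ∃[ N ] (∀ n → N ℕ.≤ n → seq x n ℚ.≤ seq y n ℚ.+ ε)

_≈ᴿ_ : ℝ → ℝ → Set
x ≈ᴿ y = x ≤ᴿ y × y ≤ᴿ x

_<ᴿ_ : ℝ → ℝ → Set
x <ᴿ y = ∃[ ε ] (0ℚ ℚ.< ε × (∃[ N ] (∀ n → N ℕ.≤ n → seq x n ℚ.+ ε ℚ.≤ seq y n)))

fromℚ : ℚ → ℝ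
fromℚ q = mkℝ (λ _ → q) λ ε ε>0 → 0 , λ _ _ _ _ →
  subst (ℚ._≤ q ℚ.+ ε) (ℚ.+-identityʳ q) (ℚ.+-monoʳ-≤ q (ℚ.<⇒≤ ε>0))

_+ᴿ_ : ℝ → ℝ → ℝ
x +ᴿ y = mkℝ (λ n → seq x n ℚ.+ seq y n) λ ε ε>0 →
  let δ = half ε
      (M , x-cauchy) = cauchy x δ (half>0 ε>0)
      (N , y-cauchy) = cauchy y δ (half>0 ε>0)
  in M ℕ.⊔ N , λ m n M⊔N≤m M⊔N≤n →
    subst (seq x m ℚ.+ seq y m ℚ.≤_)
      (trans (interchange (seq x n) δ (seq y n) δ)
             (cong (seq x n ℚ.+ seq y n ℚ.+_) (half+half ε)))
      (ℚ.+-mono-≤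
        (x-cauchy m n (ℕ.m⊔n≤o⇒m≤o M N M⊔N≤m) (ℕ.m⊔n≤o⇒m≤o M N M⊔N≤n))
        (y-cauchy m n (ℕ.m⊔n≤o⇒n≤o M N M⊔N≤m) (ℕ.m⊔n≤o⇒n≤o M N M⊔N≤n)))

sumᴿ : List ℝ → ℝ
sumᴿ = foldr _+ᴿ_ (fromℚ 0ℚ)

-- Constructively, a set of reals that is inhabited and bounded below need not
-- have an infimum in ℝ, but every set of reals has one among the extended
-- upper reals: a value u is given by its upper cut { q ∈ ℚ ∣ u < q }.  The
-- empty cut is +∞, the infimum of the empty set.
record UpperReal : Set₁ where
  field
    Above   : ℚ → Set
    upward  : ∀ {p q} → p ℚ.≤ q → Above p → Above q
    rounded : ∀ {q} → Above q → ∃[ p ] (p ℚ.< q × Above p)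
open UpperReal public

inf : (ℝ → Set) → UpperReal
inf S = record
  { Above   = λ q → Σ[ r ∈ ℝ ] (S r × r <ᴿ fromℚ q)
  ; upward  = λ { p≤q (r , r∈S , ε , ε>0 , N , r+ε≤p) →
      r , r∈S , ε , ε>0 , N , λ n N≤n → ℚ.≤-trans (r+ε≤p n N≤n) p≤q }
  ; rounded = λ { {q} (r , r∈S , ε , ε>0 , N , r+ε≤q) →
      let δ   = half ε
          δ>0 = half>0 ε>0
      in q ℚ.- δ
       , subst (q ℚ.- δ ℚ.<_) (ℚ.+-identityʳ q) (ℚ.+-monoʳ-< q (ℚ.neg-antimono-< δ>0))
       , r , r∈S , δ , δ>0 , N , λ n N≤n →
           subst (ℚ._≤ q ℚ.- δ)
             (trans (cong (λ z → (seq r n ℚ.+ z) ℚ.- δ) (sym (half+half ε)))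
                    (cancel (seq r n) δ))
             (ℚ.+-monoˡ-≤ (ℚ.- δ) (r+ε≤q n N≤n)) }
  }
  where
  cancel : ∀ a δ → (a ℚ.+ (δ ℚ.+ δ)) ℚ.- δ ≡ a ℚ.+ δ
  cancel a δ = begin
    (a ℚ.+ (δ ℚ.+ δ)) ℚ.- δ  ≡⟨ ℚ.+-assoc a (δ ℚ.+ δ) (ℚ.- δ) ⟩
    a ℚ.+ ((δ ℚ.+ δ) ℚ.- δ)  ≡⟨ cong (a ℚ.+_) (ℚ.+-assoc δ δ (ℚ.- δ)) ⟩
    a ℚ.+ (δ ℚ.+ (δ ℚ.- δ))  ≡⟨ cong (λ z → a ℚ.+ (δ ℚ.+ z)) (ℚ.+-inverseʳ δ) ⟩
    a ℚ.+ (δ ℚ.+ 0ℚ)         ≡⟨ cong (a ℚ.+_) (ℚ.+-identityʳ δ) ⟩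
    a ℚ.+ δ                  ∎
    where open ≡-Reasoning

-- For u = inf S this says that some rational q > c is a lower bound of S.
infix 4 _<ᵁ_
_<ᵁ_ : ℚ → UpperReal → Set
c <ᵁ u = ∃[ q ] (c ℚ.< q × ¬ Above u q)

-- Edges have their own identity, so distinct edges may be parallel.  The order
-- of the two ends is an arbitrary labelling without mathematical meaning.
record Multigraph : Set where
  field
    #V #E     : ℕ
    end₁ end₂ : Fin #E → Fin #V
    loopless  : ∀ e → end₁ e ≢ end₂ e

  Vertex Edge : Set
  Vertex = Fin #V
  Edge   = Fin #E

  Incident : Vertex → Edge → Set
  Incident v e = end₁ e ≡ v ⊎ end₂ e ≡ v

  incident? : ∀ v e → Dec (Incident v e)
  incident? v e = (end₁ e ≟ v) ⊎-dec (end₂ e ≟ v)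

  degree : Vertex → ℕ
  degree v = length (filter (incident? v) (allFin #E))

  Δ : ℕ
  Δ = max 0 (map degree (allFin #V))

  Adjacent : Edge → Edge → Set
  Adjacent e f = e ≢ f × (∃[ v ] (Incident v e × Incident v f))

open Multigraph public using (Vertex; Edge)

Regular : ℕ → Multigraph → Set
Regular d G = ∀ v → Multigraph.degree G v ≡ d

module _ (G : Multigraph) where
  open Multigraph G using (Adjacent; Δ)

  IsProperEdgeColouring : (m : ℕ) → (Edge G → Fin m) → Set
  IsProperEdgeColouring m c = ∀ e f → Adjacent e f → c e ≢ c f

  EdgeColourable : ℕ → Set
  EdgeColourable m = ∃[ c ] IsProperEdgeColouring m c

  IsChromaticIndex : ℕ → Set
  IsChromaticIndex m = EdgeColourable m × (∀ j → EdgeColourable j → m ℕ.≤ j)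

  Class1 : Set
  Class1 = IsChromaticIndex Δ

module _ (G : Multigraph) where
  open Multigraph G using (#E; end₁; end₂)

  -- true directs e from end₁ e to end₂ e, and false the other way.
  Orientation : Set
  Orientation = Edge G → Bool

  tail head : Orientation → Edge G → Vertex G
  tail D e = if D e then end₁ e else end₂ e
  head D e = if D e then end₂ e else end₁ e

  E⁺ E⁻ : Orientation → Vertex G → List (Edge G)
  E⁺ D v = filter (λ e → tail D e ≟ v) (allFin #E)
  E⁻ D v = filter (λ e → head D e ≟ v) (allFin #E)

  record IsNowhereZeroFlow (r : ℝ) (D : Orientation) (f : Edge G → ℝ) : Set where
    field
      lower    : ∀ e → fromℚ 1ℚ ≤ᴿ f e
      upper    : ∀ e → f e ≤ᴿ r +ᴿ fromℚ (ℚ.- 1ℚ)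
      conserve : ∀ v → sumᴿ (map f (E⁺ D v)) ≈ᴿ sumᴿ (map f (E⁻ D v))

  HasNowhereZeroFlow : ℝ → Set
  HasNowhereZeroFlow r = ∃[ D ] ∃[ f ] IsNowhereZeroFlow r D f

  φc : UpperReal
  φc = inf (λ r → fromℚ (1ℚ ℚ.+ 1ℚ) ≤ᴿ r × HasNowhereZeroFlow r)

{-# OPTIONS --safe #-}

-- The graph is a wheel with a hub and rim vertices c_j, j ∈ ℤ/(4p+1), in which
-- consecutive rim vertices are joined through a gadget S_j instead of an edge.
-- S_j is a K_{4p} with halves U and W; each vertex of W is also joined to c_j and
-- to c_{j+1}, and U carries 2p extra edges: two triangles and p − 3 digons, of
-- which no cut contains more than 2p − 2.  It is 1-factorised by rotating a
-- factorisation of the gadget, the colour k matching the hub to c_k.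
--
-- In an r-flow with r close to 2 + 1/p the out- and indegree of every vertex v
-- differ by w(v) = ±1, and (2p+1) |w(X)| ≤ |∂X| for every vertex set X.  As
-- |∂S_j| = 4p, every gadget has w(S_j) = 0.  The rim is an odd cycle, so some
-- c_j and c_{j+1} have equal signs.  Let X consist of these two vertices, S_j,
-- and the vertices of that sign in S_{j−1} and S_{j+1}: then |w(X)| = 4p + 2,
-- while |∂X| ≤ 2 (4p² + (2p − 2) + 2p) + 2 < (2p+1)(4p+2).

module Submission where

open import Defs
open import Algebra.Bundles using (CommutativeMonoid)
open import Data.Bool.Base using (Bool; true; false; if_then_else_; not; _∧_; _xor_; T)
open import Data.Bool.Properties using (if-float; not-involutive; T-∧)
open import Data.Empty using (⊥)
open import Data.Fin.Base as Fin using (Fin; zero; suc; toℕ; _↑ˡ_; _↑ʳ_; combine; remQuot)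
open import Data.Fin.Patterns using (0F; 1F; 2F)
open import Data.Fin.Permutation using (permutation)
import Data.Fin.Properties as Fin
open import Data.Integer.Base as ℤ using ()
import Data.Integer.Properties as ℤ
open import Data.Integer.Tactic.RingSolver using () renaming (solve-∀ to ℤ-solve-∀)
open import Data.List.Base using (List; []; _∷_; _++_; allFin; cartesianProduct; filter; foldr; length; lookup; map; tabulate)
open import Data.List.Extrema.Nat using (max; max≤v⁺; v≤max⁺)
open import Data.List.Membership.Propositional using (_∈_)
open import Data.List.Membership.Propositional.Properties using (∈-filter⁺; ∈-filter⁻; ∈-allFin; ∈-cartesianProduct⁺; ∈-lookup)
import Data.List.Relation.Unary.All as All
import Data.List.Relation.Unary.All.Properties as All
open import Data.List.Relation.Unary.AllPairs using (_∷_)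
open import Data.List.Relation.Unary.Any as Any using (here)
open import Data.List.Relation.Unary.Any.Properties using (lookup-index)
open import Data.List.Relation.Unary.Unique.Propositional using (Unique)
open import Data.List.Relation.Unary.Unique.Propositional.Properties using (allFin⁺; cartesianProduct⁺; filter⁺)
open import Data.Nat.Base as ℕ using (ℕ; zero; suc; _+_; _*_; _∸_; _≤_; _<_; _⊔_; _≤ᵇ_; z≤n; s≤s; NonZero)
open import Data.Nat.Divisibility using (_∤_; divides)
open import Data.Nat.DivMod using (_%_; _mod_; %-distribˡ-+; %-distribˡ-*; [m+n]%n≡m%n; [m+kn]%n≡m%n; m<n⇒m%n≡m; m%n%n≡m%n; m%n<n; n%n≡0)
import Data.Nat.Properties as ℕ
open import Data.Nat.Tactic.RingSolver using (solve-∀)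
open import Data.Product.Base using (Σ-syntax; ∃-syntax; ∃₂; _×_; _,_; proj₁; proj₂; uncurry)
open import Data.Rational.Base as ℚ using (ℚ; 0ℚ; 1ℚ; _/_; fromℚᵘ)
import Data.Rational.Properties as ℚ
open import Data.Rational.Solver using () renaming (module +-*-Solver to ℚSolver)
open import Data.Rational.Unnormalised.Base as ℚᵘ using (mkℚᵘ; *≡*; *≤*)
import Data.Rational.Unnormalised.Properties as ℚᵘ
open import Data.Sum.Base using (_⊎_; inj₁; inj₂; [_,_]′)
open import Data.Unit.Base using (tt)
open import Function.Base using (_∘_; id)
open import Function.Bundles using (Equivalence)
open import Level using (0ℓ)
open import Relation.Binary.Definitions using (tri<; tri≈; tri>)
open import Relation.Binary.PropositionalEquality
open import Relation.Nullary.Decidable using (Dec; yes; no; does; dec-true; dec-false; _⊎-dec_)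
open import Relation.Nullary.Negation using (¬_; contradiction)
open import Relation.Unary using (Decidable)

open import Algebra.Properties.CommutativeMonoid.Sum ℕ.+-0-commutativeMonoid
  using (sum; sum-syntax; sum-cong-≗; ∑-distrib-+; ∑-comm; ∑-permute; sum-replicate-zero)
open import Algebra.Properties.CommutativeMonoid.Sum ℚ.+-0-commutativeMonoid
  using () renaming (sum to sumℚ; ∑-distrib-+ to sumℚ-distrib-+)

-- Finite sums

-- The margin explains the triangles. Were U to carry p digons, a cut could contain all 2p extra
-- edges and the last estimate would read 2 (4p² + 2p + 2p) + 2 = (2p+1)(4p+2), an equality that
-- excludes nothing. An odd cycle always has an uncut edge, so each triangle saves one edge; they
-- come as a pair because the two rows of U mirror each other, and a triangle inside a row needs p ≥
-- 3. Oddness of p serves the colouring: x ↦ s - x then has exactly one fixed point on ℤ/p, so a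
-- colour that enters a gadget leaves one vertex in each row of W unmatched, one for either rim
-- vertex. The colour k acts on S_j through the distance j - k alone: 0 for the hub edge, 2p odd
-- distances for the colours that enter S_j, 2p even ones in which c_j is matched backwards. The
-- strict inequality needs one rational above 2 + 2/k that bounds all flows from below. Cut sizes
-- are integers bounded by the number of edges, so a small enough excess over 2 + 2/k cannot alter
-- the inequalities between them.

⟦_⟧ : Bool → ℕ
⟦ true  ⟧ = 1
⟦ false ⟧ = 0

not-partition : ∀ a → ⟦ a ⟧ + ⟦ not a ⟧ ≡ 1
not-partition true  = refl
not-partition false = refl

⟦∧⟧ : ∀ x y → ⟦ x ∧ y ⟧ ≡ ⟦ x ⟧ * ⟦ y ⟧
⟦∧⟧ true  y = sym (ℕ.+-identityʳ ⟦ y ⟧)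
⟦∧⟧ false y = refl

sum-mono : ∀ {n} {f g : Fin n → ℕ} → (∀ i → f i ≤ g i) → sum f ≤ sum g
sum-mono {zero}  f≤g = z≤n
sum-mono {suc n} f≤g = ℕ.+-mono-≤ (f≤g zero) (sum-mono (f≤g ∘ suc))

sum-const : ∀ n c → ∑[ _ < n ] c ≡ n * c
sum-const zero    c = refl
sum-const (suc n) c = cong (c +_) (sum-const n c)

sum-zero : ∀ n → ∑[ _ < n ] 0 ≡ 0
sum-zero = sum-replicate-zero

sum-*ˡ : ∀ {n} c (f : Fin n → ℕ) → ∑[ i < n ] (c * f i) ≡ c * sum f
sum-*ˡ {zero}  c f = sym (ℕ.*-zeroʳ c)
sum-*ˡ {suc n} c f = trans (cong (c * f zero +_) (sum-*ˡ c (f ∘ suc)))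
                           (sym (ℕ.*-distribˡ-+ c (f zero) _))

sum-reindex : ∀ {n} (f : Fin n → ℕ) (σ σ⁻¹ : Fin n → Fin n) →
              (∀ i → σ (σ⁻¹ i) ≡ i) → (∀ i → σ⁻¹ (σ i) ≡ i) →
              ∑[ i < n ] f (σ i) ≡ sum f
sum-reindex f σ σ⁻¹ right left = sym (∑-permute f (permutation σ σ⁻¹ right left))

sum-+ : ∀ m {n} (f : Fin (m + n) → ℕ) →
        sum f ≡ ∑[ i < m ] f (i ↑ˡ n) + ∑[ j < n ] f (m ↑ʳ j)
sum-+ zero    f = refl
sum-+ (suc m) f = trans (cong (f zero +_) (sum-+ m (f ∘ suc))) (sym (ℕ.+-assoc (f zero) _ _))

sum-* : ∀ m {n} (f : Fin (m * n) → ℕ) →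
        sum f ≡ ∑[ i < m ] ∑[ j < n ] f (combine i j)
sum-* zero        f = refl
sum-* (suc m) {n} f = trans (sum-+ n f) (cong (∑[ j < n ] f (j ↑ˡ m * n) +_) (sum-* m (f ∘ (n ↑ʳ_))))

-- Free of subtraction, so that it stays in ℕ. It serves the reflections `s ⊖_`: at the fixed point
-- the expected neighbour is exchanged for another one.
sum-replace : ∀ {n} (x : Fin n) c (f : Fin n → ℕ) →
              ∑[ i < n ] (if does (i Fin.≟ x) then c else f i) + f x ≡ sum f + c
sum-replace {suc n} zero c f =
  swap c (sum (f ∘ suc)) (f zero)
  where
  swap : ∀ a b c → (a + b) + c ≡ (c + b) + a
  swap = solve-∀
sum-replace {suc n} (suc x) c f =
  trans (ℕ.+-assoc (f zero) _ _)
        (trans (cong (f zero +_) (sum-replace x c (f ∘ suc)))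
               (sym (ℕ.+-assoc (f zero) _ c)))

sum-δ : ∀ {n} (x : Fin n) → ∑[ i < n ] ⟦ does (i Fin.≟ x) ⟧ ≡ 1
sum-δ {n} x = trans (sum-cong-≗ λ i → if-⟦⟧ (does (i Fin.≟ x)))
  (ℕ.+-cancelʳ-≡ 0 _ 1 (trans (sum-replace x 1 (λ _ → 0)) (cong (_+ 1) (sum-zero n))))
  where
  if-⟦⟧ : ∀ b → ⟦ b ⟧ ≡ (if b then 1 else 0)
  if-⟦⟧ true  = refl
  if-⟦⟧ false = refl

private variable
  A : Set

listSum : (A → ℕ) → List A → ℕ
listSum F []       = 0
listSum F (x ∷ xs) = F x + listSum F xs

listSum-lookup : ∀ (F : A → ℕ) xs → ∑[ i < length xs ] F (lookup xs i) ≡ listSum F xs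
listSum-lookup F []       = refl
listSum-lookup F (x ∷ xs) = cong (F x +_) (listSum-lookup F xs)

listSum-++ : ∀ (F : A → ℕ) xs ys → listSum F (xs ++ ys) ≡ listSum F xs + listSum F ys
listSum-++ F []       ys = refl
listSum-++ F (x ∷ xs) ys = trans (cong (F x +_) (listSum-++ F xs ys)) (sym (ℕ.+-assoc (F x) _ _))

listSum-map : ∀ {B : Set} (F : B → ℕ) (f : A → B) xs → listSum F (map f xs) ≡ listSum (F ∘ f) xs
listSum-map F f []       = refl
listSum-map F f (x ∷ xs) = cong (F (f x) +_) (listSum-map F f xs)

listSum-tabulate : ∀ {n} (F : A → ℕ) (f : Fin n → A) → listSum F (tabulate f) ≡ ∑[ i < n ] F (f i)
listSum-tabulate {n = zero}  F f = refl
listSum-tabulate {n = suc n} F f = cong (F (f zero) +_) (listSum-tabulate F (f ∘ suc))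

listSum-filter : ∀ {P : A → Set} (P? : Decidable P) (F : A → ℕ) xs →
                 listSum F (filter P? xs) ≡ listSum (λ x → ⟦ does (P? x) ⟧ * F x) xs
listSum-filter P? F []       = refl
listSum-filter P? F (x ∷ xs) with does (P? x)
... | true  = cong₂ _+_ (sym (ℕ.+-identityʳ (F x))) (listSum-filter P? F xs)
... | false = listSum-filter P? F xs

listSum-cartesianProduct : ∀ {B : Set} (F : A × B → ℕ) xs ys →
  listSum F (cartesianProduct xs ys) ≡ listSum (λ x → listSum (λ y → F (x , y)) ys) xs
listSum-cartesianProduct F []       ys = refl
listSum-cartesianProduct F (x ∷ xs) ys =
  trans (listSum-++ F (map (x ,_) ys) _)
        (cong₂ _+_ (listSum-map F (x ,_) ys) (listSum-cartesianProduct F xs ys))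

length-filter-allFin : ∀ {n} {P : Fin n → Set} (P? : Decidable P) →
                       length (filter P? (allFin n)) ≡ ∑[ i < n ] ⟦ does (P? i) ⟧
length-filter-allFin {n} P? = begin
  length (filter P? (allFin n))               ≡⟨ length-listSum (filter P? (allFin n)) ⟩
  listSum (λ _ → 1) (filter P? (allFin n))    ≡⟨ listSum-filter P? (λ _ → 1) (allFin n) ⟩
  listSum (λ i → ⟦ does (P? i) ⟧ * 1) (allFin n) ≡⟨ listSum-tabulate (λ i → ⟦ does (P? i) ⟧ * 1) id ⟩
  ∑[ i < n ] (⟦ does (P? i) ⟧ * 1)            ≡⟨ sum-cong-≗ (λ i → ℕ.*-identityʳ ⟦ does (P? i) ⟧) ⟩
  ∑[ i < n ] ⟦ does (P? i) ⟧                  ∎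
  where
  open ≡-Reasoning
  length-listSum : ∀ {A : Set} (xs : List A) → length xs ≡ listSum (λ _ → 1) xs
  length-listSum []       = refl
  length-listSum (x ∷ xs) = cong suc (length-listSum xs)

lookup-injective : ∀ {xs : List A} → Unique xs → ∀ i j → lookup xs i ≡ lookup xs j → i ≡ j
lookup-injective (x∉xs ∷ u) zero    zero    eq = refl
lookup-injective (x∉xs ∷ u) zero    (suc j) eq = contradiction eq (All.lookup x∉xs (∈-lookup j))
lookup-injective (x∉xs ∷ u) (suc i) zero    eq = contradiction (sym eq) (All.lookup x∉xs (∈-lookup i))
lookup-injective (x∉xs ∷ u) (suc i) (suc j) eq = cong suc (lookup-injective u i j eq)

max-constant : ∀ {n} d (f : Fin (suc n) → ℕ) → (∀ i → f i ≡ d) → max 0 (map f (allFin (suc n))) ≡ d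
max-constant {n} d f f≡d = ℕ.≤-antisym
  (max≤v⁺ z≤n (All.map⁺ (All.tabulate⁺ (ℕ.≤-reflexive ∘ f≡d))))
  (v≤max⁺ 0 (map f (allFin (suc n))) (inj₂ (here (ℕ.≤-reflexive (sym (f≡d zero))))))

⟦⊎-dec⟧ : ∀ {P Q : Set} (P? : Dec P) (Q? : Dec Q) → (P → ¬ Q) →
          ⟦ does (P? ⊎-dec Q?) ⟧ ≡ ⟦ does P? ⟧ + ⟦ does Q? ⟧
⟦⊎-dec⟧ (yes p) (yes q) ¬pq = contradiction q (¬pq p)
⟦⊎-dec⟧ (yes p) (no ¬q) ¬pq = refl
⟦⊎-dec⟧ (no ¬p) (yes q) ¬pq = refl
⟦⊎-dec⟧ (no ¬p) (no ¬q) ¬pq = refl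

-- Graphs with a 1-factorisation

Crosses : ∀ {A : Set} → (A → Bool) → A → A → ℕ
Crosses X u v = ⟦ X u ∧ not (X v) ⟧

module _ (G : Multigraph) where
  open Multigraph G using (#E; end₁; end₂)

  crossing : (Vertex G → Bool) → ℕ
  crossing X = ∑[ e < #E ] (Crosses X (end₁ e) (end₂ e) + Crosses X (end₂ e) (end₁ e))

-- A 1-factorisation, each perfect matching being given by the fixed-point-free
-- involution that exchanges matched vertices.
record Factorisation (n d : ℕ) : Set where
  field
    mate            : Fin d → Fin n → Fin n
    mate-involutive : ∀ k v → mate k (mate k v) ≡ v
    mate-≢          : ∀ k v → mate k v ≢ v

module _ {n d : ℕ} (𝓕 : Factorisation n d) where
  open Factorisation 𝓕

  -- An edge of colour `k` occurs as `(k , v)` for both of its ends `v`. Keeping only the smaller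
  -- end lists it once, while parallel edges stay distinct through their colours.
  Lower : Fin d × Fin n → Set
  Lower (k , v) = v Fin.< mate k v

  lower? : ∀ kv → Dec (Lower kv)
  lower? (k , v) = v Fin.<? mate k v

  edges : List (Fin d × Fin n)
  edges = filter lower? (cartesianProduct (allFin d) (allFin n))

  edges-unique : Unique edges
  edges-unique = filter⁺ lower? (cartesianProduct⁺ (allFin⁺ d) (allFin⁺ n))

  ∈-edges : ∀ {kv} → Lower kv → kv ∈ edges
  ∈-edges lower = ∈-filter⁺ lower? (∈-cartesianProduct⁺ (∈-allFin _) (∈-allFin _)) lower

  edges-lower : ∀ e → Lower (lookup edges e)
  edges-lower e = proj₂ (∈-filter⁻ lower? {xs = cartesianProduct (allFin d) (allFin n)} (∈-lookup e))

  colour : Fin (length edges) → Fin d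
  colour e = proj₁ (lookup edges e)

  factorGraph : Multigraph
  factorGraph = record
    { #V       = n
    ; #E       = length edges
    ; end₁     = λ e → proj₂ (lookup edges e)
    ; end₂     = λ e → mate (colour e) (proj₂ (lookup edges e))
    ; loopless = λ e end₁≡end₂ → mate-≢ (colour e) _ (sym end₁≡end₂)
    }

  open Multigraph factorGraph hiding (Vertex; Edge)

  -- Double counting: every pair of a colour and a vertex is one end of exactly one edge. Degrees
  -- and cuts of the graph are computed from the involutions through this identity alone.
  sum-edges : ∀ (F : Fin d → Fin n → ℕ) →
    ∑[ e < #E ] (F (colour e) (end₁ e) + F (colour e) (end₂ e)) ≡ ∑[ k < d ] ∑[ v < n ] F k v
  sum-edges F = begin
    ∑[ e < #E ] G (lookup edges e)
      ≡⟨ listSum-lookup G edges ⟩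
    listSum G edges
      ≡⟨ listSum-filter lower? G (cartesianProduct (allFin d) (allFin n)) ⟩
    listSum (λ kv → ⟦ does (lower? kv) ⟧ * G kv) (cartesianProduct (allFin d) (allFin n))
      ≡⟨ listSum-cartesianProduct _ (allFin d) (allFin n) ⟩
    listSum (λ k → listSum (λ v → ⟦ does (lower? (k , v)) ⟧ * G (k , v)) (allFin n)) (allFin d)
      ≡⟨ listSum-tabulate (λ k → listSum (λ v → ⟦ does (lower? (k , v)) ⟧ * G (k , v)) (allFin n)) id ⟩
    ∑[ k < d ] listSum (λ v → ⟦ does (lower? (k , v)) ⟧ * G (k , v)) (allFin n)
      ≡⟨ sum-cong-≗ (λ k → listSum-tabulate (λ v → ⟦ does (lower? (k , v)) ⟧ * G (k , v)) id) ⟩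
    ∑[ k < d ] ∑[ v < n ] (⟦ does (lower? (k , v)) ⟧ * G (k , v))
      ≡⟨ sum-cong-≗ one-factor ⟩
    ∑[ k < d ] ∑[ v < n ] F k v ∎
    where
    open ≡-Reasoning
    G : Fin d × Fin n → ℕ
    G (k , v) = F k v + F k (mate k v)

    -- Exactly one of `v` and `mate k v` is the lower end, since `mate k` has no fixed point.
    split : ∀ k v → ⟦ does (lower? (k , v)) ⟧ * F k v + ⟦ does (lower? (k , mate k v)) ⟧ * F k v ≡ F k v
    split k v with Fin.<-cmp v (mate k v)
    ... | tri< v<w _ w≮v
      rewrite dec-true (v Fin.<? mate k v) v<w
            | mate-involutive k v
            | dec-false (mate k v Fin.<? v) w≮v = trans (ℕ.+-identityʳ _) (ℕ.+-identityʳ _)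
    ... | tri≈ _ v≡w _ = contradiction (sym v≡w) (mate-≢ k v)
    ... | tri> v≮w _ w<v
      rewrite dec-false (v Fin.<? mate k v) v≮w
            | mate-involutive k v
            | dec-true (mate k v Fin.<? v) w<v = ℕ.+-identityʳ _

    -- The terms at the upper ends are reindexed along the involution `mate k`, after which both
    -- indicators multiply the same `F k v` and `split` applies.
    one-factor : ∀ k → ∑[ v < n ] (⟦ does (lower? (k , v)) ⟧ * G (k , v)) ≡ ∑[ v < n ] F k v
    one-factor k = begin
      ∑[ v < n ] (⟦ does (lower? (k , v)) ⟧ * G (k , v))
        ≡⟨ sum-cong-≗ (λ v → ℕ.*-distribˡ-+ ⟦ does (lower? (k , v)) ⟧ (F k v) (F k (mate k v))) ⟩
      ∑[ v < n ] (⟦ does (lower? (k , v)) ⟧ * F k v + ⟦ does (lower? (k , v)) ⟧ * F k (mate k v))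
        ≡⟨ ∑-distrib-+ (λ v → ⟦ does (lower? (k , v)) ⟧ * F k v) _ ⟩
      ∑[ v < n ] (⟦ does (lower? (k , v)) ⟧ * F k v)
        + ∑[ v < n ] (⟦ does (lower? (k , v)) ⟧ * F k (mate k v))
        ≡⟨ cong (∑[ v < n ] (⟦ does (lower? (k , v)) ⟧ * F k v) +_)
             (trans (sum-cong-≗ λ v → cong (λ u → ⟦ does (lower? (k , u)) ⟧ * F k (mate k v))
                                           (sym (mate-involutive k v)))
                    (sum-reindex (λ v → ⟦ does (lower? (k , mate k v)) ⟧ * F k v)
                                 (mate k) (mate k) (mate-involutive k) (mate-involutive k))) ⟩
      ∑[ v < n ] (⟦ does (lower? (k , v)) ⟧ * F k v)
        + ∑[ v < n ] (⟦ does (lower? (k , mate k v)) ⟧ * F k v)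
        ≡⟨ ∑-distrib-+ (λ v → ⟦ does (lower? (k , v)) ⟧ * F k v) _ ⟨
      ∑[ v < n ] (⟦ does (lower? (k , v)) ⟧ * F k v + ⟦ does (lower? (k , mate k v)) ⟧ * F k v)
        ≡⟨ sum-cong-≗ (split k) ⟩
      ∑[ v < n ] F k v ∎

  factorGraph-regular : Regular d factorGraph
  factorGraph-regular v = begin
    degree v
      ≡⟨ length-filter-allFin (incident? v) ⟩
    ∑[ e < #E ] ⟦ does (incident? v e) ⟧
      ≡⟨ sum-cong-≗ (λ e → ⟦⊎-dec⟧ (end₁ e Fin.≟ v) (end₂ e Fin.≟ v)
                             λ end₁≡v end₂≡v → loopless e (trans end₁≡v (sym end₂≡v))) ⟩
    ∑[ e < #E ] (⟦ does (end₁ e Fin.≟ v) ⟧ + ⟦ does (end₂ e Fin.≟ v) ⟧)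
      ≡⟨ sum-edges (λ _ u → ⟦ does (u Fin.≟ v) ⟧) ⟩
    ∑[ k < d ] ∑[ u < n ] ⟦ does (u Fin.≟ v) ⟧
      ≡⟨ sum-cong-≗ {d} (λ _ → sum-δ v) ⟩
    ∑[ k < d ] 1
      ≡⟨ trans (sum-const d 1) (ℕ.*-identityʳ d) ⟩
    d ∎
    where open ≡-Reasoning

  mate-incident : ∀ {v e} → Incident v e → end₁ e ≡ v ⊎ end₁ e ≡ mate (colour e) v
  mate-incident (inj₁ end₁≡v) = inj₁ end₁≡v
  mate-incident (inj₂ end₂≡v) = inj₂ (trans (sym (mate-involutive _ _)) (cong (mate _) end₂≡v))

  -- Two edges of one colour that meet in `v` join `v` to the same mate. Their lower ends cannot be
  -- the two different ends of this pair, so they agree, and an entry of `edges` is determined by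
  -- its colour and its lower end.
  colour-proper : IsProperEdgeColouring factorGraph d colour
  colour-proper e f (e≢f , v , v∈e , v∈f) same =
    e≢f (lookup-injective edges-unique e f (cong₂ _,_ same (ends (mate-incident v∈e) (mate-incident v∈f))))
    where
    lower-at : ∀ k → k ≡ colour e → (g : Fin #E) → colour g ≡ k → end₁ g Fin.< mate k (end₁ g)
    lower-at k _ g refl = edges-lower g

    e-lower : end₁ e Fin.< mate (colour e) (end₁ e)
    e-lower = edges-lower e
    f-lower : end₁ f Fin.< mate (colour e) (end₁ f)
    f-lower = lower-at (colour e) refl f (sym same)

    both-lower : ∀ {u w} → u ≡ mate (colour e) w → ¬ (u Fin.< mate (colour e) u × w Fin.< mate (colour e) w)
    both-lower {w = w} refl (u< , w<) =
      Fin.<-asym w< (subst (mate (colour e) w Fin.<_) (mate-involutive (colour e) w) u<)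

    ends : end₁ e ≡ v ⊎ end₁ e ≡ mate (colour e) v → end₁ f ≡ v ⊎ end₁ f ≡ mate (colour f) v →
           end₁ e ≡ end₁ f
    ends (inj₁ p) (inj₁ q) = trans p (sym q)
    ends (inj₁ p) (inj₂ q) = contradiction (f-lower , e-lower)
      (both-lower (trans q (cong₂ mate (sym same) (sym p))))
    ends (inj₂ p) (inj₁ q) = contradiction (e-lower , f-lower)
      (both-lower (trans p (cong (mate (colour e)) (sym q))))
    ends (inj₂ p) (inj₂ q) = trans p (trans (cong (λ k → mate k v) same) (sym q))

  edge-at : ∀ v k → ∃[ e ] (Incident v e × colour e ≡ k)
  edge-at v k with Fin.<-cmp v (mate k v)
  ... | tri< v<w _ _ = Any.index v∈ , inj₁ (cong proj₂ (sym (lookup-index v∈))) , cong proj₁ (sym (lookup-index v∈))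
    where v∈ = ∈-edges {k , v} v<w
  ... | tri≈ _ v≡w _ = contradiction (sym v≡w) (mate-≢ k v)
  ... | tri> _ _ w<v = Any.index w∈ , inj₂ (trans (cong (uncurry mate) (sym (lookup-index w∈))) (mate-involutive k v))
                     , cong proj₁ (sym (lookup-index w∈))
    where w∈ = ∈-edges {k , mate k v} (subst (mate k v Fin.<_) (sym (mate-involutive k v)) w<v)

  -- The `d` edges at one vertex, one of each colour, are pairwise adjacent.
  colours-needed : Vertex factorGraph → ∀ j → EdgeColourable factorGraph j → d ≤ j
  colours-needed v j (c , proper) = Fin.injective⇒≤ {f = c ∘ edge} injective
    where
    edge : Fin d → Fin #E
    edge k = proj₁ (edge-at v k)
    edge-colour : ∀ k → colour (edge k) ≡ k
    edge-colour k = proj₂ (proj₂ (edge-at v k))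
    injective : ∀ {k l} → c (edge k) ≡ c (edge l) → k ≡ l
    injective {k} {l} same with edge k Fin.≟ edge l
    ... | yes e≡f = trans (sym (edge-colour k)) (trans (cong colour e≡f) (edge-colour l))
    ... | no  e≢f = contradiction same
      (proper _ _ (e≢f , v , proj₁ (proj₂ (edge-at v k)) , proj₁ (proj₂ (edge-at v l))))

  -- Each crossing edge is counted from its end inside `X`. Rewriting `end₁` as the mate of `end₂`
  -- gives both summands of an edge the same shape, as `sum-edges` requires.
  sum-crossing : ∀ X → crossing factorGraph X ≡ ∑[ k < d ] ∑[ v < n ] Crosses X v (mate k v)
  sum-crossing X = trans
    (sum-cong-≗ λ e → cong (λ u → Crosses X (end₁ e) (end₂ e) + Crosses X (end₂ e) u)
                           (sym (mate-involutive (colour e) (end₁ e))))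
    (sum-edges λ k v → Crosses X v (mate k v))

factorGraph-class1 : ∀ {n d} (𝓕 : Factorisation n d) → Fin n → Class1 (factorGraph 𝓕)
factorGraph-class1 {suc n} {d} 𝓕 v = subst (IsChromaticIndex (factorGraph 𝓕))
  (sym (max-constant d (Multigraph.degree (factorGraph 𝓕)) (factorGraph-regular 𝓕)))
  ((colour 𝓕 , colour-proper 𝓕) , colours-needed 𝓕 v)

factorisation⇒graph : ∀ {n d r} (𝓕 : Factorisation n d) → Fin n → d ≡ r → (Q : Multigraph → Set) →
  Q (factorGraph 𝓕) → Σ[ G ∈ Multigraph ] (Regular r G × Class1 G × Q G)
factorisation⇒graph 𝓕 v refl Q holds = factorGraph 𝓕 , factorGraph-regular 𝓕 , factorGraph-class1 𝓕 v , holds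

-- Flows and cuts

module Gather (M : CommutativeMonoid 0ℓ 0ℓ) where
  open CommutativeMonoid M renaming (Carrier to C; _∙_ to _⊹_; ε to 0#; refl to ≈-refl; sym to ≈-sym; trans to ≈-trans)
  open import Algebra.Properties.CommutativeMonoid.Sum M
    using () renaming (sum to ∑; sum-cong-≋ to ∑-cong; ∑-comm to ∑-swap; sum-replicate-zero to ∑-zero)

  ∑-δ : ∀ {n} (u : Fin n) (h : Fin n → C) → ∑ (λ v → if does (u Fin.≟ v) then h v else 0#) ≈ h u
  ∑-δ {suc n} zero    h = ≈-trans (∙-congˡ (∑-zero n)) (identityʳ (h zero))
  ∑-δ {suc n} (suc u) h = ≈-trans (identityˡ _) (∑-δ u (h ∘ suc))

  if-∑ : ∀ {n} b (h : Fin n → C) → (if b then ∑ h else 0#) ≈ ∑ (λ i → if b then h i else 0#)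
  if-∑     true  h = ≈-refl
  if-∑ {n} false h = ≈-sym (∑-zero n)

  -- Grouping edges by an end. It is proved for any commutative monoid because it is applied to flow
  -- values in ℚ and to degrees in ℕ.
  ∑-fibres : ∀ {m n} (t : Fin m → Fin n) (X : Fin n → Bool) (g : Fin m → C) →
    ∑ (λ v → if X v then ∑ (λ e → if does (t e Fin.≟ v) then g e else 0#) else 0#)
      ≈ ∑ (λ e → if X (t e) then g e else 0#)
  ∑-fibres {m} {n} t X g =
    ≈-trans (∑-cong {n} λ v → ≈-trans (if-∑ {m} (X v) (λ e → if does (t e Fin.≟ v) then g e else 0#))
                                      (∑-cong {m} λ e → if-swap (X v) (does (t e Fin.≟ v)) (g e)))
    (≈-trans (∑-swap {n} {m} λ v e → if does (t e Fin.≟ v) then (if X v then g e else 0#) else 0#)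
             (∑-cong {m} λ e → ∑-δ (t e) (λ v → if X v then g e else 0#)))
    where
    if-swap : ∀ a b x → (if a then (if b then x else 0#) else 0#) ≈ (if b then (if a then x else 0#) else 0#)
    if-swap true  true  x = ≈-refl
    if-swap true  false x = ≈-refl
    if-swap false true  x = ≈-refl
    if-swap false false x = ≈-refl

fromℚᵘ-homo-+ : ∀ p q → fromℚᵘ p ℚ.+ fromℚᵘ q ≡ fromℚᵘ (p ℚᵘ.+ q)
fromℚᵘ-homo-+ p q = ℚ.toℚᵘ-injective
  (ℚᵘ.≃-trans (ℚ.toℚᵘ-homo-+ (fromℚᵘ p) (fromℚᵘ q))
  (ℚᵘ.≃-trans (ℚᵘ.+-cong (ℚ.toℚᵘ-fromℚᵘ p) (ℚ.toℚᵘ-fromℚᵘ q))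
              (ℚᵘ.≃-sym (ℚ.toℚᵘ-fromℚᵘ (p ℚᵘ.+ q)))))

fromℚᵘ-homo-* : ∀ p q → fromℚᵘ p ℚ.* fromℚᵘ q ≡ fromℚᵘ (p ℚᵘ.* q)
fromℚᵘ-homo-* p q = ℚ.toℚᵘ-injective
  (ℚᵘ.≃-trans (ℚ.toℚᵘ-homo-* (fromℚᵘ p) (fromℚᵘ q))
  (ℚᵘ.≃-trans (ℚᵘ.*-cong (ℚ.toℚᵘ-fromℚᵘ p) (ℚ.toℚᵘ-fromℚᵘ q))
              (ℚᵘ.≃-sym (ℚ.toℚᵘ-fromℚᵘ (p ℚᵘ.* q)))))

opaque
  -- Opaque, so that later goals use its homomorphism laws instead of unfolding the normalisation of
  -- fractions inside `_/_`.
  ι : ℕ → ℚ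
  ι n = ℤ.+ n / 1

opaque
  unfolding ι

  ι-+ : ∀ m n → ι (m ℕ.+ n) ≡ ι m ℚ.+ ι n
  ι-+ m n = sym (trans (fromℚᵘ-homo-+ (mkℚᵘ (ℤ.+ m) 0) (mkℚᵘ (ℤ.+ n) 0))
                       (ℚ.fromℚᵘ-cong {mkℚᵘ (ℤ.+ m) 0 ℚᵘ.+ mkℚᵘ (ℤ.+ n) 0} {mkℚᵘ (ℤ.+ (m ℕ.+ n)) 0}
                                         (*≡* (cross (ℤ.+ m) (ℤ.+ n)))))
    where
    cross : ∀ a b → (a ℤ.* ℤ.+ 1 ℤ.+ b ℤ.* ℤ.+ 1) ℤ.* ℤ.+ 1 ≡ (a ℤ.+ b) ℤ.* (ℤ.+ 1 ℤ.* ℤ.+ 1)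
    cross = ℤ-solve-∀

  ι-* : ∀ m n → ι (m ℕ.* n) ≡ ι m ℚ.* ι n
  ι-* m n = sym (trans (fromℚᵘ-homo-* (mkℚᵘ (ℤ.+ m) 0) (mkℚᵘ (ℤ.+ n) 0))
                       (ℚ.fromℚᵘ-cong {mkℚᵘ (ℤ.+ m) 0 ℚᵘ.* mkℚᵘ (ℤ.+ n) 0} {mkℚᵘ (ℤ.+ (m ℕ.* n)) 0}
                                         (*≡* (cong (ℤ._* ℤ.+ 1) (sym (ℤ.pos-* m n))))))

  ι-1 : ι 1 ≡ 1ℚ
  ι-1 = refl

  ι-0 : ι 0 ≡ 0ℚ
  ι-0 = refl

  ι-*-/ : ∀ m c .{{_ : NonZero m}} → ι m ℚ.* (ℤ.+ c / m) ≡ ι c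
  ι-*-/ (suc m) c = trans (fromℚᵘ-homo-* (mkℚᵘ (ℤ.+ suc m) 0) (mkℚᵘ (ℤ.+ c) m))
                          (ℚ.fromℚᵘ-cong {mkℚᵘ (ℤ.+ suc m) 0 ℚᵘ.* mkℚᵘ (ℤ.+ c) m} {mkℚᵘ (ℤ.+ c) 0}
                                         (*≡* (cross (ℤ.+ suc m) (ℤ.+ c))))
    where
    cross : ∀ a b → (a ℤ.* b) ℤ.* ℤ.+ 1 ≡ b ℤ.* (ℤ.+ 1 ℤ.* a)
    cross = ℤ-solve-∀

  ι-cancel-≤ : ∀ m n → ι m ℚ.≤ ι n → m ℕ.≤ n
  ι-cancel-≤ m n ιm≤ιn with ℚᵘ.≤-respʳ-≃ (ℚ.toℚᵘ-fromℚᵘ (mkℚᵘ (ℤ.+ n) 0))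
                             (ℚᵘ.≤-respˡ-≃ (ℚ.toℚᵘ-fromℚᵘ (mkℚᵘ (ℤ.+ m) 0)) (ℚ.toℚᵘ-mono-≤ ιm≤ιn))
  ... | *≤* m≤n = ℤ.drop‿+≤+ (subst₂ ℤ._≤_ (ℤ.*-identityʳ (ℤ.+ m)) (ℤ.*-identityʳ (ℤ.+ n)) m≤n)

  ι-nonNegative : ∀ n → ℚ.NonNegative (ι n)
  ι-nonNegative n = ℚ.normalize-nonNeg n 1

unit-fraction>0 : ∀ n .{{_ : NonZero n}} → 0ℚ ℚ.< ℤ.+ 1 / n
unit-fraction>0 n = ℚ.positive⁻¹ (ℤ.+ 1 / n) {{ℚ.normalize-pos 1 n}}

sumℚ-mono : ∀ {n} {f g : Fin n → ℚ} → (∀ i → f i ℚ.≤ g i) → sumℚ f ℚ.≤ sumℚ g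
sumℚ-mono {zero}  f≤g = ℚ.≤-refl
sumℚ-mono {suc n} f≤g = ℚ.+-mono-≤ (f≤g zero) (sumℚ-mono (f≤g ∘ suc))

sumℚ-const : ∀ n c → sumℚ {n} (λ _ → c) ≡ ι n ℚ.* c
sumℚ-const zero    c = sym (trans (cong (ℚ._* c) ι-0) (ℚ.*-zeroˡ c))
sumℚ-const (suc n) c = begin
  c ℚ.+ sumℚ {n} (λ _ → c)  ≡⟨ cong₂ ℚ._+_ (sym (ℚ.*-identityˡ c)) (sumℚ-const n c) ⟩
  1ℚ ℚ.* c ℚ.+ ι n ℚ.* c    ≡⟨ ℚ.*-distribʳ-+ c 1ℚ (ι n) ⟨
  (1ℚ ℚ.+ ι n) ℚ.* c        ≡⟨ cong (ℚ._* c) (trans (ι-+ 1 n) (cong (ℚ._+ ι n) ι-1)) ⟨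
  ι (suc n) ℚ.* c           ∎
  where open ≡-Reasoning

sumℚ-indicator : ∀ {n} (b : Fin n → Bool) c →
                 sumℚ (λ i → if b i then c else 0ℚ) ≡ ι (∑[ i < n ] ⟦ b i ⟧) ℚ.* c
sumℚ-indicator {zero}  b c = sym (trans (cong (ℚ._* c) ι-0) (ℚ.*-zeroˡ c))
sumℚ-indicator {suc n} b c with b zero
... | false = trans (ℚ.+-identityˡ _) (sumℚ-indicator (b ∘ suc) c)
... | true  = begin
  c ℚ.+ sumℚ (λ i → if b (suc i) then c else 0ℚ)
    ≡⟨ cong₂ ℚ._+_ (sym (ℚ.*-identityˡ c)) (sumℚ-indicator (b ∘ suc) c) ⟩
  1ℚ ℚ.* c ℚ.+ ι (∑[ i < n ] ⟦ b (suc i) ⟧) ℚ.* c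
    ≡⟨ ℚ.*-distribʳ-+ c 1ℚ (ι (∑[ i < n ] ⟦ b (suc i) ⟧)) ⟨
  (1ℚ ℚ.+ ι (∑[ i < n ] ⟦ b (suc i) ⟧)) ℚ.* c
    ≡⟨ cong (ℚ._* c) (trans (ι-+ 1 (∑[ i < n ] ⟦ b (suc i) ⟧)) (cong (ℚ._+ ι (∑[ i < n ] ⟦ b (suc i) ⟧)) ι-1)) ⟨
  ι (suc (∑[ i < n ] ⟦ b (suc i) ⟧)) ℚ.* c ∎
  where open ≡-Reasoning

foldr-filter : ∀ {A : Set} {P : A → Set} (P? : Decidable P) (g : A → ℚ) {m} (h : Fin m → A) →
               foldr (λ x s → g x ℚ.+ s) 0ℚ (filter P? (tabulate h)) ≡ sumℚ (λ i → if does (P? (h i)) then g (h i) else 0ℚ)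
foldr-filter P? g {zero}  h = refl
foldr-filter P? g {suc m} h with does (P? (h zero))
... | true  = cong (g (h zero) ℚ.+_) (foldr-filter P? g (h ∘ suc))
... | false = trans (foldr-filter P? g (h ∘ suc))
  (sym (ℚ.+-identityˡ (sumℚ (λ i → if does (P? (h (suc i))) then g (h (suc i)) else 0ℚ))))

seq-sumᴿ : ∀ {A : Set} (f : A → ℝ) n xs → seq (sumᴿ (map f xs)) n ≡ foldr (λ x s → seq (f x) n ℚ.+ s) 0ℚ xs
seq-sumᴿ f n []       = refl
seq-sumᴿ f n (x ∷ xs) = cong (seq (f x) n ℚ.+_) (seq-sumᴿ f n xs)

seq-sumᴿ-filter : ∀ {m} {P : Fin m → Set} (P? : Decidable P) (f : Fin m → ℝ) n →
  seq (sumᴿ (map f (filter P? (allFin m)))) n ≡ sumℚ (λ i → if does (P? i) then seq (f i) n else 0ℚ)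
seq-sumᴿ-filter {m} P? f n = trans (seq-sumᴿ f n (filter P? (allFin m))) (foldr-filter P? (λ x → seq (f x) n) id)

-- From real flows to integer cut inequalities

Eventually : (ℕ → Set) → Set
Eventually P = ∃[ N ] (∀ n → N ℕ.≤ n → P n)

-- By finiteness a single index of the Cauchy sequences serves all edges and vertices, so the real
-- flow can be replaced by rational values at that index.
eventually-∀ : ∀ {m} {P : Fin m → ℕ → Set} →
               (∀ i → Eventually (P i)) → Eventually (λ n → ∀ i → P i n)
eventually-∀ {zero}  _  = 0 , λ _ _ ()
eventually-∀ {suc m} ev with ev zero | eventually-∀ (ev ∘ suc)
... | N , P-zero | M , P-suc = N ⊔ M , λ where
  n N⊔M≤n zero    → P-zero n (ℕ.m⊔n≤o⇒m≤o N M N⊔M≤n)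
  n N⊔M≤n (suc i) → P-suc n (ℕ.m⊔n≤o⇒n≤o N M N⊔M≤n) i

module _ (G : Multigraph) where
  open Multigraph G using (#V; #E)

  outflow inflow : Orientation G → (Vertex G → Bool) → ℕ
  outflow D X = ∑[ e < #E ] Crosses X (tail G D e) (head G D e)
  inflow  D X = ∑[ e < #E ] Crosses X (head G D e) (tail G D e)

  module _ (D : Orientation G) (g : Edge G → ℚ) {ρ η : ℚ} (0≤η : 0ℚ ℚ.≤ η)
           (lower : ∀ e → 1ℚ ℚ.≤ g e ℚ.+ η) (upper : ∀ e → g e ℚ.≤ ρ)
           (conserve : ∀ v → sumℚ (λ e → if does (tail G D e Fin.≟ v) then g e else 0ℚ) ℚ.≤
                             sumℚ (λ e → if does (head G D e Fin.≟ v) then g e else 0ℚ) ℚ.+ η)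
           (X : Vertex G → Bool) where

    private
      out into : Edge G → Bool
      out  e = X (tail G D e) ∧ not (X (head G D e))
      into e = X (head G D e) ∧ not (X (tail G D e))

      tailFlow headFlow : ℚ
      tailFlow = sumℚ (λ e → if X (tail G D e) then g e else 0ℚ)
      headFlow = sumℚ (λ e → if X (head G D e) then g e else 0ℚ)

    -- Here `a` and `b` tell whether the tail and the head lie in `X`. An edge leaving `X` carries
    -- at least 1 - η, an edge entering it at most ρ, and any other edge adds equally to the tail
    -- sum and the head sum.
    edgewise : ∀ a b x → 1ℚ ℚ.≤ x ℚ.+ η → x ℚ.≤ ρ →
      (if a ∧ not b then 1ℚ else 0ℚ) ℚ.+ (if b then x else 0ℚ) ℚ.≤
      ((if a then x else 0ℚ) ℚ.+ (if b ∧ not a then ρ else 0ℚ)) ℚ.+ η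
    edgewise true  true  x _ _ = subst₂ ℚ._≤_ (trans (ℚ.+-identityʳ x) (sym (ℚ.+-identityˡ x)))
      (cong (ℚ._+ η) (sym (ℚ.+-identityʳ x))) (ℚ.+-monoʳ-≤ x 0≤η)
    edgewise true  false x 1≤x+η _ = subst₂ ℚ._≤_ (sym (ℚ.+-identityʳ 1ℚ))
      (cong (ℚ._+ η) (sym (ℚ.+-identityʳ x))) 1≤x+η
    edgewise false true  x _ x≤ρ = subst₂ ℚ._≤_ (trans (ℚ.+-identityʳ x) (sym (ℚ.+-identityˡ x)))
      (cong (ℚ._+ η) (sym (ℚ.+-identityˡ ρ))) (ℚ.+-mono-≤ x≤ρ 0≤η)
    edgewise false false x _ _ = subst₂ ℚ._≤_ (sym (ℚ.+-identityˡ 0ℚ)) (sym (ℚ.+-identityˡ η)) 0≤η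

    edge-bound : ι (outflow D X) ℚ.+ headFlow ℚ.≤ (tailFlow ℚ.+ ι (inflow D X) ℚ.* ρ) ℚ.+ ι #E ℚ.* η
    edge-bound = subst₂ ℚ._≤_
      (trans (sumℚ-distrib-+ (λ e → if out e then 1ℚ else 0ℚ) _)
             (cong (ℚ._+ headFlow) (trans (sumℚ-indicator out 1ℚ) (ℚ.*-identityʳ (ι (outflow D X))))))
      (trans (sumℚ-distrib-+ (λ e → (if X (tail G D e) then g e else 0ℚ) ℚ.+ (if into e then ρ else 0ℚ)) (λ _ → η))
             (cong₂ ℚ._+_ (trans (sumℚ-distrib-+ (λ e → if X (tail G D e) then g e else 0ℚ) _)
                                 (cong (tailFlow ℚ.+_) (sumℚ-indicator into ρ)))
                          (sumℚ-const #E η)))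
      (sumℚ-mono λ e → edgewise (X (tail G D e)) (X (head G D e)) (g e) (lower e) (upper e))

    vertex-bound : tailFlow ℚ.≤ headFlow ℚ.+ ι #V ℚ.* η
    vertex-bound = subst₂ ℚ._≤_
      (∑-fibres (tail G D) X g)
      (trans (sumℚ-distrib-+ (λ v → if X v then sumℚ (λ e → if does (head G D e Fin.≟ v) then g e else 0ℚ) else 0ℚ) (λ _ → η))
             (cong₂ ℚ._+_ (∑-fibres (head G D) X g) (sumℚ-const #V η)))
      (sumℚ-mono at)
      where
      open Gather ℚ.+-0-commutativeMonoid
      at : ∀ v → (if X v then sumℚ (λ e → if does (tail G D e Fin.≟ v) then g e else 0ℚ) else 0ℚ) ℚ.≤
                 (if X v then sumℚ (λ e → if does (head G D e Fin.≟ v) then g e else 0ℚ) else 0ℚ) ℚ.+ η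
      at v with X v
      ... | true  = conserve v
      ... | false = subst (0ℚ ℚ.≤_) (sym (ℚ.+-identityˡ η)) 0≤η

    -- What leaves `X` must enter it: at least one unit per leaving edge against at most ρ per
    -- entering edge, with an error η for each edge (lower bounds) and each vertex (conservation).
    -- `headFlow` cancels between the two bounds.
    cut-bound : ι (outflow D X) ℚ.≤ ι (inflow D X) ℚ.* ρ ℚ.+ ι (#E ℕ.+ #V) ℚ.* η
    cut-bound = ℚ.≤-trans (ℚ.≤-reflexive (sym (cancel (ι (outflow D X)) headFlow)))
      (ℚ.≤-trans (ℚ.+-monoˡ-≤ (ℚ.- headFlow) (ℚ.≤-trans edge-bound
                    (ℚ.+-monoˡ-≤ (ι #E ℚ.* η) (ℚ.+-monoˡ-≤ (ι (inflow D X) ℚ.* ρ) vertex-bound))))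
                 (ℚ.≤-reflexive (trans (rearrange headFlow (ι #V) η (ι (inflow D X) ℚ.* ρ) (ι #E))
                   (cong (λ z → ι (inflow D X) ℚ.* ρ ℚ.+ z ℚ.* η) (sym (ι-+ #E #V))))))
      where
      open ℚSolver
      cancel : ∀ a b → (a ℚ.+ b) ℚ.- b ≡ a
      cancel = solve 2 (λ a b → (a :+ b) :- b := a) refl
      rearrange : ∀ h v x i e → (((h ℚ.+ v ℚ.* x) ℚ.+ i) ℚ.+ e ℚ.* x) ℚ.- h ≡ i ℚ.+ (e ℚ.+ v) ℚ.* x
      rearrange = solve 5 (λ h v x i e → (((h :+ v :* x) :+ i) :+ e :* x) :- h := i :+ (e :+ v) :* x) refl

  inflow≤#E : ∀ D X → inflow D X ℕ.≤ #E
  inflow≤#E D X = ℕ.≤-trans (sum-mono λ e → bit (X (head G D e) ∧ not (X (tail G D e))))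
                            (ℕ.≤-reflexive (trans (sum-const #E 1) (ℕ.*-identityʳ #E)))
    where
    bit : ∀ b → ⟦ b ⟧ ℕ.≤ 1
    bit true  = ℕ.≤-refl
    bit false = ℕ.z≤n

-- If `k O ≤ (k + 2) I` failed, it would fail by at least 1, hence by at least `M` after scaling,
-- whereas the hypothesis leaves room for only `I + 1 < M`.
integral-slack : ∀ k M O I → suc I ℕ.< M →
  (k ℕ.* M) ℕ.* O ℕ.≤ suc (((k ℕ.+ 2) ℕ.* M ℕ.+ 1) ℕ.* I) → k ℕ.* O ℕ.≤ (k ℕ.+ 2) ℕ.* I
integral-slack k M O I 1+I<M bound with k ℕ.* O ℕ.≤? (k ℕ.+ 2) ℕ.* I
... | yes kO≤ = kO≤
... | no  kO≰ = contradiction (ℕ.≤-<-trans lhs (ℕ.+-monoʳ-< (M ℕ.* ((k ℕ.+ 2) ℕ.* I)) 1+I<M)) (ℕ.<-irrefl refl)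
  where
  e₁ : ∀ k M O → M ℕ.* (k ℕ.* O) ≡ (k ℕ.* M) ℕ.* O
  e₁ = solve-∀
  e₂ : ∀ k M I → suc (((k ℕ.+ 2) ℕ.* M ℕ.+ 1) ℕ.* I) ≡ M ℕ.* ((k ℕ.+ 2) ℕ.* I) ℕ.+ suc I
  e₂ = solve-∀
  e₃ : ∀ M a → M ℕ.* suc a ≡ M ℕ.* a ℕ.+ M
  e₃ = solve-∀
  lhs : M ℕ.* ((k ℕ.+ 2) ℕ.* I) ℕ.+ M ℕ.≤ M ℕ.* ((k ℕ.+ 2) ℕ.* I) ℕ.+ suc I
  lhs = begin
    M ℕ.* ((k ℕ.+ 2) ℕ.* I) ℕ.+ M               ≡⟨ e₃ M ((k ℕ.+ 2) ℕ.* I) ⟨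
    M ℕ.* suc ((k ℕ.+ 2) ℕ.* I)                 ≤⟨ ℕ.*-monoʳ-≤ M (ℕ.≰⇒> kO≰) ⟩
    M ℕ.* (k ℕ.* O)                             ≡⟨ e₁ k M O ⟩
    (k ℕ.* M) ℕ.* O                             ≤⟨ bound ⟩
    suc (((k ℕ.+ 2) ℕ.* M ℕ.+ 1) ℕ.* I)         ≡⟨ e₂ k M I ⟩
    M ℕ.* ((k ℕ.+ 2) ℕ.* I) ℕ.+ suc I           ∎
    where open ℕ.≤-Reasoning

module _ (G : Multigraph) (k : ℕ) .{{_ : NonZero k}} where
  open Multigraph G using (#V; #E)

  private
    -- With q = 2 + 2/k + 1/kM and errors of total size at most 1/kM, the slack
    -- in the cut inequalities is too small to matter for integers.
    M K S : ℕ
    M = suc (suc #E)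
    K = k ℕ.* M
    S = suc (#E ℕ.+ #V)

    instance
      K≢0 : NonZero K
      K≢0 = ℕ.m*n≢0 k M
      KS≢0 : NonZero (K ℕ.* S)
      KS≢0 = ℕ.m*n≢0 K S

    c q η : ℚ
    c = (ℤ.+ 2 / 1) ℚ.+ (ℤ.+ 2 / k)
    q = c ℚ.+ (ℤ.+ 1 / K)
    η = ℤ.+ 1 / (K ℕ.* S)

    η>0 : 0ℚ ℚ.< η
    η>0 = unit-fraction>0 (K ℕ.* S)

    K*ρ : ι K ℚ.* (q ℚ.- 1ℚ) ≡ ι ((k ℕ.+ 2) ℕ.* M ℕ.+ 1)
    K*ρ = begin
      ι K ℚ.* (q ℚ.- 1ℚ)
        ≡⟨ split (ι K) (ℤ.+ 2 / k) (ℤ.+ 1 / K) ⟩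
      ι K ℚ.+ ι K ℚ.* (ℤ.+ 2 / k) ℚ.+ ι K ℚ.* (ℤ.+ 1 / K)
        ≡⟨ cong₂ (λ x y → ι K ℚ.+ x ℚ.+ y) K*2/k (ι-*-/ K 1) ⟩
      ι K ℚ.+ ι (M ℕ.* 2) ℚ.+ ι 1
        ≡⟨ cong (ℚ._+ ι 1) (ι-+ K (M ℕ.* 2)) ⟨
      ι (K ℕ.+ M ℕ.* 2) ℚ.+ ι 1
        ≡⟨ ι-+ (K ℕ.+ M ℕ.* 2) 1 ⟨
      ι (K ℕ.+ M ℕ.* 2 ℕ.+ 1)
        ≡⟨ cong ι (regroup k M) ⟩
      ι ((k ℕ.+ 2) ℕ.* M ℕ.+ 1) ∎
      where
      open ≡-Reasoning
      open ℚSolver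
      split : ∀ a b d → a ℚ.* ((((1ℚ ℚ.+ 1ℚ) ℚ.+ b) ℚ.+ d) ℚ.- 1ℚ) ≡ a ℚ.+ a ℚ.* b ℚ.+ a ℚ.* d
      split = solve 3 (λ a b d → a :* ((((con 1ℚ :+ con 1ℚ) :+ b) :+ d) :- con 1ℚ) := a :+ a :* b :+ a :* d) refl
      K*2/k : ι K ℚ.* (ℤ.+ 2 / k) ≡ ι (M ℕ.* 2)
      K*2/k = begin
        ι K ℚ.* (ℤ.+ 2 / k)              ≡⟨ cong (λ n → ι n ℚ.* (ℤ.+ 2 / k)) (ℕ.*-comm k M) ⟩
        ι (M ℕ.* k) ℚ.* (ℤ.+ 2 / k)      ≡⟨ cong (ℚ._* (ℤ.+ 2 / k)) (ι-* M k) ⟩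
        (ι M ℚ.* ι k) ℚ.* (ℤ.+ 2 / k)    ≡⟨ ℚ.*-assoc (ι M) (ι k) (ℤ.+ 2 / k) ⟩
        ι M ℚ.* (ι k ℚ.* (ℤ.+ 2 / k))    ≡⟨ cong (ι M ℚ.*_) (ι-*-/ k 2) ⟩
        ι M ℚ.* ι 2                    ≡⟨ ι-* M 2 ⟨
        ι (M ℕ.* 2)                    ∎
      regroup : ∀ k M → k ℕ.* M ℕ.+ M ℕ.* 2 ℕ.+ 1 ≡ (k ℕ.+ 2) ℕ.* M ℕ.+ 1
      regroup = solve-∀

    K*errors : ι K ℚ.* (ι (#E ℕ.+ #V) ℚ.* η) ℚ.≤ 1ℚ
    K*errors = begin
      ι K ℚ.* (ι (#E ℕ.+ #V) ℚ.* η)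
        ≤⟨ ℚ.*-monoˡ-≤-nonNeg (ι K) {{ι-nonNegative K}} (ℚ.*-monoʳ-≤-nonNeg η {{ℚ.nonNegative (ℚ.<⇒≤ η>0)}} step) ⟩
      ι K ℚ.* (ι S ℚ.* η)
        ≡⟨ ℚ.*-assoc (ι K) (ι S) η ⟨
      (ι K ℚ.* ι S) ℚ.* η
        ≡⟨ cong (ℚ._* η) (ι-* K S) ⟨
      ι (K ℕ.* S) ℚ.* η
        ≡⟨ trans (ι-*-/ (K ℕ.* S) 1) ι-1 ⟩
      1ℚ ∎
      where
      open ℚ.≤-Reasoning
      step : ι (#E ℕ.+ #V) ℚ.≤ ι S
      step = subst₂ ℚ._≤_ (ℚ.+-identityˡ (ι (#E ℕ.+ #V))) (sym (trans (ι-+ 1 (#E ℕ.+ #V)) (cong (ℚ._+ ι (#E ℕ.+ #V)) ι-1)))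
        (ℚ.+-monoˡ-≤ (ι (#E ℕ.+ #V)) (ℚ.<⇒≤ (unit-fraction>0 1)))

  rational-cut-bound : ∀ O I → I ℕ.≤ #E →
    ι O ℚ.≤ ι I ℚ.* (q ℚ.- 1ℚ) ℚ.+ ι (#E ℕ.+ #V) ℚ.* η → k ℕ.* O ℕ.≤ (k ℕ.+ 2) ℕ.* I
  rational-cut-bound O I I≤#E bound = integral-slack k M O I (ℕ.s≤s (ℕ.s≤s I≤#E))
    (ι-cancel-≤ (K ℕ.* O) (suc (((k ℕ.+ 2) ℕ.* M ℕ.+ 1) ℕ.* I)) scaled)
    where
    open ℚ.≤-Reasoning
    distribute : ∀ a i r e → a ℚ.* (i ℚ.* r ℚ.+ e) ≡ a ℚ.* e ℚ.+ (a ℚ.* r) ℚ.* i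
    distribute = solve 4 (λ a i r e → a :* (i :* r :+ e) := a :* e :+ (a :* r) :* i) refl
      where open ℚSolver
    scaled : ι (K ℕ.* O) ℚ.≤ ι (suc (((k ℕ.+ 2) ℕ.* M ℕ.+ 1) ℕ.* I))
    scaled = begin
      ι (K ℕ.* O)
        ≡⟨ ι-* K O ⟩
      ι K ℚ.* ι O
        ≤⟨ ℚ.*-monoˡ-≤-nonNeg (ι K) {{ι-nonNegative K}} bound ⟩
      ι K ℚ.* (ι I ℚ.* (q ℚ.- 1ℚ) ℚ.+ ι (#E ℕ.+ #V) ℚ.* η)
        ≡⟨ distribute (ι K) (ι I) (q ℚ.- 1ℚ) (ι (#E ℕ.+ #V) ℚ.* η) ⟩
      ι K ℚ.* (ι (#E ℕ.+ #V) ℚ.* η) ℚ.+ (ι K ℚ.* (q ℚ.- 1ℚ)) ℚ.* ι I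
        ≤⟨ ℚ.+-monoˡ-≤ ((ι K ℚ.* (q ℚ.- 1ℚ)) ℚ.* ι I) K*errors ⟩
      1ℚ ℚ.+ (ι K ℚ.* (q ℚ.- 1ℚ)) ℚ.* ι I
        ≡⟨ cong (λ z → 1ℚ ℚ.+ z ℚ.* ι I) K*ρ ⟩
      1ℚ ℚ.+ ι ((k ℕ.+ 2) ℕ.* M ℕ.+ 1) ℚ.* ι I
        ≡⟨ cong (1ℚ ℚ.+_) (ι-* ((k ℕ.+ 2) ℕ.* M ℕ.+ 1) I) ⟨
      1ℚ ℚ.+ ι (((k ℕ.+ 2) ℕ.* M ℕ.+ 1) ℕ.* I)
        ≡⟨ trans (ι-+ 1 (((k ℕ.+ 2) ℕ.* M ℕ.+ 1) ℕ.* I)) (cong (ℚ._+ ι (((k ℕ.+ 2) ℕ.* M ℕ.+ 1) ℕ.* I)) ι-1) ⟨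
      ι (suc (((k ℕ.+ 2) ℕ.* M ℕ.+ 1) ℕ.* I)) ∎

  -- The flow is evaluated at one index `n`, late enough for every bound and every conservation law
  -- to hold up to its error.
  flow⇒cuts : Above (φc G) q →
    ∃[ D ] (∀ X → k ℕ.* outflow G D X ℕ.≤ (k ℕ.+ 2) ℕ.* inflow G D X)
  flow⇒cuts (r , (_ , D , f , flow) , ε , ε>0 , N , r+ε≤q) = D , λ X →
    rational-cut-bound (outflow G D X) (inflow G D X) (inflow≤#E G D X)
      (cut-bound G D g (ℚ.<⇒≤ η>0) (proj₂ lower n N₁≤n) g-upper g-conserve X)
    where
    open IsNowhereZeroFlow flow renaming (lower to flow-lower; upper to flow-upper; conserve to flow-conserve)

    lower : Eventually (λ n → ∀ e → 1ℚ ℚ.≤ seq (f e) n ℚ.+ η)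
    lower = eventually-∀ (λ e → flow-lower e η η>0)

    -- The error is the margin `ε` of `r <ᴿ fromℚ q` itself, so it disappears when `seq r n + ε` is
    -- bounded by `q`.
    upper : Eventually (λ n → ∀ e → seq (f e) n ℚ.≤ (seq r n ℚ.+ (ℚ.- 1ℚ)) ℚ.+ ε)
    upper = eventually-∀ (λ e → flow-upper e ε ε>0)

    conserve : Eventually (λ n → ∀ v → seq (sumᴿ (map f (E⁺ G D v))) n ℚ.≤ seq (sumᴿ (map f (E⁻ G D v))) n ℚ.+ η)
    conserve = eventually-∀ (λ v → proj₁ (flow-conserve v) η η>0)

    N₁ N₂ N₃ : ℕ
    N₁ = proj₁ lower
    N₂ = proj₁ upper
    N₃ = proj₁ conserve

    n : ℕ
    n = N ⊔ (N₁ ⊔ (N₂ ⊔ N₃))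
    N₁₂₃≤n : N₁ ⊔ (N₂ ⊔ N₃) ℕ.≤ n
    N₁₂₃≤n = ℕ.m≤n⊔m N _
    N₁≤n : N₁ ℕ.≤ n
    N₁≤n = ℕ.m⊔n≤o⇒m≤o N₁ _ N₁₂₃≤n
    N₂₃≤n : N₂ ⊔ N₃ ℕ.≤ n
    N₂₃≤n = ℕ.m⊔n≤o⇒n≤o N₁ _ N₁₂₃≤n

    g : Edge G → ℚ
    g e = seq (f e) n

    g-upper : ∀ e → g e ℚ.≤ q ℚ.- 1ℚ
    g-upper e = begin
      g e                              ≤⟨ proj₂ upper n (ℕ.m⊔n≤o⇒m≤o N₂ _ N₂₃≤n) e ⟩
      (seq r n ℚ.+ (ℚ.- 1ℚ)) ℚ.+ ε     ≡⟨ swap (seq r n) ε ⟩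
      (seq r n ℚ.+ ε) ℚ.- 1ℚ           ≤⟨ ℚ.+-monoˡ-≤ (ℚ.- 1ℚ) (r+ε≤q n (ℕ.m≤m⊔n N _)) ⟩
      q ℚ.- 1ℚ                         ∎
      where
      open ℚ.≤-Reasoning
      swap : ∀ a b → (a ℚ.+ (ℚ.- 1ℚ)) ℚ.+ b ≡ (a ℚ.+ b) ℚ.- 1ℚ
      swap = solve 2 (λ a b → (a :+ (:- con 1ℚ)) :+ b := (a :+ b) :- con 1ℚ) refl
        where open ℚSolver

    g-conserve : ∀ v → sumℚ (λ e → if does (tail G D e Fin.≟ v) then g e else 0ℚ) ℚ.≤
                       sumℚ (λ e → if does (head G D e Fin.≟ v) then g e else 0ℚ) ℚ.+ η
    g-conserve v = subst₂ (λ a b → a ℚ.≤ b ℚ.+ η)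
      (seq-sumᴿ-filter (λ e → tail G D e Fin.≟ v) f n)
      (seq-sumᴿ-filter (λ e → head G D e Fin.≟ v) f n)
      (proj₂ conserve n (ℕ.m⊔n≤o⇒n≤o N₂ _ N₂₃≤n) v)

  no-cuts⇒large-flow-number :
    (∀ D → ¬ (∀ X → k ℕ.* outflow G D X ℕ.≤ (k ℕ.+ 2) ℕ.* inflow G D X)) →
    ((ℤ.+ 2 / 1) ℚ.+ (ℤ.+ 2 / k)) <ᵁ φc G
  no-cuts⇒large-flow-number no-cuts = q
    , subst (ℚ._< q) (ℚ.+-identityʳ c) (ℚ.+-monoʳ-< c (unit-fraction>0 K))
    , λ above → let (D , cuts) = flow⇒cuts above in no-cuts D cuts

-- Arithmetic modulo suc m

module _ {m : ℕ} where
  private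
    n : ℕ
    n = suc m

  infixl 6 _⊕_ _⊖_
  _⊕_ _⊖_ : Fin (suc m) → Fin (suc m) → Fin (suc m)
  x ⊕ y = (toℕ x + toℕ y) mod suc m
  x ⊖ y = (toℕ x + (suc m ∸ toℕ y)) mod suc m

  toℕ-mod : ∀ a → toℕ (a mod n) ≡ a % n
  toℕ-mod a = Fin.toℕ-fromℕ< (m%n<n a n)

  toℕ-⊕ : ∀ x y → toℕ (x ⊕ y) ≡ (toℕ x + toℕ y) % n
  toℕ-⊕ x y = toℕ-mod (toℕ x + toℕ y)

  toℕ-⊖ : ∀ x y → toℕ (x ⊖ y) ≡ (toℕ x + (n ∸ toℕ y)) % n
  toℕ-⊖ x y = toℕ-mod (toℕ x + (n ∸ toℕ y))

  toℕ-% : ∀ (x : Fin n) → toℕ x % n ≡ toℕ x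
  toℕ-% x = m<n⇒m%n≡m (Fin.toℕ<n x)

  %-absorb-+ : ∀ a b → (a % n + b) % n ≡ (a + b) % n
  %-absorb-+ a b = begin
    (a % n + b) % n            ≡⟨ %-distribˡ-+ (a % n) b n ⟩
    (a % n % n + b % n) % n    ≡⟨ cong (λ z → (z + b % n) % n) (m%n%n≡m%n a n) ⟩
    (a % n + b % n) % n        ≡⟨ %-distribˡ-+ a b n ⟨
    (a + b) % n                ∎
    where open ≡-Reasoning

  ⊕-comm : ∀ x y → x ⊕ y ≡ y ⊕ x
  ⊕-comm x y = cong (_mod n) (ℕ.+-comm (toℕ x) (toℕ y))

  ⊕-⊕ : ∀ x y z → toℕ ((x ⊕ y) ⊕ z) ≡ (toℕ x + toℕ y + toℕ z) % n
  ⊕-⊕ x y z = trans (toℕ-⊕ (x ⊕ y) z)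
    (trans (cong (λ a → (a + toℕ z) % n) (toℕ-⊕ x y)) (%-absorb-+ (toℕ x + toℕ y) (toℕ z)))

  ⊕-right-comm : ∀ x y z → (x ⊕ y) ⊕ z ≡ (x ⊕ z) ⊕ y
  ⊕-right-comm x y z = Fin.toℕ-injective
    (trans (⊕-⊕ x y z) (trans (cong (_% n) (swap (toℕ x) (toℕ y) (toℕ z))) (sym (⊕-⊕ x z y))))
    where
    swap : ∀ a b c → a + b + c ≡ a + c + b
    swap = solve-∀

  ⊕-⊖ : ∀ y x → (y ⊕ x) ⊖ x ≡ y
  ⊕-⊖ y x = Fin.toℕ-injective (begin
    toℕ ((y ⊕ x) ⊖ x)                        ≡⟨ toℕ-⊖ (y ⊕ x) x ⟩
    (toℕ (y ⊕ x) + (n ∸ toℕ x)) % n          ≡⟨ cong (λ z → (z + (n ∸ toℕ x)) % n) (toℕ-⊕ y x) ⟩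
    ((toℕ y + toℕ x) % n + (n ∸ toℕ x)) % n  ≡⟨ %-absorb-+ (toℕ y + toℕ x) (n ∸ toℕ x) ⟩
    (toℕ y + toℕ x + (n ∸ toℕ x)) % n        ≡⟨ cong (_% n) (ℕ.+-assoc (toℕ y) (toℕ x) (n ∸ toℕ x)) ⟩
    (toℕ y + (toℕ x + (n ∸ toℕ x))) % n      ≡⟨ cong (λ z → (toℕ y + z) % n) (ℕ.m+[n∸m]≡n (Fin.toℕ≤n x)) ⟩
    (toℕ y + n) % n                          ≡⟨ [m+n]%n≡m%n (toℕ y) n ⟩
    toℕ y % n                                ≡⟨ toℕ-% y ⟩
    toℕ y                                    ∎)
    where open ≡-Reasoning

  ⊖-⊕ : ∀ s x → (s ⊖ x) ⊕ x ≡ s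
  ⊖-⊕ s x = Fin.toℕ-injective (begin
    toℕ ((s ⊖ x) ⊕ x)                        ≡⟨ toℕ-⊕ (s ⊖ x) x ⟩
    (toℕ (s ⊖ x) + toℕ x) % n                ≡⟨ cong (λ z → (z + toℕ x) % n) (toℕ-⊖ s x) ⟩
    ((toℕ s + (n ∸ toℕ x)) % n + toℕ x) % n  ≡⟨ %-absorb-+ (toℕ s + (n ∸ toℕ x)) (toℕ x) ⟩
    (toℕ s + (n ∸ toℕ x) + toℕ x) % n        ≡⟨ cong (_% n) (ℕ.+-assoc (toℕ s) (n ∸ toℕ x) (toℕ x)) ⟩
    (toℕ s + (n ∸ toℕ x + toℕ x)) % n        ≡⟨ cong (λ z → (toℕ s + z) % n) (ℕ.m∸n+n≡m (Fin.toℕ≤n x)) ⟩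
    (toℕ s + n) % n                          ≡⟨ [m+n]%n≡m%n (toℕ s) n ⟩
    toℕ s % n                                ≡⟨ toℕ-% s ⟩
    toℕ s                                    ∎)
    where open ≡-Reasoning

  ⊖-involutive : ∀ s x → s ⊖ (s ⊖ x) ≡ x
  ⊖-involutive s x = begin
    s ⊖ (s ⊖ x)                ≡⟨ cong (_⊖ (s ⊖ x)) (trans (⊕-comm x (s ⊖ x)) (⊖-⊕ s x)) ⟨
    (x ⊕ (s ⊖ x)) ⊖ (s ⊖ x)    ≡⟨ ⊕-⊖ x (s ⊖ x) ⟩
    x                          ∎
    where open ≡-Reasoning

  zero-⊕ : ∀ x → zero ⊕ x ≡ x
  zero-⊕ x = Fin.toℕ-injective (trans (toℕ-⊕ zero x) (toℕ-% x))

  ⊖-self : ∀ x → x ⊖ x ≡ zero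
  ⊖-self x = trans (cong (_⊖ x) (sym (zero-⊕ x))) (⊕-⊖ zero x)

  ⊖≡zero : ∀ x y → x ⊖ y ≡ zero → x ≡ y
  ⊖≡zero x y x⊖y≡0 = trans (sym (⊖-⊕ x y)) (trans (cong (_⊕ y) x⊖y≡0) (zero-⊕ y))

  ⊕-⊖-comm : ∀ x y z → (x ⊕ y) ⊖ z ≡ (x ⊖ z) ⊕ y
  ⊕-⊖-comm x y z = begin
    (x ⊕ y) ⊖ z                ≡⟨ cong (λ w → (w ⊕ y) ⊖ z) (⊖-⊕ x z) ⟨
    (((x ⊖ z) ⊕ z) ⊕ y) ⊖ z    ≡⟨ cong (_⊖ z) (⊕-right-comm (x ⊖ z) z y) ⟩
    (((x ⊖ z) ⊕ y) ⊕ z) ⊖ z    ≡⟨ ⊕-⊖ ((x ⊖ z) ⊕ y) z ⟩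
    (x ⊖ z) ⊕ y                ∎
    where open ≡-Reasoning

  -- `next zero` plays the part of the residue 1, which has no uniform constructor form because `m`
  -- may be 0.
  next prev : Fin (suc m) → Fin (suc m)
  next x = (toℕ x + 1) mod suc m
  prev x = x ⊖ next zero

  next-toℕ : ∀ x → toℕ x < m → toℕ (next x) ≡ suc (toℕ x)
  next-toℕ x x<m = trans (toℕ-mod (toℕ x + 1))
    (trans (cong (_% n) (ℕ.+-comm (toℕ x) 1)) (m<n⇒m%n≡m (ℕ.s≤s x<m)))

  next≡⊕ : ∀ x → next x ≡ x ⊕ next zero
  next≡⊕ x = Fin.toℕ-injective (begin
    toℕ (next x)               ≡⟨ toℕ-mod (toℕ x + 1) ⟩
    (toℕ x + 1) % n            ≡⟨ cong (_% n) (ℕ.+-comm (toℕ x) 1) ⟩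
    (1 + toℕ x) % n            ≡⟨ %-absorb-+ 1 (toℕ x) ⟨
    (1 % n + toℕ x) % n        ≡⟨ cong (_% n) (ℕ.+-comm (1 % n) (toℕ x)) ⟩
    (toℕ x + 1 % n) % n        ≡⟨ cong (λ z → (toℕ x + z) % n) (toℕ-mod 1) ⟨
    (toℕ x + toℕ (next zero)) % n ≡⟨ toℕ-⊕ x (next zero) ⟨
    toℕ (x ⊕ next zero)        ∎)
    where open ≡-Reasoning

  next-prev : ∀ x → next (prev x) ≡ x
  next-prev x = trans (next≡⊕ (prev x)) (⊖-⊕ x (next zero))

  prev-next : ∀ x → prev (next x) ≡ x
  prev-next x = trans (cong prev (next≡⊕ x)) (⊕-⊖ x (next zero))

  next-⊖ : ∀ x y → next x ⊖ y ≡ next (x ⊖ y)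
  next-⊖ x y = trans (cong (_⊖ y) (next≡⊕ x))
    (trans (⊕-⊖-comm x (next zero) y) (sym (next≡⊕ (x ⊖ y))))

  prev-⊖ : ∀ x y → prev x ⊖ y ≡ prev (x ⊖ y)
  prev-⊖ x y = trans (sym (prev-next (prev x ⊖ y)))
    (cong prev (trans (sym (next-⊖ (prev x) y)) (cong (_⊖ y) (next-prev x))))

  module Halving (h : ℕ) (odd : _≡_ {A = ℕ} (suc m) (suc (h + h))) where
    -- Multiplication by `suc h`, the inverse of 2 modulo `suc (h + h)`.
    halve : Fin (suc m) → Fin (suc m)
    halve s = (toℕ s * suc h) mod suc m

    private
      double : ∀ a → a * suc h + a * suc h ≡ a + a * n
      double a = trans (rearrange a h) (cong (λ z → a + a * z) (sym odd))
        where
        rearrange : ∀ a h → a * suc h + a * suc h ≡ a + a * suc (h + h)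
        rearrange = solve-∀

    halve-⊕-halve : ∀ s → halve s ⊕ halve s ≡ s
    halve-⊕-halve s = Fin.toℕ-injective (begin
      toℕ (halve s ⊕ halve s)                        ≡⟨ toℕ-⊕ (halve s) (halve s) ⟩
      (toℕ (halve s) + toℕ (halve s)) % n            ≡⟨ cong (λ z → (z + z) % n) (toℕ-mod (toℕ s * suc h)) ⟩
      ((toℕ s * suc h) % n + (toℕ s * suc h) % n) % n ≡⟨ %-distribˡ-+ (toℕ s * suc h) (toℕ s * suc h) n ⟨
      (toℕ s * suc h + toℕ s * suc h) % n          ≡⟨ cong (_% n) (double (toℕ s)) ⟩
      (toℕ s + toℕ s * n) % n                      ≡⟨ [m+kn]%n≡m%n (toℕ s) (toℕ s) n ⟩
      toℕ s % n                                    ≡⟨ toℕ-% s ⟩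
      toℕ s                                        ∎)
      where open ≡-Reasoning

    halve-double : ∀ x → halve (x ⊕ x) ≡ x
    halve-double x = Fin.toℕ-injective (begin
      toℕ (halve (x ⊕ x))                                ≡⟨ toℕ-mod (toℕ (x ⊕ x) * suc h) ⟩
      (toℕ (x ⊕ x) * suc h) % n                         ≡⟨ %-distribˡ-* (toℕ (x ⊕ x)) (suc h) n ⟩
      (toℕ (x ⊕ x) % n * (suc h % n)) % n               ≡⟨ cong (λ z → (z * (suc h % n)) % n) reduce ⟩
      ((toℕ x + toℕ x) % n * (suc h % n)) % n           ≡⟨ %-distribˡ-* (toℕ x + toℕ x) (suc h) n ⟨
      ((toℕ x + toℕ x) * suc h) % n                     ≡⟨ cong (_% n) (trans (ℕ.*-distribʳ-+ (suc h) (toℕ x) (toℕ x)) (double (toℕ x))) ⟩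
      (toℕ x + toℕ x * n) % n                           ≡⟨ [m+kn]%n≡m%n (toℕ x) (toℕ x) n ⟩
      toℕ x % n                                         ≡⟨ toℕ-% x ⟩
      toℕ x                                             ∎)
      where
      open ≡-Reasoning
      reduce : toℕ (x ⊕ x) % n ≡ (toℕ x + toℕ x) % n
      reduce = trans (toℕ-% (x ⊕ x)) (toℕ-⊕ x x)

sum-⊖ : ∀ {m} (x : Fin (suc m)) (f : Fin (suc m) → ℕ) → sum (λ s → f (s ⊖ x)) ≡ sum f
sum-⊖ x f = sum-reindex f (_⊖ x) (_⊕ x) (λ y → ⊕-⊖ y x) (λ s → ⊖-⊕ s x)

sum-reflect : ∀ {m} (s : Fin (suc m)) (f : Fin (suc m) → ℕ) → sum (λ x → f (s ⊖ x)) ≡ sum f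
sum-reflect s f = sum-reindex f (s ⊖_) (s ⊖_) (⊖-involutive s) (⊖-involutive s)

-- The twisted gadget

-- U r x and W r x are the vertices in row r and column x of the two halves of a
-- gadget; only the W half is joined to the rim.
data Cell (n : ℕ) : Set where
  U W : Bool → Fin n → Cell n

-- The colours as seen from one gadget: in a used colour both rim vertices next to
-- it are matched into the gadget, in the others neither is.
data Local (n : ℕ) : Set where
  straight   : Local n
  cross used : Bool → Fin n → Local n

cellSum : ∀ {n} → (Cell n → ℕ) → ℕ
cellSum f = (sum (f ∘ U false) + sum (f ∘ U true)) + (sum (f ∘ W false) + sum (f ∘ W true))

rowSum : ∀ {n} → (Bool → Fin n → ℕ) → ℕ
rowSum F = sum (F false) + sum (F true)

localSum : ∀ {n} → (Local n → ℕ) → ℕ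
localSum F = F straight + ((sum (F ∘ used false) + sum (F ∘ used true)) + (sum (F ∘ cross false) + sum (F ∘ cross true)))

-- The rungs (0, x) — (1, ρ x) join two copies of the fixed points of τ; the
-- other points are matched by τ in row 0 and by its ρ-conjugate in row 1.
module _ {n : ℕ} (τ ρ : Fin n → Fin n) where
  prism : Bool → Fin n → Cell n
  prism false x = if does (τ x Fin.≟ x) then U true (ρ x) else U false (τ x)
  prism true  y = if does (τ (ρ y) Fin.≟ ρ y) then U false (ρ y) else U true (ρ (τ (ρ y)))

  module _ (τ-involutive : ∀ x → τ (τ x) ≡ x) (ρ-involutive : ∀ x → ρ (ρ x) ≡ x) where
    -- A rung is undone because `ρ` is an involution and its end in row 1 is fixed by the conjugate
    -- of `τ`; other points move within their row. Involutivity and the absence of fixed points come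
    -- from the same case split, hence the joint statement.
    prism-mate : ∀ r x → ∃₂ λ s y → prism r x ≡ U s y × prism s y ≡ U r x × U s y ≢ U r x
    prism-mate false x with τ x Fin.≟ x
    ... | yes τx≡x = true , ρ x , refl , back , λ ()
      where
      back : prism true (ρ x) ≡ U false x
      back rewrite ρ-involutive x | dec-true (τ x Fin.≟ x) τx≡x = refl
    ... | no  τx≢x = false , τ x , refl , back , λ { eq → τx≢x (U-injective eq) }
      where
      U-injective : ∀ {r s} {x y : Fin n} → U r x ≡ U s y → x ≡ y
      U-injective refl = refl
      back : prism false (τ x) ≡ U false x
      back rewrite τ-involutive x | dec-false (x Fin.≟ τ x) (τx≢x ∘ sym) = refl
    prism-mate true y with τ (ρ y) Fin.≟ ρ y
    ... | yes fixed = false , ρ y , refl , back , λ ()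
      where
      back : prism false (ρ y) ≡ U true y
      back rewrite dec-true (τ (ρ y) Fin.≟ ρ y) fixed | ρ-involutive y = refl
    ... | no moved = true , ρ (τ (ρ y)) , refl , back
                   , λ { eq → moved (trans (sym (ρ-involutive _)) (cong ρ (U-injective eq))) }
      where
      U-injective : ∀ {r s} {x y : Fin n} → U r x ≡ U s y → x ≡ y
      U-injective refl = refl
      back : prism true (ρ (τ (ρ y))) ≡ U true y
      back rewrite ρ-involutive (τ (ρ y)) | τ-involutive (ρ y)
                 | dec-false (ρ y Fin.≟ τ (ρ y)) (moved ∘ sym) | ρ-involutive y = refl

module _ {q : ℕ} where
  private
    p : ℕ
    p = suc (suc (suc q))

  transpose : Fin 3 → Fin (suc (suc (suc q))) → Fin (suc (suc (suc q)))
  transpose 0F 0F = 0F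
  transpose 0F 1F = 2F
  transpose 0F 2F = 1F
  transpose 1F 0F = 2F
  transpose 1F 1F = 1F
  transpose 1F 2F = 0F
  transpose 2F 0F = 1F
  transpose 2F 1F = 0F
  transpose 2F 2F = 2F
  transpose t  (suc (suc (suc x))) = suc (suc (suc x))

  transpose-involutive : ∀ t x → transpose t (transpose t x) ≡ x
  transpose-involutive 0F 0F = refl
  transpose-involutive 0F 1F = refl
  transpose-involutive 0F 2F = refl
  transpose-involutive 1F 0F = refl
  transpose-involutive 1F 1F = refl
  transpose-involutive 1F 2F = refl
  transpose-involutive 2F 0F = refl
  transpose-involutive 2F 1F = refl
  transpose-involutive 2F 2F = refl
  transpose-involutive 0F (suc (suc (suc x))) = refl
  transpose-involutive 1F (suc (suc (suc x))) = refl
  transpose-involutive 2F (suc (suc (suc x))) = refl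

  -- Each of the columns 0, 1, 2 is fixed by one transposition and moved by the other two, so these
  -- three matchings together form a triangular prism there and triple the rung in every other
  -- column. They replace the single matching of the rungs from `x` to `0F ⊖ x`; what this adds is
  -- the two triangles and the p - 3 digons.
  twisted : Fin 3 → Bool → Fin p → Cell p
  twisted t = prism (transpose t) (0F ⊖_)

  -- The edges inside U are shared out by type. `used false s` takes the edges within rows whose
  -- columns add up to `s`, with one class of rungs, column sum 1, closing the gaps at fixed points.
  -- `used true` takes the rungs of column sum 2 and more. `straight` and the two remaining
  -- `used true` colours take the three matchings `twisted`.
  colour-τ : Local p → Fin p → Fin p
  colour-τ straight = transpose 2F
  colour-τ (cross _ _)              = id
  colour-τ (used false s)           = s ⊖_
  colour-τ (used true 0F)           = transpose 0F
  colour-τ (used true 1F)           = transpose 1F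
  colour-τ (used true (suc (suc s))) = id

  colour-ρ : Local p → Fin p
  colour-ρ (used false s)            = 1F
  colour-ρ (used true (suc (suc s))) = suc (suc s)
  colour-ρ _                         = 0F

  -- inj₂ false is the rim vertex to the left of the gadget, inj₂ true the one to
  -- its right.
  twistedPartner : Local p → Cell p → Cell p ⊎ Bool
  twistedPartner (cross b d) (U r x) = inj₁ (W (r xor b) (d ⊖ x))
  twistedPartner (cross b d) (W r x) = inj₁ (U (r xor b) (d ⊖ x))
  twistedPartner straight (W r x) = inj₁ (W (not r) x)
  twistedPartner (used b s)  (W r x) = if does (s ⊖ x Fin.≟ x) then inj₂ (r xor b) else inj₁ (W (r xor b) (s ⊖ x))
  twistedPartner l@straight (U r x) = inj₁ (prism (colour-τ l) (colour-ρ l ⊖_) r x)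
  twistedPartner l@(used _ _) (U r x) = inj₁ (prism (colour-τ l) (colour-ρ l ⊖_) r x)

  colour-τ-involutive : ∀ l x → colour-τ l (colour-τ l x) ≡ x
  colour-τ-involutive straight x = transpose-involutive 2F x
  colour-τ-involutive (cross _ _)               x = refl
  colour-τ-involutive (used false s)            x = ⊖-involutive s x
  colour-τ-involutive (used true 0F)            x = transpose-involutive 0F x
  colour-τ-involutive (used true 1F)            x = transpose-involutive 1F x
  colour-τ-involutive (used true (suc (suc s))) x = refl

  xor-cancel : ∀ r b → (r xor b) xor b ≡ r
  xor-cancel true  true  = refl
  xor-cancel true  false = refl
  xor-cancel false true  = refl
  xor-cancel false false = refl

  inj₁-injective : ∀ {c c′ : Cell p} → inj₁ {B = Bool} c ≡ inj₁ c′ → c ≡ c′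
  inj₁-injective refl = refl

  twistedPartner-involutive : ∀ l c {c′} → twistedPartner l c ≡ inj₁ c′ → twistedPartner l c′ ≡ inj₁ c
  twistedPartner-involutive (cross b d) (U r x) refl = cong₂ (λ s y → inj₁ (U s y)) (xor-cancel r b) (⊖-involutive d x)
  twistedPartner-involutive (cross b d) (W r x) refl = cong₂ (λ s y → inj₁ (W s y)) (xor-cancel r b) (⊖-involutive d x)
  twistedPartner-involutive straight (W r x) refl = cong (λ s → inj₁ (W s x)) (not-involutive r)
  twistedPartner-involutive (used b s)  (W r x) eq with s ⊖ x Fin.≟ x
  twistedPartner-involutive (used b s)  (W r x) () | yes _
  twistedPartner-involutive (used b s)  (W r x) refl | no moved
    rewrite ⊖-involutive s x | dec-false (x Fin.≟ s ⊖ x) (moved ∘ sym) | xor-cancel r b = refl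
  twistedPartner-involutive l@straight (U r x) eq
    with prism-mate (colour-τ l) (colour-ρ l ⊖_) (colour-τ-involutive l) (⊖-involutive (colour-ρ l)) r x
  ... | s , y , there , back , _ rewrite sym (inj₁-injective eq) | there = cong inj₁ back
  twistedPartner-involutive l@(used _ _) (U r x) eq
    with prism-mate (colour-τ l) (colour-ρ l ⊖_) (colour-τ-involutive l) (⊖-involutive (colour-ρ l)) r x
  ... | s , y , there , back , _ rewrite sym (inj₁-injective eq) | there = cong inj₁ back

  twistedPartner-≢ : ∀ l c → twistedPartner l c ≢ inj₁ c
  twistedPartner-≢ (cross b d) (U r x) ()
  twistedPartner-≢ (cross b d) (W r x) ()
  twistedPartner-≢ straight (W true x) ()
  twistedPartner-≢ straight (W false x) ()
  twistedPartner-≢ (used b s)  (W r x) eq with s ⊖ x Fin.≟ x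
  twistedPartner-≢ (used b s)  (W r x) () | yes _
  twistedPartner-≢ (used b s)  (W r x) eq | no moved = moved (W-injective eq)
    where
    W-injective : ∀ {r s} {x y : Fin p} → inj₁ {B = Bool} (W r x) ≡ inj₁ (W s y) → x ≡ y
    W-injective refl = refl
  twistedPartner-≢ l@straight (U r x) eq
    with prism-mate (colour-τ l) (colour-ρ l ⊖_) (colour-τ-involutive l) (⊖-involutive (colour-ρ l)) r x
  ... | s , y , there , _ , distinct = distinct (trans (sym there) (inj₁-injective eq))
  twistedPartner-≢ l@(used _ _) (U r x) eq
    with prism-mate (colour-τ l) (colour-ρ l ⊖_) (colour-τ-involutive l) (⊖-involutive (colour-ρ l)) r x
  ... | s , y , there , _ , distinct = distinct (trans (sym there) (inj₁-injective eq))

  module _ (f : Cell p → ℕ) (e : Bool → ℕ) where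
    private
      F : Cell p ⊎ Bool → ℕ
      F = [ f , e ]′

    -- As `s` varies, `s ⊖ x` meets each column once; only at column `x` does the edge leave for the
    -- rim instead of reaching `W (r xor b) x`.
    sum-used-W : ∀ b r x → ∑[ s < p ] F (twistedPartner (used b s) (W r x)) + f (W (r xor b) x)
                         ≡ sum (f ∘ W (r xor b)) + e (r xor b)
    sum-used-W b r x = trans
      (cong (_+ f (W (r xor b) x))
        (trans (sum-cong-≗ {p} λ s → if-float F (does (s ⊖ x Fin.≟ x)) {inj₂ (r xor b)} {inj₁ (W (r xor b) (s ⊖ x))})
               (sum-⊖ x (λ y → if does (y Fin.≟ x) then e (r xor b) else f (W (r xor b) y)))))
      (sum-replace x (e (r xor b)) (f ∘ W (r xor b)))

    -- With arbitrary weights `f` and `e`, this determines the neighbourhood: every other cell once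
    -- and both rim vertices. The `used` colours omit the cell itself and the cell opposite in the
    -- same column; `straight` restores the latter.
    twistedPartner-sum-W : ∀ r x → localSum (λ l → F (twistedPartner l (W r x))) + f (W r x) ≡ cellSum f + (e false + e true)
    twistedPartner-sum-W r x = begin
      localSum (λ l → F (twistedPartner l (W r x))) + f (W r x)
        ≡⟨ cong (λ z → (f (W (not r) x) + ((u false + u true) + z)) + f (W r x))
             (cong₂ _+_ (sum-⊖ x (f ∘ U (r xor false))) (sum-⊖ x (f ∘ U (r xor true)))) ⟩
      (f (W (not r) x) + ((u false + u true) + (sum (f ∘ U (r xor false)) + sum (f ∘ U (r xor true))))) + f (W r x)
        ≡⟨ by-row r refl ⟩
      cellSum f + (e false + e true) ∎
      where
      open ≡-Reasoning
      u : Bool → ℕ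
      u b = ∑[ s < p ] F (twistedPartner (used b s) (W r x))
      arrange₀ : ∀ wt u₀ u₁ c₀ c₁ wf → (wt + ((u₀ + u₁) + (c₀ + c₁))) + wf ≡ (c₀ + c₁) + ((u₀ + wf) + (u₁ + wt))
      arrange₀ = solve-∀
      arrange₁ : ∀ wf u₀ u₁ c₀ c₁ wt → (wf + ((u₀ + u₁) + (c₀ + c₁))) + wt ≡ (c₁ + c₀) + ((u₁ + wf) + (u₀ + wt))
      arrange₁ = solve-∀
      collect : ∀ c a b x y → c + ((a + x) + (b + y)) ≡ (c + (a + b)) + (x + y)
      collect = solve-∀
      by-row : ∀ r′ → r′ ≡ r →
        (f (W (not r) x) + ((u false + u true) + (sum (f ∘ U (r xor false)) + sum (f ∘ U (r xor true))))) + f (W r x)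
          ≡ cellSum f + (e false + e true)
      by-row false refl = trans (arrange₀ (f (W true x)) (u false) (u true) (sum (f ∘ U false)) (sum (f ∘ U true)) (f (W false x)))
        (trans (cong₂ (λ a b → (sum (f ∘ U false) + sum (f ∘ U true)) + (a + b)) (sum-used-W false false x) (sum-used-W true false x))
               (collect (sum (f ∘ U false) + sum (f ∘ U true)) (sum (f ∘ W false)) (sum (f ∘ W true)) (e false) (e true)))
      by-row true  refl = trans (arrange₁ (f (W false x)) (u false) (u true) (sum (f ∘ U true)) (sum (f ∘ U false)) (f (W true x)))
        (trans (cong₂ (λ a b → (sum (f ∘ U false) + sum (f ∘ U true)) + (a + b)) (sum-used-W true true x) (sum-used-W false true x))
               (collect (sum (f ∘ U false) + sum (f ∘ U true)) (sum (f ∘ W false)) (sum (f ∘ W true)) (e false) (e true)))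

    sum-used-U : ∀ r x → ∑[ s < p ] F (twistedPartner (used false s) (U r x)) + f (U r x)
                       ≡ sum (f ∘ U r) + f (U (not r) (1F ⊖ x))
    sum-used-U false x = trans
      (cong (_+ f (U false x))
        (trans (sum-cong-≗ {p} λ s → if-float f (does (s ⊖ x Fin.≟ x)) {U true (1F ⊖ x)} {U false (s ⊖ x)})
               (sum-⊖ x (λ y → if does (y Fin.≟ x) then f (U true (1F ⊖ x)) else f (U false y)))))
      (sum-replace x (f (U true (1F ⊖ x))) (f ∘ U false))
    sum-used-U true y = begin
      ∑[ s < p ] F (twistedPartner (used false s) (U true y)) + f (U true y)
        ≡⟨ cong₂ _+_ (trans (sum-cong-≗ {p} λ s → if-float f (does (s ⊖ (1F ⊖ y) Fin.≟ 1F ⊖ y)) {U false (1F ⊖ y)} {U true (1F ⊖ (s ⊖ (1F ⊖ y)))})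
                            (sum-⊖ (1F ⊖ y) (λ z → if does (z Fin.≟ 1F ⊖ y) then f (U false (1F ⊖ y)) else f (U true (1F ⊖ z)))))
                     (cong (f ∘ U true) (sym (⊖-involutive 1F y))) ⟩
      ∑[ z < p ] (if does (z Fin.≟ 1F ⊖ y) then f (U false (1F ⊖ y)) else f (U true (1F ⊖ z))) + f (U true (1F ⊖ (1F ⊖ y)))
        ≡⟨ sum-replace (1F ⊖ y) (f (U false (1F ⊖ y))) (λ z → f (U true (1F ⊖ z))) ⟩
      ∑[ z < p ] f (U true (1F ⊖ z)) + f (U false (1F ⊖ y))
        ≡⟨ cong (_+ f (U false (1F ⊖ y))) (sum-reflect 1F (f ∘ U true)) ⟩
      sum (f ∘ U true) + f (U false (1F ⊖ y)) ∎
      where open ≡-Reasoning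

    sum-twisted : Bool → Fin p → ℕ
    sum-twisted r x = ∑[ t < 3 ] f (twisted t r x)

    prism-rungs : ∀ (ρ : Fin p → Fin p) r x → prism id ρ r x ≡ U (not r) (ρ x)
    prism-rungs ρ false x rewrite dec-true (x Fin.≟ x) refl = refl
    prism-rungs ρ true  x rewrite dec-true (ρ x Fin.≟ ρ x) refl = refl

    -- The neighbours of a U cell are all other cells, except that its rung of column sum 0 is
    -- exchanged for three twisted edges. The omitted terms stand on the left.
    twistedPartner-sum-U : ∀ r x → localSum (λ l → F (twistedPartner l (U r x))) + f (U r x) + f (U (not r) (0F ⊖ x))
                          ≡ cellSum f + sum-twisted r x
    twistedPartner-sum-U r x = begin
      localSum (λ l → F (twistedPartner l (U r x))) + f (U r x) + f (U (not r) (0F ⊖ x))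
        -- `straight`, `used true 0F` and `used true 1F` supply `tw 2F`, `tw 0F` and `tw 1F`; the
        -- remaining `used true` colours are pure rungs, and the `cross` colours run over all of W.
        ≡⟨ cong₂ (λ R C → (tw 2F + ((A′ + (tw 0F + (tw 1F + R))) + C)) + f (U r x) + f (U (not r) (0F ⊖ x)))
             (sum-cong-≗ λ s → cong f (prism-rungs (suc (suc s) ⊖_) r x))
             (cong₂ _+_ (sum-⊖ x (f ∘ W (r xor false))) (sum-⊖ x (f ∘ W (r xor true)))) ⟩
      (tw 2F + ((A′ + (tw 0F + (tw 1F + R′))) + (sum (f ∘ W (r xor false)) + sum (f ∘ W (r xor true)))))
        + f (U r x) + f (U (not r) (0F ⊖ x))
        ≡⟨ arrange (tw 0F) (tw 1F) (tw 2F) A′ R′ (sum (f ∘ W (r xor false)) + sum (f ∘ W (r xor true))) (f (U r x)) (f (U (not r) (0F ⊖ x))) ⟩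
      (((A′ + f (U r x)) + (f (U (not r) (0F ⊖ x)) + R′)) + (sum (f ∘ W (r xor false)) + sum (f ∘ W (r xor true)))) + sum-twisted r x
        ≡⟨ cong (λ z → ((z + (f (U (not r) (0F ⊖ x)) + R′)) + (sum (f ∘ W (r xor false)) + sum (f ∘ W (r xor true)))) + sum-twisted r x)
             (sum-used-U r x) ⟩
      (((sum (f ∘ U r) + f (U (not r) (1F ⊖ x))) + (f (U (not r) (0F ⊖ x)) + R′))
        + (sum (f ∘ W (r xor false)) + sum (f ∘ W (r xor true)))) + sum-twisted r x
        ≡⟨ cong (λ z → (z + (sum (f ∘ W (r xor false)) + sum (f ∘ W (r xor true)))) + sum-twisted r x)
             (trans (regroup (sum (f ∘ U r)) (f (U (not r) (1F ⊖ x))) (f (U (not r) (0F ⊖ x))) R′)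
                    (cong (sum (f ∘ U r) +_) (sum-⊖ x (f ∘ U (not r))))) ⟩
      ((sum (f ∘ U r) + sum (f ∘ U (not r))) + (sum (f ∘ W (r xor false)) + sum (f ∘ W (r xor true)))) + sum-twisted r x
        ≡⟨ cong (_+ sum-twisted r x) (by-row r) ⟩
      cellSum f + sum-twisted r x ∎
      where
      open ≡-Reasoning
      tw : Fin 3 → ℕ
      tw t = f (twisted t r x)
      A′ R′ : ℕ
      A′ = ∑[ s < p ] F (twistedPartner (used false s) (U r x))
      R′ = ∑[ s < suc q ] f (U (not r) (suc (suc s) ⊖ x))
      arrange : ∀ t₀ t₁ t₂ a r c u v → (t₂ + ((a + (t₀ + (t₁ + r))) + c)) + u + v
                                     ≡ (((a + u) + (v + r)) + c) + (t₀ + (t₁ + (t₂ + 0)))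
      arrange = solve-∀
      regroup : ∀ s f₁ f₀ r → (s + f₁) + (f₀ + r) ≡ s + (f₀ + (f₁ + r))
      regroup = solve-∀
      by-row : ∀ r → (sum (f ∘ U r) + sum (f ∘ U (not r))) + (sum (f ∘ W (r xor false)) + sum (f ∘ W (r xor true))) ≡ cellSum f
      by-row false = refl
      by-row true  = cong₂ _+_ (ℕ.+-comm (sum (f ∘ U true)) _) (ℕ.+-comm (sum (f ∘ W true)) _)

-- Cuts through the extra edges of a gadget

∀ᵇ : (Bool → Bool) → Bool
∀ᵇ P = P false ∧ P true

∀ᵇ-elim : ∀ P → T (∀ᵇ P) → ∀ b → T (P b)
∀ᵇ-elim P all false = proj₁ (Equivalence.to T-∧ all)
∀ᵇ-elim P all true  = proj₂ (Equivalence.to (T-∧ {P false}) all)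

module _ {q : ℕ} where
  private
    p : ℕ
    p = suc (suc (suc q))

  -- α x and β x are the signs of the two ends of rung x; ladder α β x counts the
  -- twisted edges that lead from a positive end of rung x to a negative vertex.
  ladder : (α β : Fin p → Bool) → Fin p → ℕ
  ladder α β x = ⟦ α x ⟧ * ∑[ t < 3 ] ⟦ not (if does (transpose t x Fin.≟ x) then β x else α (transpose t x)) ⟧
               + ⟦ β x ⟧ * ∑[ t < 3 ] ⟦ not (if does (transpose t x Fin.≟ x) then α x else β (transpose t x)) ⟧

  rungs : (α β : Fin p → Bool) → Fin p → ℕ
  rungs α β x = ⟦ α x ⟧ * ⟦ not (β x) ⟧ + ⟦ β x ⟧ * ⟦ not (α x) ⟧

  -- Apart from the original rung, the tripled rung contains a digon, which a cut meets in at most 2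
  -- edges.
  ladder-fixed : ∀ α β (x : Fin q) → ladder α β (suc (suc (suc x))) ≤ rungs α β (suc (suc (suc x))) + 2
  ladder-fixed α β x rewrite dec-true (x Fin.≟ x) refl = bits (α (suc (suc (suc x)))) (β (suc (suc (suc x))))
    where
    bits : ∀ a b → ⟦ a ⟧ * (⟦ not b ⟧ + (⟦ not b ⟧ + (⟦ not b ⟧ + 0))) + ⟦ b ⟧ * (⟦ not a ⟧ + (⟦ not a ⟧ + (⟦ not a ⟧ + 0)))
                 ≤ ⟦ a ⟧ * ⟦ not b ⟧ + ⟦ b ⟧ * ⟦ not a ⟧ + 2
    bits a b = ℕ.≤ᵇ⇒≤ _ _ (∀ᵇ-elim (λ b → lhs a b ≤ᵇ rhs a b) (∀ᵇ-elim (λ a → ∀ᵇ λ b → lhs a b ≤ᵇ rhs a b) tt a) b)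
      where
      lhs rhs : Bool → Bool → ℕ
      lhs a b = ⟦ a ⟧ * (⟦ not b ⟧ + (⟦ not b ⟧ + (⟦ not b ⟧ + 0))) + ⟦ b ⟧ * (⟦ not a ⟧ + (⟦ not a ⟧ + (⟦ not a ⟧ + 0)))
      rhs a b = ⟦ a ⟧ * ⟦ not b ⟧ + ⟦ b ⟧ * ⟦ not a ⟧ + 2

  -- Apart from the three rungs the prism consists of two triangles, and a cut contains at most 2
  -- edges of each. All 64 sign patterns are checked by evaluation.
  ladder-triangles : ∀ α β → ladder α β 0F + (ladder α β 1F + ladder α β 2F) ≤
                             rungs α β 0F + (rungs α β 1F + rungs α β 2F) + 4
  ladder-triangles α β = ℕ.≤ᵇ⇒≤ _ _
    (∀ᵇ-elim (check (α 0F) (α 1F) (α 2F) (β 0F) (β 1F))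
    (∀ᵇ-elim (λ b₁ → ∀ᵇ (check (α 0F) (α 1F) (α 2F) (β 0F) b₁))
    (∀ᵇ-elim (λ b₀ → ∀ᵇ λ b₁ → ∀ᵇ (check (α 0F) (α 1F) (α 2F) b₀ b₁))
    (∀ᵇ-elim (λ a₂ → ∀ᵇ λ b₀ → ∀ᵇ λ b₁ → ∀ᵇ (check (α 0F) (α 1F) a₂ b₀ b₁))
    (∀ᵇ-elim (λ a₁ → ∀ᵇ λ a₂ → ∀ᵇ λ b₀ → ∀ᵇ λ b₁ → ∀ᵇ (check (α 0F) a₁ a₂ b₀ b₁))
    (∀ᵇ-elim (λ a₀ → ∀ᵇ λ a₁ → ∀ᵇ λ a₂ → ∀ᵇ λ b₀ → ∀ᵇ λ b₁ → ∀ᵇ (check a₀ a₁ a₂ b₀ b₁))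
      tt (α 0F)) (α 1F)) (α 2F)) (β 0F)) (β 1F)) (β 2F))
    where
    check : (a₀ a₁ a₂ b₀ b₁ b₂ : Bool) → Bool
    check a₀ a₁ a₂ b₀ b₁ b₂ =
      ((⟦ a₀ ⟧ * (⟦ not b₀ ⟧ + (⟦ not a₂ ⟧ + (⟦ not a₁ ⟧ + 0))) + ⟦ b₀ ⟧ * (⟦ not a₀ ⟧ + (⟦ not b₂ ⟧ + (⟦ not b₁ ⟧ + 0))))
      + ((⟦ a₁ ⟧ * (⟦ not a₂ ⟧ + (⟦ not b₁ ⟧ + (⟦ not a₀ ⟧ + 0))) + ⟦ b₁ ⟧ * (⟦ not b₂ ⟧ + (⟦ not a₁ ⟧ + (⟦ not b₀ ⟧ + 0))))
      + (⟦ a₂ ⟧ * (⟦ not a₁ ⟧ + (⟦ not a₀ ⟧ + (⟦ not b₂ ⟧ + 0))) + ⟦ b₂ ⟧ * (⟦ not b₁ ⟧ + (⟦ not b₀ ⟧ + (⟦ not a₂ ⟧ + 0))))))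
      ≤ᵇ ((⟦ a₀ ⟧ * ⟦ not b₀ ⟧ + ⟦ b₀ ⟧ * ⟦ not a₀ ⟧)
         + ((⟦ a₁ ⟧ * ⟦ not b₁ ⟧ + ⟦ b₁ ⟧ * ⟦ not a₁ ⟧) + (⟦ a₂ ⟧ * ⟦ not b₂ ⟧ + ⟦ b₂ ⟧ * ⟦ not a₂ ⟧)) + 4)

  ladder-bound : ∀ α β → sum (ladder α β) ≤ sum (rungs α β) + (4 + q * 2)
  ladder-bound α β = begin
    L 0F + (L 1F + (L 2F + sum L₃))
      ≡⟨ assoc (L 0F) (L 1F) (L 2F) (sum L₃) ⟩
    (L 0F + (L 1F + L 2F)) + sum L₃
      ≤⟨ ℕ.+-mono-≤ (ladder-triangles α β) (sum-mono (ladder-fixed α β)) ⟩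
    (R 0F + (R 1F + R 2F) + 4) + ∑[ x < q ] (R (suc (suc (suc x))) + 2)
      ≡⟨ cong ((R 0F + (R 1F + R 2F) + 4) +_) (trans (∑-distrib-+ R₃ (λ _ → 2)) (cong (sum R₃ +_) (sum-const q 2))) ⟩
    (R 0F + (R 1F + R 2F) + 4) + (sum R₃ + q * 2)
      ≡⟨ regroup (R 0F) (R 1F) (R 2F) (sum R₃) (q * 2) ⟩
    (R 0F + (R 1F + (R 2F + sum R₃))) + (4 + q * 2) ∎
    where
    open ℕ.≤-Reasoning
    L R : Fin p → ℕ
    L = ladder α β
    R = rungs α β
    L₃ R₃ : Fin q → ℕ
    L₃ x = L (suc (suc (suc x)))
    R₃ x = R (suc (suc (suc x)))
    assoc : ∀ a b c d → a + (b + (c + d)) ≡ (a + (b + c)) + d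
    assoc = solve-∀
    regroup : ∀ a b c d e → (a + (b + c) + 4) + (d + e) ≡ (a + (b + (c + d))) + (4 + e)
    regroup = solve-∀

  module _ (a : Cell p → Bool) where
    private
      ā : Cell p → ℕ
      ā c = ⟦ not (a c) ⟧
      α β : Fin p → Bool
      α x = a (U false x)
      β x = a (U true (0F ⊖ x))

    -- Row 1 is reindexed by `0F ⊖_`, which gives both ends of a rung the same column index and
    -- turns the count into `ladder`.
    twisted-bound : rowSum {p} (λ r x → ⟦ a (U r x) ⟧ * sum-twisted ā (λ _ → 0) r x) ≤
                    rowSum {p} (λ r x → ⟦ a (U r x) ⟧ * ā (U (not r) (0F ⊖ x))) + (4 + q * 2)
    twisted-bound = begin
      rowSum {p} (λ r x → ⟦ a (U r x) ⟧ * tw r x)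
        ≡⟨ cong (sum (λ x → ⟦ α x ⟧ * tw false x) +_) (sum-reflect 0F (λ y → ⟦ a (U true y) ⟧ * tw true y)) ⟨
      sum (λ x → ⟦ α x ⟧ * tw false x) + sum (λ x → ⟦ β x ⟧ * tw true (0F ⊖ x))
        ≡⟨ ∑-distrib-+ (λ x → ⟦ α x ⟧ * tw false x) (λ x → ⟦ β x ⟧ * tw true (0F ⊖ x)) ⟨
      sum (λ x → ⟦ α x ⟧ * tw false x + ⟦ β x ⟧ * tw true (0F ⊖ x))
        ≡⟨ sum-cong-≗ {p} (λ x → cong₂ (λ u v → ⟦ α x ⟧ * u + ⟦ β x ⟧ * v)
                              (sum-cong-≗ {3} (twist-false x)) (sum-cong-≗ {3} (twist-true x))) ⟩
      sum (ladder α β)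
        ≤⟨ ladder-bound α β ⟩
      sum (rungs α β) + (4 + q * 2)
        ≡⟨ cong (_+ (4 + q * 2)) rungs-split ⟩
      rowSum {p} (λ r x → ⟦ a (U r x) ⟧ * ā (U (not r) (0F ⊖ x))) + (4 + q * 2) ∎
      where
      open ℕ.≤-Reasoning
      tw : Bool → Fin p → ℕ
      tw = sum-twisted ā (λ _ → 0)

      twist-false : ∀ x t → ā (twisted t false x)
                          ≡ ⟦ not (if does (transpose t x Fin.≟ x) then β x else α (transpose t x)) ⟧
      twist-false x t = cong (λ b → ⟦ not b ⟧)
        (if-float a (does (transpose t x Fin.≟ x)) {U true (0F ⊖ x)} {U false (transpose t x)})

      twist-true : ∀ x t → ā (twisted t true (0F ⊖ x))
                         ≡ ⟦ not (if does (transpose t x Fin.≟ x) then α x else β (transpose t x)) ⟧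
      twist-true x t rewrite ⊖-involutive 0F x = cong (λ b → ⟦ not b ⟧)
        (if-float a (does (transpose t x Fin.≟ x)) {U false x} {U true (0F ⊖ transpose t x)})

      rungs-split : sum (rungs α β) ≡ rowSum {p} (λ r x → ⟦ a (U r x) ⟧ * ā (U (not r) (0F ⊖ x)))
      rungs-split = trans (∑-distrib-+ (λ x → ⟦ α x ⟧ * ⟦ not (β x) ⟧) (λ x → ⟦ β x ⟧ * ⟦ not (α x) ⟧))
        (cong (sum (λ x → ⟦ α x ⟧ * ⟦ not (β x) ⟧) +_)
          (trans (sum-cong-≗ {p} λ x → cong (λ z → ⟦ β x ⟧ * ā (U false z)) (sym (⊖-involutive 0F x)))
                 (sum-reflect 0F (λ y → ⟦ a (U true y) ⟧ * ā (U false (0F ⊖ y))))))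

    module _ (e : Bool → ℕ) where
      twistedExits : Cell p → ℕ
      twistedExits c = localSum (λ l → [ ā , e ]′ (twistedPartner l c))

      private
        E B : ℕ
        E = e false + e true
        B = cellSum ā

      -- A cell on one side of a cut is not on the other, so the self-term in the neighbourhood
      -- identities vanishes once weighted by membership.
      absent : ∀ b m x → ⟦ b ⟧ * (m + ⟦ not b ⟧ + x) ≡ ⟦ b ⟧ * (m + x)
      absent true  m x = cong (λ z → 1 * (z + x)) (ℕ.+-identityʳ m)
      absent false m x = refl

      absent₀ : ∀ b m → ⟦ b ⟧ * (m + ⟦ not b ⟧) ≡ ⟦ b ⟧ * m
      absent₀ true  m = cong (1 *_) (ℕ.+-identityʳ m)
      absent₀ false m = refl

      twisted-exits-W : ∀ r x → ⟦ a (W r x) ⟧ * twistedExits (W r x) ≡ ⟦ a (W r x) ⟧ * B + E * ⟦ a (W r x) ⟧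
      twisted-exits-W r x = begin
        ⟦ a (W r x) ⟧ * twistedExits (W r x)                   ≡⟨ absent₀ (a (W r x)) (twistedExits (W r x)) ⟨
        ⟦ a (W r x) ⟧ * (twistedExits (W r x) + ā (W r x))     ≡⟨ cong (⟦ a (W r x) ⟧ *_) (twistedPartner-sum-W ā e r x) ⟩
        ⟦ a (W r x) ⟧ * (B + E)                         ≡⟨ ℕ.*-distribˡ-+ ⟦ a (W r x) ⟧ B E ⟩
        ⟦ a (W r x) ⟧ * B + ⟦ a (W r x) ⟧ * E           ≡⟨ cong (⟦ a (W r x) ⟧ * B +_) (ℕ.*-comm ⟦ a (W r x) ⟧ E) ⟩
        ⟦ a (W r x) ⟧ * B + E * ⟦ a (W r x) ⟧           ∎
        where open ≡-Reasoning

      twisted-exits-U : ∀ r x → ⟦ a (U r x) ⟧ * twistedExits (U r x) + ⟦ a (U r x) ⟧ * ā (U (not r) (0F ⊖ x))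
                      ≡ ⟦ a (U r x) ⟧ * B + ⟦ a (U r x) ⟧ * sum-twisted ā (λ _ → 0) r x
      twisted-exits-U r x = begin
        ⟦ a (U r x) ⟧ * twistedExits (U r x) + ⟦ a (U r x) ⟧ * ā (U (not r) (0F ⊖ x))
          ≡⟨ ℕ.*-distribˡ-+ ⟦ a (U r x) ⟧ (twistedExits (U r x)) (ā (U (not r) (0F ⊖ x))) ⟨
        ⟦ a (U r x) ⟧ * (twistedExits (U r x) + ā (U (not r) (0F ⊖ x)))
          ≡⟨ absent (a (U r x)) (twistedExits (U r x)) (ā (U (not r) (0F ⊖ x))) ⟨
        ⟦ a (U r x) ⟧ * (twistedExits (U r x) + ā (U r x) + ā (U (not r) (0F ⊖ x)))
          ≡⟨ cong (⟦ a (U r x) ⟧ *_) (twistedPartner-sum-U ā e r x) ⟩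
        ⟦ a (U r x) ⟧ * (B + sum-twisted ā (λ _ → 0) r x)
          ≡⟨ ℕ.*-distribˡ-+ ⟦ a (U r x) ⟧ B _ ⟩
        ⟦ a (U r x) ⟧ * B + ⟦ a (U r x) ⟧ * sum-twisted ā (λ _ → 0) r x ∎
        where open ≡-Reasoning

      rowSum-cong : ∀ {F G : Bool → Fin p → ℕ} → (∀ r x → F r x ≡ G r x) → rowSum {p} F ≡ rowSum {p} G
      rowSum-cong F≡G = cong₂ _+_ (sum-cong-≗ {p} (F≡G false)) (sum-cong-≗ {p} (F≡G true))

      rowSum-+ : ∀ F G → rowSum {p} (λ r x → F r x + G r x) ≡ rowSum {p} F + rowSum {p} G
      rowSum-+ F G = trans (cong₂ _+_ (∑-distrib-+ (F false) (G false)) (∑-distrib-+ (F true) (G true)))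
                           (middle (sum (F false)) (sum (G false)) (sum (F true)) (sum (G true)))
        where
        middle : ∀ a b c d → (a + b) + (c + d) ≡ (a + c) + (b + d)
        middle = solve-∀

      rowSum-*ˡ : ∀ k F → rowSum {p} (λ r x → k * F r x) ≡ k * rowSum {p} F
      rowSum-*ˡ k F = trans (cong₂ _+_ (sum-*ˡ k (F false)) (sum-*ˡ k (F true)))
                            (sym (ℕ.*-distribˡ-+ k (sum (F false)) (sum (F true))))

      -- The three terms are the cut of the complete graph on the cells, the most that the triangles
      -- and digons can add, and the rim edges of the chosen W cells.
      twisted-exits-bound : cellSum (λ c → ⟦ a c ⟧ * twistedExits c) ≤
                    B * cellSum (λ c → ⟦ a c ⟧) + (4 + q * 2) + E * rowSum {p} (λ r x → ⟦ a (W r x) ⟧)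
      -- `R` counts the cut rungs of column sum 0. Adding it completes the neighbourhoods of the U
      -- cells, and `twisted-bound` gives it back on the other side.
      twisted-exits-bound = ℕ.+-cancelʳ-≤ R _ _ (begin
        (rowSum {p} XU + rowSum {p} XW) + R
          ≡⟨ swap (rowSum {p} XU) (rowSum {p} XW) R ⟩
        (rowSum {p} XU + R) + rowSum {p} XW
          ≡⟨ cong₂ _+_ (trans (sym (rowSum-+ XU RU)) (trans (rowSum-cong twisted-exits-U) (rowSum-+ (λ r x → ⟦ a (U r x) ⟧ * B) TU)))
                       (trans (rowSum-cong twisted-exits-W) (rowSum-+ (λ r x → ⟦ a (W r x) ⟧ * B) (λ r x → E * ⟦ a (W r x) ⟧))) ⟩
        (rowSum {p} (λ r x → ⟦ a (U r x) ⟧ * B) + rowSum {p} TU) + (rowSum {p} (λ r x → ⟦ a (W r x) ⟧ * B) + rowSum {p} (λ r x → E * ⟦ a (W r x) ⟧))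
          ≡⟨ cong₂ (λ u v → (u + rowSum {p} TU) + v) (scale (λ r x → ⟦ a (U r x) ⟧))
               (cong₂ _+_ (scale (λ r x → ⟦ a (W r x) ⟧)) (rowSum-*ˡ E (λ r x → ⟦ a (W r x) ⟧))) ⟩
        (B * AU + rowSum {p} TU) + (B * AW + E * AW)
          ≤⟨ ℕ.+-monoˡ-≤ (B * AW + E * AW) (ℕ.+-monoʳ-≤ (B * AU) twisted-bound) ⟩
        (B * AU + (R + (4 + q * 2))) + (B * AW + E * AW)
          ≡⟨ regroup B AU AW R (4 + q * 2) (E * AW) ⟩
        (B * (AU + AW) + (4 + q * 2) + E * AW) + R ∎)
        where
        open ℕ.≤-Reasoning
        XU XW RU TU : Bool → Fin p → ℕ
        XU r x = ⟦ a (U r x) ⟧ * twistedExits (U r x)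
        XW r x = ⟦ a (W r x) ⟧ * twistedExits (W r x)
        RU r x = ⟦ a (U r x) ⟧ * ā (U (not r) (0F ⊖ x))
        TU r x = ⟦ a (U r x) ⟧ * sum-twisted ā (λ _ → 0) r x
        R AU AW : ℕ
        R  = rowSum {p} RU
        AU = rowSum {p} (λ r x → ⟦ a (U r x) ⟧)
        AW = rowSum {p} (λ r x → ⟦ a (W r x) ⟧)
        scale : ∀ F → rowSum {p} (λ r x → F r x * B) ≡ B * rowSum {p} F
        scale F = trans (rowSum-cong λ r x → ℕ.*-comm (F r x) B) (rowSum-*ˡ B F)
        swap : ∀ u w r → (u + w) + r ≡ (u + r) + w
        swap = solve-∀
        regroup : ∀ b u w r k x → (b * u + (r + k)) + (b * w + x) ≡ (b * (u + w) + k + x) + r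
        regroup = solve-∀

  -- Weight 0 on cells and 1 on the rim turns the neighbourhood identities into a count of rim
  -- edges: none at U, two at each of the 2p cells of W.
  twisted-cell-exits : cellSum {p} (λ c → localSum (λ l → [ (λ _ → 0) , (λ _ → 1) ]′ (twistedPartner l c))) ≡ 2 * (2 * p)
  twisted-cell-exits = begin
    cellSum {p} (λ c → localSum (λ l → [ (λ _ → 0) , (λ _ → 1) ]′ (twistedPartner l c)))
      ≡⟨ cong₂ _+_ (cong₂ _+_ (sum-cong-≗ {p} (onU false)) (sum-cong-≗ {p} (onU true)))
                   (cong₂ _+_ (sum-cong-≗ {p} (onW false)) (sum-cong-≗ {p} (onW true))) ⟩
    (∑[ _ < p ] 0 + ∑[ _ < p ] 0) + (∑[ _ < p ] 2 + ∑[ _ < p ] 2)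
      ≡⟨ cong₂ _+_ (cong₂ _+_ (sum-zero p) (sum-zero p)) (cong₂ _+_ (sum-const p 2) (sum-const p 2)) ⟩
    p * 2 + p * 2
      ≡⟨ double p ⟩
    2 * (2 * p) ∎
    where
    open ≡-Reasoning
    none : cellSum {p} (λ _ → 0) ≡ 0
    none = cong₂ _+_ (cong₂ _+_ (sum-zero p) (sum-zero p)) (cong₂ _+_ (sum-zero p) (sum-zero p))
    onU : ∀ r (x : Fin p) → localSum (λ l → [ (λ _ → 0) , (λ _ → 1) ]′ (twistedPartner l (U r x))) ≡ 0
    onU r x = trans (sym (trans (ℕ.+-identityʳ _) (ℕ.+-identityʳ _)))
      (trans (twistedPartner-sum-U (λ _ → 0) (λ _ → 1) r x) (cong (_+ 0) none))
    onW : ∀ r (x : Fin p) → localSum (λ l → [ (λ _ → 0) , (λ _ → 1) ]′ (twistedPartner l (W r x))) ≡ 2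
    onW r x = trans (sym (ℕ.+-identityʳ _))
      (trans (twistedPartner-sum-W (λ _ → 0) (λ _ → 1) r x) (cong (_+ 2) none))
    double : ∀ p → p * 2 + p * 2 ≡ 2 * (2 * p)
    double = solve-∀

-- The wheel

bit : Bool → Fin 2
bit false = 0F
bit true  = 1F

bool : Fin 2 → Bool
bool 0F = false
bool 1F = true

bool-bit : ∀ b → bool (bit b) ≡ b
bool-bit false = refl
bool-bit true  = refl

bit-bool : ∀ i → bit (bool i) ≡ i
bit-bool 0F = refl
bit-bool 1F = refl

localSum-cong : ∀ {n} {F G : Local n → ℕ} → (∀ l → F l ≡ G l) → localSum F ≡ localSum G
localSum-cong {n} F≡G = cong₂ _+_ (F≡G straight)
  (cong₂ _+_ (cong₂ _+_ (sum-cong-≗ {n} (F≡G ∘ used false)) (sum-cong-≗ {n} (F≡G ∘ used true)))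
             (cong₂ _+_ (sum-cong-≗ {n} (F≡G ∘ cross false)) (sum-cong-≗ {n} (F≡G ∘ cross true))))

cellSum-cong : ∀ {n} {f g : Cell n → ℕ} → (∀ c → f c ≡ g c) → cellSum f ≡ cellSum g
cellSum-cong {n} f≡g =
  cong₂ _+_ (cong₂ _+_ (sum-cong-≗ {n} (f≡g ∘ U false)) (sum-cong-≗ {n} (f≡g ∘ U true)))
            (cong₂ _+_ (sum-cong-≗ {n} (f≡g ∘ W false)) (sum-cong-≗ {n} (f≡g ∘ W true)))

localSum-zero : ∀ n → localSum {n} (λ _ → 0) ≡ 0
localSum-zero n rewrite sum-zero n = refl

cellSum-zero : ∀ n → cellSum {n} (λ _ → 0) ≡ 0
cellSum-zero n rewrite sum-zero n = refl

localSum-*ˡ : ∀ {n} k (F : Local n → ℕ) → localSum (λ l → k * F l) ≡ k * localSum F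
localSum-*ˡ k F
  rewrite sum-*ˡ k (F ∘ used false) | sum-*ˡ k (F ∘ used true)
        | sum-*ˡ k (F ∘ cross false) | sum-*ˡ k (F ∘ cross true)
  = factor k (F straight) (sum (F ∘ used false)) (sum (F ∘ used true)) (sum (F ∘ cross false)) (sum (F ∘ cross true))
  where
  factor : ∀ k d a b c e → k * d + ((k * a + k * b) + (k * c + k * e)) ≡ k * (d + ((a + b) + (c + e)))
  factor = solve-∀

cellSum-+ : ∀ {n} (f g : Cell n → ℕ) → cellSum (λ c → f c + g c) ≡ cellSum f + cellSum g
cellSum-+ f g
  rewrite ∑-distrib-+ (f ∘ U false) (g ∘ U false) | ∑-distrib-+ (f ∘ U true) (g ∘ U true)
        | ∑-distrib-+ (f ∘ W false) (g ∘ W false) | ∑-distrib-+ (f ∘ W true) (g ∘ W true)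
  = middle (sum (f ∘ U false)) (sum (g ∘ U false)) (sum (f ∘ U true)) (sum (g ∘ U true))
           (sum (f ∘ W false)) (sum (g ∘ W false)) (sum (f ∘ W true)) (sum (g ∘ W true))
  where
  middle : ∀ a a′ b b′ c c′ d d′ → ((a + a′) + (b + b′)) + ((c + c′) + (d + d′)) ≡ ((a + b) + (c + d)) + ((a′ + b′) + (c′ + d′))
  middle = solve-∀

-- Numbering of colours, cells and vertices

module _ {n : ℕ} where

  pickRow : Fin 2 → Fin 2 × Fin n → Local n
  pickRow 0F (b , s) = used (bool b) s
  pickRow 1F (b , s) = cross (bool b) s

  pick : Fin (2 * n) × Fin 2 → Local n
  pick (a , e) = pickRow e (remQuot {2} n a)

  -- A local colour is the distance from the position matched to the hub;
  -- gadgets at odd distance are entered from both sides.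
  decode : Fin (suc ((2 * n) * 2)) → Local n
  decode zero    = straight
  decode (suc i) = pick (remQuot {2 * n} 2 i)

  encode : Local n → Fin (suc ((2 * n) * 2))
  encode straight = zero
  encode (used b s)  = suc (combine (combine (bit b) s) 0F)
  encode (cross b s) = suc (combine (combine (bit b) s) 1F)

  decode-encode : ∀ l → decode (encode l) ≡ l
  decode-encode straight = refl
  decode-encode (used b s) = trans
    (cong pick (Fin.remQuot-combine {2 * n} {2} (combine (bit b) s) 0F))
    (trans (cong (pickRow 0F) (Fin.remQuot-combine {2} {n} (bit b) s)) (cong (λ c → used c s) (bool-bit b)))
  decode-encode (cross b s) = trans
    (cong pick (Fin.remQuot-combine {2 * n} {2} (combine (bit b) s) 1F))
    (trans (cong (pickRow 1F) (Fin.remQuot-combine {2} {n} (bit b) s)) (cong (λ c → cross c s) (bool-bit b)))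

  encode-pickRow : ∀ e bs → encode (pickRow e bs) ≡ suc (combine (uncurry combine bs) e)
  encode-pickRow 0F (b , s) = cong (λ c → suc (combine (combine {2} c s) 0F)) (bit-bool b)
  encode-pickRow 1F (b , s) = cong (λ c → suc (combine (combine {2} c s) 1F)) (bit-bool b)

  encode-decode : ∀ i → encode (decode i) ≡ i
  encode-decode zero    = refl
  encode-decode (suc i) = trans
    (encode-pickRow (proj₂ (remQuot {2 * n} 2 i)) (remQuot {2} n (proj₁ (remQuot {2 * n} 2 i))))
    (cong suc (trans (cong (λ a → combine a (proj₂ (remQuot {2 * n} 2 i))) (Fin.combine-remQuot {2} n (proj₁ (remQuot {2 * n} 2 i))))
                     (Fin.combine-remQuot {2 * n} 2 i)))

  sum-decode : ∀ (F : Local n → ℕ) → ∑[ i < suc ((2 * n) * 2) ] F (decode i) ≡ localSum F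
  sum-decode F = cong (F straight +_) (begin
    ∑[ i < (2 * n) * 2 ] F (decode (suc i))
      ≡⟨ sum-* (2 * n) (F ∘ decode ∘ suc) ⟩
    ∑[ a < 2 * n ] ∑[ e < 2 ] F (decode (suc (combine a e)))
      ≡⟨ sum-* 2 {n} (λ a → ∑[ e < 2 ] F (decode (suc (combine a e)))) ⟩
    ∑[ b < 2 ] ∑[ s < n ] ∑[ e < 2 ] F (decode (suc (combine (combine b s) e)))
      ≡⟨ cong₂ (λ x y → x + (y + 0)) (per-bit false) (per-bit true) ⟩
    (sum (F ∘ used false) + sum (F ∘ cross false)) + ((sum (F ∘ used true) + sum (F ∘ cross true)) + 0)
      ≡⟨ regroup (sum (F ∘ used false)) (sum (F ∘ cross false)) (sum (F ∘ used true)) (sum (F ∘ cross true)) ⟩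
    (sum (F ∘ used false) + sum (F ∘ used true)) + (sum (F ∘ cross false) + sum (F ∘ cross true)) ∎)
    where
    open ≡-Reasoning
    per-bit : ∀ b → ∑[ s < n ] ∑[ e < 2 ] F (decode (suc (combine (combine (bit b) s) e)))
                  ≡ sum (F ∘ used b) + sum (F ∘ cross b)
    per-bit b = trans (sum-cong-≗ {n} λ s → cong₂ _+_ (cong F (decode-encode (used b s)))
                                               (trans (ℕ.+-identityʳ _) (cong F (decode-encode (cross b s)))))
                      (∑-distrib-+ (F ∘ used b) (F ∘ cross b))
    regroup : ∀ a b c d → (a + b) + ((c + d) + 0) ≡ (a + c) + (b + d)
    regroup = solve-∀

  cellCode : Cell n → Fin (2 * (2 * n))
  cellCode (U r x) = combine {2} 0F (combine (bit r) x)
  cellCode (W r x) = combine {2} 1F (combine (bit r) x)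

  side : Fin 2 → Bool → Fin n → Cell n
  side 0F = U
  side 1F = W

  pickCell : Fin 2 × Fin (2 * n) → Cell n
  pickCell (i , r) = side i (bool (proj₁ (remQuot {2} n r))) (proj₂ (remQuot {2} n r))

  cellAt : Fin (2 * (2 * n)) → Cell n
  cellAt i = pickCell (remQuot {2} (2 * n) i)

  cellAt-combine : ∀ i b x → cellAt (combine i (combine b x)) ≡ side i (bool b) x
  cellAt-combine i b x = trans
    (cong pickCell (Fin.remQuot-combine {2} {2 * n} i (combine b x)))
    (cong (uncurry (λ c → side i (bool c))) (Fin.remQuot-combine {2} {n} b x))

  cellAt-cellCode : ∀ c → cellAt (cellCode c) ≡ c
  cellAt-cellCode (U r x) = trans (cellAt-combine 0F (bit r) x) (cong (λ b → U b x) (bool-bit r))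
  cellAt-cellCode (W r x) = trans (cellAt-combine 1F (bit r) x) (cong (λ b → W b x) (bool-bit r))

  cellCode-side : ∀ i b x → cellCode (side i (bool b) x) ≡ combine i (combine b x)
  cellCode-side 0F b x = cong (λ c → combine {2} 0F (combine c x)) (bit-bool b)
  cellCode-side 1F b x = cong (λ c → combine {2} 1F (combine c x)) (bit-bool b)

  cellCode-cellAt : ∀ i → cellCode (cellAt i) ≡ i
  cellCode-cellAt i = trans
    (cellCode-side (proj₁ (remQuot {2} (2 * n) i)) (proj₁ (remQuot {2} n (proj₂ (remQuot {2} (2 * n) i))))
                   (proj₂ (remQuot {2} n (proj₂ (remQuot {2} (2 * n) i)))))
    (trans (cong (combine {2} (proj₁ (remQuot {2} (2 * n) i))) (Fin.combine-remQuot {2} n (proj₂ (remQuot {2} (2 * n) i))))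
           (Fin.combine-remQuot {2} (2 * n) i))

  sum-cellAt : ∀ (f : Cell n → ℕ) → ∑[ i < 2 * (2 * n) ] f (cellAt i) ≡ cellSum f
  sum-cellAt f = begin
    ∑[ i < 2 * (2 * n) ] f (cellAt i)
      ≡⟨ sum-* 2 {2 * n} (f ∘ cellAt) ⟩
    ∑[ i < 2 ] ∑[ r < 2 * n ] f (cellAt (combine i r))
      ≡⟨ cong₂ (λ x y → x + (y + 0)) (per-side 0F) (per-side 1F) ⟩
    (sum (f ∘ U false) + (sum (f ∘ U true) + 0)) + ((sum (f ∘ W false) + (sum (f ∘ W true) + 0)) + 0)
      ≡⟨ cong₂ _+_ (cong (sum (f ∘ U false) +_) (ℕ.+-identityʳ _))
           (trans (ℕ.+-identityʳ _) (cong (sum (f ∘ W false) +_) (ℕ.+-identityʳ _))) ⟩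
    cellSum f ∎
    where
    open ≡-Reasoning
    per-side : ∀ i → ∑[ r < 2 * n ] f (cellAt (combine i r)) ≡ sum (f ∘ side i false) + (sum (f ∘ side i true) + 0)
    per-side i = trans (sum-* 2 {n} (λ r → f (cellAt (combine i r))))
      (cong₂ (λ x y → x + (y + 0)) (sum-cong-≗ {n} λ x → cong f (cellAt-combine i 0F x))
                                   (sum-cong-≗ {n} λ x → cong f (cellAt-combine i 1F x)))

module _ {n : ℕ} where

  -- The codes differ only in their last binary digit, so adding 1 does not wrap around. A colour
  -- that enters gadget j is thus seen from gadget j + 1 as `cross` with the same parameters, which
  -- tells the shared rim vertex to look backwards.
  next-encode : ∀ b s → next (encode (used b s)) ≡ encode (cross b s)
  next-encode b s = Fin.toℕ-injective (trans (next-toℕ {(2 * n) * 2} (encode {n} (used b s)) bound) (sym above))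
    where
    i : Fin (2 * n)
    i = combine {2} {n} (bit b) s
    above : toℕ (encode {n} (cross b s)) ≡ suc (toℕ (encode {n} (used b s)))
    above = cong suc (trans (Fin.toℕ-combine {2 * n} {2} i 1F)
      (trans (ℕ.+-suc (2 * toℕ i) 0) (cong suc (sym (Fin.toℕ-combine {2 * n} {2} i 0F)))))
    bound : toℕ (encode {n} (used b s)) < (2 * n) * 2
    bound = ℕ.s≤s⁻¹ (subst (_< suc ((2 * n) * 2)) above (Fin.toℕ<n {suc ((2 * n) * 2)} (encode {n} (cross b s))))

  colourAt : Fin (suc ((2 * n) * 2)) → Fin (suc ((2 * n) * 2)) → Local n
  colourAt j k = decode (j ⊖ k)

  colourAt-straight : ∀ j k → colourAt j k ≡ straight → j ≡ k
  colourAt-straight j k eq = ⊖≡zero j k (trans (sym (encode-decode {n} (j ⊖ k))) (cong (encode {n}) eq))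

  colourAt-next : ∀ j k b s → colourAt j k ≡ used b s → colourAt (next j) k ≡ cross b s
  colourAt-next j k b s eq = begin
    colourAt (next j) k                        ≡⟨ cong (decode {n}) (next-⊖ j k) ⟩
    decode {n} (next (j ⊖ k))                      ≡⟨ cong (decode {n} ∘ next) (trans (sym (encode-decode {n} (j ⊖ k))) (cong (encode {n}) eq)) ⟩
    decode {n} (next (encode {n} (used b s)))          ≡⟨ cong (decode {n}) (next-encode b s) ⟩
    decode {n} (encode {n} (cross b s))                ≡⟨ decode-encode (cross b s) ⟩
    cross b s                                  ∎
    where open ≡-Reasoning

  colourAt-prev : ∀ j k b s → colourAt j k ≡ cross b s → colourAt (prev j) k ≡ used b s
  colourAt-prev j k b s eq = begin
    colourAt (prev j) k                        ≡⟨ cong (decode {n}) (prev-⊖ j k) ⟩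
    decode {n} (prev (j ⊖ k))                      ≡⟨ cong (decode {n} ∘ prev) (trans (sym (encode-decode {n} (j ⊖ k))) (cong (encode {n}) eq)) ⟩
    decode {n} (prev (encode {n} (cross b s)))         ≡⟨ cong (decode {n} ∘ prev) (next-encode b s) ⟨
    decode {n} (prev (next (encode {n} (used b s))))   ≡⟨ cong (decode {n}) (prev-next (encode {n} (used b s))) ⟩
    decode {n} (encode {n} (used b s))                 ≡⟨ decode-encode (used b s) ⟩
    used b s                                   ∎
    where open ≡-Reasoning

data Node (N n : ℕ) : Set where
  hub  : Node N n
  rim  : Fin N → Node N n
  cell : Fin N → Cell n → Node N n

module _ {N n : ℕ} where

  atPosition : Fin N → Fin (suc (2 * (2 * n))) → Node N n
  atPosition j zero    = rim j
  atPosition j (suc i) = cell j (cellAt i)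

  nodeAt : Fin (suc (N * suc (2 * (2 * n)))) → Node N n
  nodeAt zero    = hub
  nodeAt (suc i) = uncurry atPosition (remQuot {N} (suc (2 * (2 * n))) i)

  nodeCode : Node N n → Fin (suc (N * suc (2 * (2 * n))))
  nodeCode hub        = zero
  nodeCode (rim j)    = suc (combine {N} j zero)
  nodeCode (cell j c) = suc (combine {N} j (suc (cellCode c)))

  nodeAt-combine : ∀ j i → nodeAt (suc (combine j i)) ≡ atPosition j i
  nodeAt-combine j i = cong (uncurry atPosition) (Fin.remQuot-combine {N} {suc (2 * (2 * n))} j i)

  nodeAt-nodeCode : ∀ v → nodeAt (nodeCode v) ≡ v
  nodeAt-nodeCode hub        = refl
  nodeAt-nodeCode (rim j)    = nodeAt-combine j zero
  nodeAt-nodeCode (cell j c) = trans (nodeAt-combine j (suc (cellCode c))) (cong (cell j) (cellAt-cellCode c))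

  nodeCode-nodeAt : ∀ i → nodeCode (nodeAt i) ≡ i
  nodeCode-nodeAt zero    = refl
  nodeCode-nodeAt (suc i) = trans (code (proj₁ (remQuot {N} (suc (2 * (2 * n))) i)) (proj₂ (remQuot {N} (suc (2 * (2 * n))) i)))
                                  (cong suc (Fin.combine-remQuot {N} (suc (2 * (2 * n))) i))
    where
    code : ∀ j r → nodeCode (atPosition j r) ≡ suc (combine j r)
    code j zero    = refl
    code j (suc r) = cong (λ z → suc (combine j (suc z))) (cellCode-cellAt {n} r)

  nodeSum : (Node N n → ℕ) → ℕ
  nodeSum g = g hub + ∑[ j < N ] (g (rim j) + cellSum (g ∘ cell j))

  sum-nodeAt : ∀ g → ∑[ i < suc (N * suc (2 * (2 * n))) ] g (nodeAt i) ≡ nodeSum g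
  sum-nodeAt g = cong (g hub +_) (trans (sum-* N {suc (2 * (2 * n))} (g ∘ nodeAt ∘ suc)) (sum-cong-≗ {N} λ j →
    cong₂ _+_ (cong g (nodeAt-combine j zero))
              (trans (sum-cong-≗ {2 * (2 * n)} λ i → cong g (nodeAt-combine j (suc i))) (sum-cellAt (g ∘ cell j)))))

-- A gadget on n = suc m columns: each local colour pairs off its cells, except
-- that the used colours send one cell to either side.
record Gadget (m : ℕ) : Set where
  field
    partner            : Local (suc m) → Cell (suc m) → Cell (suc m) ⊎ Bool
    partner-involutive : ∀ l c {c′} → partner l c ≡ inj₁ c′ → partner l c′ ≡ inj₁ c
    partner-≢          : ∀ l c → partner l c ≢ inj₁ c
    halve double        : Fin (suc m) → Fin (suc m)
    halve-double        : ∀ x → halve (double x) ≡ x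
    double-halve        : ∀ s → double (halve s) ≡ s

  terminal : Bool → Bool → Fin (suc m) → Cell (suc m)
  terminal e b s = W (e xor b) (halve s)

  exits : (Cell (suc m) → ℕ) → (Bool → ℕ) → Cell (suc m) → ℕ
  exits f e c = localSum (λ l → [ f , e ]′ (partner l c))

  field
    partner-terminal : ∀ e b s → partner (used b s) (terminal e b s) ≡ inj₂ e
    partner-exit     : ∀ l c {e} → partner l c ≡ inj₂ e → ∃₂ λ b s → l ≡ used b s × c ≡ terminal e b s
    cell-exits       : cellSum (exits (λ _ → 0) (λ _ → 1)) ≡ 2 * (2 * suc m)
    surplus          : ℕ
    surplus-small    : surplus + 2 ≡ 2 * suc m
    exits-bound      : ∀ (a : Cell (suc m) → Bool) (e : Bool → ℕ) →
      cellSum (λ c → ⟦ a c ⟧ * exits (λ c → ⟦ not (a c) ⟧) e c) ≤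
      cellSum (λ c → ⟦ not (a c) ⟧) * cellSum (λ c → ⟦ a c ⟧) + surplus
        + (e false + e true) * rowSum (λ r x → ⟦ a (W r x) ⟧)

-- The 1-factorisation of the wheel

module Wheel {m : ℕ} (𝓖 : Gadget m) where
  open Gadget 𝓖

  p N : ℕ
  p = suc m
  N = suc ((2 * p) * 2)

  attach : Fin N → Cell p ⊎ Bool → Node N p
  attach j (inj₁ c)     = cell j c
  attach j (inj₂ false) = rim j
  attach j (inj₂ true)  = rim (next j)

  -- Gadget `j` lies between `rim j` and `rim (next j)`. In a `cross` colour the gadget before
  -- `rim j` is one step nearer to the hub edge, hence in a `used` colour, and its right terminal is
  -- free for `rim j`.
  rimMate : Fin N → Local p → Node N p
  rimMate j straight = hub
  rimMate j (used b s)  = cell j (terminal false b s)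
  rimMate j (cross b s) = cell (prev j) (terminal true b s)

  mate : Fin N → Node N p → Node N p
  mate k hub        = rim k
  mate k (rim j)    = rimMate j (colourAt {p} j k)
  mate k (cell j c) = attach j (partner (colourAt {p} j k) c)

  rimMate-mate : ∀ k j l → colourAt {p} j k ≡ l → mate k (rimMate j l) ≡ rim j
  rimMate-mate k j straight eq = cong rim (sym (colourAt-straight {p} j k eq))
  rimMate-mate k j (used b s)  eq = trans
    (cong (λ l → attach j (partner l (terminal false b s))) eq)
    (cong (attach j) (partner-terminal false b s))
  rimMate-mate k j (cross b s) eq = trans
    (cong (λ l → attach (prev j) (partner l (terminal true b s))) (colourAt-prev {p} j k b s eq))
    (trans (cong (attach (prev j)) (partner-terminal true b s)) (cong rim (next-prev j)))

  attach-mate : ∀ k j c y → partner (colourAt {p} j k) c ≡ y → mate k (attach j y) ≡ cell j c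
  attach-mate k j c (inj₁ c′)    eq = cong (attach j) (partner-involutive (colourAt {p} j k) c eq)
  attach-mate k j c (inj₂ false) eq =
    let (b , s , l≡ , c≡) = partner-exit (colourAt {p} j k) c eq
    in trans (cong (rimMate j) l≡) (cong (cell j) (sym c≡))
  attach-mate k j c (inj₂ true)  eq =
    let (b , s , l≡ , c≡) = partner-exit (colourAt {p} j k) c eq
    in trans (cong (rimMate (next j)) (colourAt-next {p} j k b s l≡)) (cong₂ cell (prev-next j) (sym c≡))

  mate-involutive : ∀ k v → mate k (mate k v) ≡ v
  mate-involutive k hub        = cong (rimMate k ∘ decode {p}) (⊖-self k)
  mate-involutive k (rim j)    = rimMate-mate k j (colourAt {p} j k) refl
  mate-involutive k (cell j c) = attach-mate k j c (partner (colourAt {p} j k) c) refl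

  rimMate-≢ : ∀ i j l → rimMate i l ≢ rim j
  rimMate-≢ i j straight ()
  rimMate-≢ i j (used b s)  ()
  rimMate-≢ i j (cross b s) ()

  attach-cell : ∀ j y {c} → attach j y ≡ cell j c → y ≡ inj₁ c
  attach-cell j (inj₁ c)     refl = refl
  attach-cell j (inj₂ false) ()
  attach-cell j (inj₂ true)  ()

  mate-≢ : ∀ k v → mate k v ≢ v
  mate-≢ k hub        ()
  mate-≢ k (rim j)    = rimMate-≢ j j (colourAt {p} j k)
  mate-≢ k (cell j c) eq = partner-≢ (colourAt {p} j k) c (attach-cell j (partner (colourAt {p} j k) c) eq)

module _ (q h : ℕ) (odd : _≡_ {A = ℕ} (suc (suc (suc q))) (suc (h + h))) where
  private
    p : ℕ
    p = suc (suc (suc q))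

  open Halving {suc (suc q)} h odd

  terminalCell : Bool → Bool → Fin p → Cell p
  terminalCell e b s = W (e xor b) (halve s)

  terminal-partner : ∀ e b s → twistedPartner (used b s) (terminalCell e b s) ≡ inj₂ e
  terminal-partner e b s = trans
    (cong (λ d → if d then inj₂ ((e xor b) xor b) else inj₁ (W ((e xor b) xor b) (s ⊖ halve s)))
          (dec-true (s ⊖ halve s Fin.≟ halve s)
            (trans (cong (_⊖ halve s) (sym (halve-⊕-halve s))) (⊕-⊖ (halve s) (halve s)))))
    (cong inj₂ (xor-cancel {q} e b))

  -- A cell leaves only where `s ⊖ x ≡ x`, that is `x ⊕ x ≡ s`; as 2 is invertible, `x` is then the
  -- half of `s`.
  exit-partner : ∀ l c {e} → twistedPartner l c ≡ inj₂ e → ∃₂ λ b s → l ≡ used b s × c ≡ terminalCell e b s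
  exit-partner straight (U r x) ()
  exit-partner straight (W r x) ()
  exit-partner (cross b s) (U r x) ()
  exit-partner (cross b s) (W r x) ()
  exit-partner (used b s)  (U r x) ()
  exit-partner (used b s)  (W r x) eq with s ⊖ x Fin.≟ x
  exit-partner (used b s)  (W r x) refl | yes s⊖x≡x = b , s , refl
    , cong₂ W (sym (xor-cancel {q} r b))
        (trans (sym (halve-double x)) (cong halve (trans (cong (_⊕ x) (sym s⊖x≡x)) (⊖-⊕ s x))))
  exit-partner (used b s)  (W r x) () | no _

  twistedGadget : Gadget (suc (suc q))
  twistedGadget = record
    { partner            = twistedPartner
    ; partner-involutive = twistedPartner-involutive
    ; partner-≢          = twistedPartner-≢
    ; halve               = halve
    ; double             = λ x → x ⊕ x
    ; halve-double        = halve-double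
    ; double-halve        = halve-⊕-halve
    ; partner-terminal   = terminal-partner
    ; partner-exit       = exit-partner
    ; cell-exits         = twisted-cell-exits
    ; surplus            = 4 + q * 2
    ; surplus-small      = count q
    ; exits-bound        = twisted-exits-bound
    }
    where
    count : ∀ q → 4 + q * 2 + 2 ≡ 2 * suc (suc (suc q))
    count = solve-∀

-- No signs satisfy all cut bounds of the wheel

sum-vanishing : ∀ {n} (f : Fin n → ℕ) → (∀ i → f i ≡ 0) → sum f ≡ 0
sum-vanishing {n} f f≡0 = trans (sum-cong-≗ {n} f≡0) (sum-zero n)

sum-head : ∀ {n} (f : Fin (suc n) → ℕ) → (∀ i → f (suc i) ≡ 0) → sum f ≡ f 0F
sum-head f f≡0 = trans (cong (f 0F +_) (sum-vanishing (f ∘ suc) f≡0)) (ℕ.+-identityʳ (f 0F))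

sum-three : ∀ {n} (f : Fin (suc (suc (suc n))) → ℕ) → (∀ i → f (suc (suc (suc i))) ≡ 0) →
            sum f ≡ f 0F + (f 1F + f 2F)
sum-three f f≡0 = cong (λ z → f 0F + (f 1F + z)) (sum-head (λ i → f (suc (suc i))) f≡0)

-- `A − B` is even because `A + B` is; a positive difference would therefore be at least 2, and 2 (P
-- + 1) exceeds 2 P.
balanced-≤ : ∀ P A B → A + B ≡ 2 * P → (P + 1) * A ≤ 2 * P + (P + 1) * B → A ≤ P
balanced-≤ P A B A+B≡2P bound with A ℕ.≤? P
... | yes A≤P = A≤P
... | no  A≰P = contradiction
  (ℕ.+-cancelʳ-≤ ((P + 1) * B) _ _ (ℕ.≤-trans (ℕ.≤-reflexive (expand P B)) (ℕ.≤-trans (ℕ.*-monoʳ-≤ (P + 1) B+2≤A) bound)))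
  (ℕ.<⇒≱ (ℕ.m<m+n (2 * P) (ℕ.s≤s ℕ.z≤n)))
  where
  expand : ∀ P B → (2 * P + 2) + (P + 1) * B ≡ (P + 1) * (B + 2)
  expand = solve-∀
  double : ∀ P → 2 * P ≡ P + P
  double = solve-∀
  P<A : P < A
  P<A = ℕ.≰⇒> A≰P
  B<P : B < P
  B<P = ℕ.≰⇒> λ P≤B → ℕ.<-irrefl (trans (sym (double P)) (sym A+B≡2P)) (ℕ.+-mono-<-≤ P<A P≤B)
  B+2≤A : B + 2 ≤ A
  B+2≤A = ℕ.≤-trans (ℕ.≤-reflexive (ℕ.+-comm B 2)) (ℕ.≤-trans (ℕ.s≤s B<P) P<A)

module Core {m : ℕ} (𝓖 : Gadget m) where
  open Gadget 𝓖
  open Wheel 𝓖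

  private
    P : ℕ
    P = 2 * p

  boundary : (Node N p → Bool) → ℕ
  boundary X = nodeSum (λ v → ∑[ k < N ] Crosses X v (mate k v))

  -- The inequality (2p+1) w(X) ≤ |∂X| for the signs `a`, with the negative part of w moved to the
  -- right. Together with the same for `not ∘ a` it bounds |w(X)|.
  Bounded : (Node N p → Bool) → Set
  Bounded a = ∀ X → (P + 1) * nodeSum (λ v → ⟦ X v ∧ a v ⟧) ≤ boundary X + (P + 1) * nodeSum (λ v → ⟦ X v ∧ not (a v) ⟧)

  module _ (i₀ : Fin N) (R : Fin N → Bool) (C : Fin N → Cell p → Bool) where
    -- The set is described by offsets from `i₀`, which the rotational symmetry permits. A set near
    -- position `i₀` then lives on the offsets 0, 1, 2, where `R` and `C` are given by pattern
    -- matching and sums over the rim collapse.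
    pattern-set : Node N p → Bool
    pattern-set hub        = false
    pattern-set (rim j)    = R (j ⊖ i₀)
    pattern-set (cell j c) = C (j ⊖ i₀) c

    rimMember : Fin N → Local p → Bool
    rimMember t straight = false
    rimMember t (used b s)  = C t (terminal false b s)
    rimMember t (cross b s) = C (prev t) (terminal true b s)

    cellMember : Fin N → Cell p ⊎ Bool → Bool
    cellMember t (inj₁ c)     = C t c
    cellMember t (inj₂ false) = R t
    cellMember t (inj₂ true)  = R (next t)

    rimCut cellCut : Fin N → ℕ
    rimCut  t = localSum λ l → ⟦ R t ∧ not (rimMember t l) ⟧
    cellCut t = cellSum λ c → localSum λ l → ⟦ C t c ∧ not (cellMember t (partner l c)) ⟧

    rimMember-correct : ∀ j l → pattern-set (rimMate j l) ≡ rimMember (j ⊖ i₀) l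
    rimMember-correct j straight = refl
    rimMember-correct j (used b s)  = refl
    rimMember-correct j (cross b s) = cong (λ t → C t (terminal true b s)) (prev-⊖ j i₀)

    cellMember-correct : ∀ j y → pattern-set (attach j y) ≡ cellMember (j ⊖ i₀) y
    cellMember-correct j (inj₁ c)     = refl
    cellMember-correct j (inj₂ false) = refl
    cellMember-correct j (inj₂ true)  = cong R (next-⊖ j i₀)

    -- For fixed `j` the distance `j ⊖ k` runs through all residues as `k` does, so every position
    -- sees each local colour once.
    sum-colours : ∀ j (F : Local p → ℕ) → ∑[ k < N ] F (colourAt {p} j k) ≡ localSum F
    sum-colours j F = trans (sum-reflect j (F ∘ decode {p})) (sum-decode F)

    boundary-pattern : boundary pattern-set ≡ ∑[ t < N ] (rimCut t + cellCut t)
    boundary-pattern = begin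
      boundary pattern-set
        ≡⟨ cong (_+ ∑[ j < N ] (rimB j + cellB j)) (sum-zero N) ⟩
      ∑[ j < N ] (rimB j + cellB j)
        ≡⟨ sum-cong-≗ {N} (λ j → cong₂ _+_ (rim-eq j) (cellSum-cong {p} (cell-eq j))) ⟩
      ∑[ j < N ] (rimCut (j ⊖ i₀) + cellCut (j ⊖ i₀))
        ≡⟨ sum-⊖ i₀ (λ t → rimCut t + cellCut t) ⟩
      ∑[ t < N ] (rimCut t + cellCut t) ∎
      where
      open ≡-Reasoning
      rimB cellB : Fin N → ℕ
      rimB  j = ∑[ k < N ] Crosses pattern-set (rim j) (mate k (rim j))
      cellB j = cellSum λ c → ∑[ k < N ] Crosses pattern-set (cell j c) (mate k (cell j c))
      rim-eq : ∀ j → rimB j ≡ rimCut (j ⊖ i₀)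
      rim-eq j = trans (sum-colours j (λ l → Crosses pattern-set (rim j) (rimMate j l)))
        (localSum-cong {p} λ l → cong (λ b → ⟦ R (j ⊖ i₀) ∧ not b ⟧) (rimMember-correct j l))
      cell-eq : ∀ j c → ∑[ k < N ] Crosses pattern-set (cell j c) (mate k (cell j c))
                      ≡ localSum λ l → ⟦ C (j ⊖ i₀) c ∧ not (cellMember (j ⊖ i₀) (partner l c)) ⟧
      cell-eq j c = trans (sum-colours j (λ l → Crosses pattern-set (cell j c) (attach j (partner l c))))
        (localSum-cong {p} λ l → cong (λ b → ⟦ C (j ⊖ i₀) c ∧ not b ⟧) (cellMember-correct j (partner l c)))

    weight : (Node N p → Bool) → Fin N → ℕ
    weight b t = ⟦ R t ∧ b (rim (t ⊕ i₀)) ⟧ + cellSum (λ c → ⟦ C t c ∧ b (cell (t ⊕ i₀) c) ⟧)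

    weight-pattern : ∀ b → nodeSum (λ v → ⟦ pattern-set v ∧ b v ⟧) ≡ ∑[ t < N ] weight b t
    weight-pattern b = trans
      (sum-cong-≗ {N} λ j → cong (λ i → ⟦ R (j ⊖ i₀) ∧ b (rim i) ⟧ + cellSum (λ c → ⟦ C (j ⊖ i₀) c ∧ b (cell i c) ⟧))
                                 (sym (⊖-⊕ j i₀)))
      (sum-⊖ i₀ (weight b))

    pattern-bound : ∀ {a} → Bounded a →
      (P + 1) * ∑[ t < N ] weight a t ≤ ∑[ t < N ] (rimCut t + cellCut t) + (P + 1) * ∑[ t < N ] weight (not ∘ a) t
    pattern-bound {a} bounded = subst₂ (λ x y → (P + 1) * x ≤ y)
      (weight-pattern a)
      (cong₂ (λ x y → x + (P + 1) * y) boundary-pattern (weight-pattern (not ∘ a)))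
      (bounded pattern-set)

  cell-partition : ∀ (a : Cell p → Bool) → cellSum (λ c → ⟦ a c ⟧) + cellSum (λ c → ⟦ not (a c) ⟧) ≡ 2 * P
  cell-partition a = begin
    cellSum (λ c → ⟦ a c ⟧) + cellSum (λ c → ⟦ not (a c) ⟧)   ≡⟨ cellSum-+ (λ c → ⟦ a c ⟧) (λ c → ⟦ not (a c) ⟧) ⟨
    cellSum (λ c → ⟦ a c ⟧ + ⟦ not (a c) ⟧)                   ≡⟨ cellSum-cong {p} (λ c → not-partition (a c)) ⟩
    cellSum {p} (λ _ → 1)                                     ≡⟨ cong (λ z → (z + z) + (z + z)) (sum-const p 1) ⟩
    (p * 1 + p * 1) + (p * 1 + p * 1)                         ≡⟨ four p ⟩
    2 * P                                                     ∎
    where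
    open ≡-Reasoning
    four : ∀ p → (p * 1 + p * 1) + (p * 1 + p * 1) ≡ 2 * (2 * p)
    four = solve-∀

  -- The bound is applied to one whole gadget, whose boundary consists of its 2 P rim edges.
  gadget-≤ : ∀ {a} → Bounded a → ∀ j → cellSum (λ c → ⟦ a (cell j c) ⟧) ≤ P
  gadget-≤ {a} bounded j = subst (λ i → cellSum (λ c → ⟦ a (cell i c) ⟧) ≤ P) (zero-⊕ j)
    (balanced-≤ P (size a) (size (not ∘ a)) (cell-partition (λ c → a (cell (0F ⊕ j) c)))
      (subst₂ _≤_ (cong ((P + 1) *_) (sum-head (weight j R C a) (λ t → cellSum-zero p)))
                  (cong₂ (λ x y → x + (P + 1) * y)
                    (trans (sum-head (λ t → rimCut j R C t + cellCut j R C t)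
                                     (λ t → cong₂ _+_ (localSum-zero p) (trans (cellSum-cong {p} {g = λ _ → 0} (λ c → localSum-zero p)) (cellSum-zero p))))
                           (cong₂ _+_ (localSum-zero p) cut))
                    (sum-head (weight j R C (not ∘ a)) (λ t → cellSum-zero p)))
                  (pattern-bound j R C {a} bounded)))
    where
    size : (Node N p → Bool) → ℕ
    size b = cellSum (λ c → ⟦ b (cell (0F ⊕ j) c) ⟧)
    R : Fin N → Bool
    R _ = false
    C : Fin N → Cell p → Bool
    C zero    _ = true
    C (suc _) _ = false
    cut : cellCut j R C 0F ≡ 2 * P
    cut = trans (cellSum-cong {p} λ c → localSum-cong {p} λ l → leaves (partner l c)) cell-exits
      where
      leaves : ∀ y → ⟦ not (cellMember j R C 0F y) ⟧ ≡ [ (λ _ → 0) , (λ _ → 1) ]′ y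
      leaves (inj₁ c)     = refl
      leaves (inj₂ false) = refl
      leaves (inj₂ true)  = refl

  -- Stands in for function extensionality when `not ∘ not ∘ a` is compared with `a`.
  Bounded-≗ : ∀ {a b} → (∀ v → a v ≡ b v) → Bounded a → Bounded b
  Bounded-≗ a≗b bounded X = subst₂ (λ x y → (P + 1) * x ≤ boundary X + (P + 1) * y)
    (nodeSum-cong λ v → cong (λ s → ⟦ X v ∧ s ⟧) (a≗b v))
    (nodeSum-cong λ v → cong (λ s → ⟦ X v ∧ not s ⟧) (a≗b v))
    (bounded X)
    where
    nodeSum-cong : ∀ {f g : Node N p → ℕ} → (∀ v → f v ≡ g v) → nodeSum f ≡ nodeSum g
    nodeSum-cong f≡g = cong₂ _+_ (f≡g hub) (sum-cong-≗ {N} λ j → cong₂ _+_ (f≡g (rim j)) (cellSum-cong {p} (f≡g ∘ cell j)))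

  gadget-balanced : ∀ {a} → Bounded a → Bounded (not ∘ a) → ∀ j →
    cellSum (λ c → ⟦ a (cell j c) ⟧) ≡ P × cellSum (λ c → ⟦ not (a (cell j c)) ⟧) ≡ P
  gadget-balanced {a} bounded bounded¬ j = pinch #a+#ā≡2P #a≤P #ā≤P , pinch (trans (ℕ.+-comm #ā #a) #a+#ā≡2P) #ā≤P #a≤P
    where
    #a #ā : ℕ
    #a = cellSum (λ c → ⟦ a (cell j c) ⟧)
    #ā = cellSum (λ c → ⟦ not (a (cell j c)) ⟧)
    #a+#ā≡2P : #a + #ā ≡ 2 * P
    #a+#ā≡2P = cell-partition (λ c → a (cell j c))
    #a≤P : #a ≤ P
    #a≤P = gadget-≤ {a} bounded j
    #ā≤P : #ā ≤ P
    #ā≤P = gadget-≤ {not ∘ a} bounded¬ j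
    pinch : ∀ {x y} → x + y ≡ 2 * P → x ≤ P → y ≤ P → x ≡ P
    pinch {x} {y} x+y≡2P x≤P y≤P = ℕ.≤-antisym x≤P (ℕ.+-cancelʳ-≤ P P x (begin
      P + P      ≡⟨ cong (P +_) (ℕ.+-identityʳ P) ⟨
      2 * P      ≡⟨ x+y≡2P ⟨
      x + y      ≤⟨ ℕ.+-monoʳ-≤ x y≤P ⟩
      x + P      ∎))
      where open ℕ.≤-Reasoning

  -- For either side `e`, `terminal e b s` runs through W exactly once: `b` selects the row and
  -- halving permutes the columns. So a rim vertex is joined once to each W cell of an adjacent
  -- gadget.
  sum-terminals : ∀ e (f : Cell p → ℕ) →
    sum (λ s → f (terminal e false s)) + sum (λ s → f (terminal e true s)) ≡ rowSum {p} (λ r x → f (W r x))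
  sum-terminals false f = cong₂ _+_ (sum-reindex (f ∘ W false) halve double halve-double double-halve)
                                    (sum-reindex (f ∘ W true)  halve double halve-double double-halve)
  sum-terminals true  f = trans (ℕ.+-comm (sum (λ s → f (W true (halve s)))) _) (sum-terminals false f)

  row-partition : ∀ (a : Cell p → Bool) →
    rowSum {p} (λ r x → ⟦ a (W r x) ⟧) + rowSum {p} (λ r x → ⟦ not (a (W r x)) ⟧) ≡ P
  row-partition a = trans
    (sym (trans (cong₂ _+_ (∑-distrib-+ (λ x → ⟦ a (W false x) ⟧) (λ x → ⟦ not (a (W false x)) ⟧))
                           (∑-distrib-+ (λ x → ⟦ a (W true x) ⟧) (λ x → ⟦ not (a (W true x)) ⟧)))
                (middle (sum (λ x → ⟦ a (W false x) ⟧)) _ (sum (λ x → ⟦ a (W true x) ⟧)) _)))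
    (trans (cong₂ _+_ (ones false) (ones true)) (twice p))
    where
    ones : ∀ r → ∑[ x < p ] (⟦ a (W r x) ⟧ + ⟦ not (a (W r x)) ⟧) ≡ p * 1
    ones r = trans (sum-cong-≗ {p} λ x → not-partition (a (W r x))) (sum-const p 1)
    middle : ∀ a b c d → (a + b) + (c + d) ≡ (a + c) + (b + d)
    middle = solve-∀
    twice : ∀ p → p * 1 + p * 1 ≡ 2 * p
    twice = solve-∀

  -- A gadget cut along its signs costs at most 2p − 2 more than it gains, instead
  -- of the 2p it would cost to separate its two rim vertices otherwise.
  side-cut : ∀ (a : Cell p → Bool) → cellSum (λ c → ⟦ a c ⟧) ≡ P → cellSum (λ c → ⟦ not (a c) ⟧) ≡ P →
    ∀ (e : Bool → ℕ) → e false + e true ≡ 1 →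
    cellSum (λ c → ⟦ a c ⟧ * exits (λ c → ⟦ not (a c) ⟧) e c) + rowSum {p} (λ r x → ⟦ not (a (W r x)) ⟧) ≤ P * P + surplus + P
  side-cut a A≡P B≡P e e≡1 = begin
    cellSum (λ c → ⟦ a c ⟧ * exits (λ c → ⟦ not (a c) ⟧) e c) + B̄
      ≤⟨ ℕ.+-monoˡ-≤ B̄ (exits-bound a e) ⟩
    cellSum (λ c → ⟦ not (a c) ⟧) * cellSum (λ c → ⟦ a c ⟧) + surplus + (e false + e true) * AW + B̄
      ≡⟨ cong₂ (λ x y → x + surplus + y + B̄) (cong₂ _*_ B≡P A≡P) (trans (cong (_* AW) e≡1) (ℕ.*-identityˡ AW)) ⟩
    P * P + surplus + AW + B̄
      ≡⟨ ℕ.+-assoc (P * P + surplus) AW B̄ ⟩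
    P * P + surplus + (AW + B̄)
      ≡⟨ cong (P * P + surplus +_) (row-partition a) ⟩
    P * P + surplus + P ∎
    where
    open ℕ.≤-Reasoning
    AW B̄ : ℕ
    AW = rowSum {p} (λ r x → ⟦ a (W r x) ⟧)
    B̄  = rowSum {p} (λ r x → ⟦ not (a (W r x)) ⟧)

  private
    M : ℕ
    M = (2 * p) * 2

  next-0F : next {M} 0F ≡ 1F
  next-0F = Fin.toℕ-injective (next-toℕ {M} 0F (ℕ.s≤s ℕ.z≤n))

  next-1F : next {M} 1F ≡ 2F
  next-1F = Fin.toℕ-injective (next-toℕ {M} 1F (ℕ.s≤s (ℕ.s≤s ℕ.z≤n)))

  next-injective : ∀ (s t : Fin N) → next s ≡ next t → s ≡ t
  next-injective s t eq = trans (sym (prev-next s)) (trans (cong prev eq) (prev-next t))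

  module _ {a : Node N p → Bool} (bounded : Bounded a) (bounded¬ : Bounded (not ∘ a)) (i : Fin N)
           (true₁ : a (rim (next i)) ≡ true) (true₂ : a (rim (next (next i))) ≡ true) where
    private
      α : Fin N → Cell p → Bool
      α t c = a (cell (t ⊕ i) c)

      -- Offsets count from the gadget preceding the equal pair: gadget t lies between rim vertices
      -- t and t + 1, so the pair sits at 1 and 2, gadget 1 is taken whole and gadgets 0 and 2 are
      -- cut along their signs.
      R : Fin N → Bool
      R 1F = true
      R 2F = true
      R _  = false

      C : Fin N → Cell p → Bool
      C 0F                    = α 0F
      C 1F                  _ = true
      C 2F                    = α 2F
      C (suc (suc (suc _))) _ = false

      1F⊕ : 1F ⊕ i ≡ next i
      1F⊕ = trans (cong (_⊕ i) (sym next-0F)) (trans (⊕-comm (next {M} 0F) i) (sym (next≡⊕ i)))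

      2F⊕ : 2F ⊕ i ≡ next (next i)
      2F⊕ = begin
        2F ⊕ i                       ≡⟨ cong (_⊕ i) (trans (sym (next≡⊕ 1F)) next-1F) ⟨
        (1F ⊕ next {M} 0F) ⊕ i           ≡⟨ ⊕-right-comm 1F (next {M} 0F) i ⟩
        (1F ⊕ i) ⊕ next {M} 0F           ≡⟨ next≡⊕ (1F ⊕ i) ⟨
        next (1F ⊕ i)                ≡⟨ cong next 1F⊕ ⟩
        next (next i)                ∎
        where open ≡-Reasoning

      rim₁ : a (rim (1F ⊕ i)) ≡ true
      rim₁ = trans (cong (a ∘ rim) 1F⊕) true₁
      rim₂ : a (rim (2F ⊕ i)) ≡ true
      rim₂ = trans (cong (a ∘ rim) 2F⊕) true₂

      -- `next` is injective with `next 0F ≡ 1F` and `next 1F ≡ 2F`, so the successor of `2F` is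
      -- neither of these.
      R-next-2F : R (next {M} 2F) ≡ false
      R-next-2F = avoid (next {M} 2F)
        (λ eq → case-0≢2 (next-injective 2F 0F (trans eq (sym next-0F))))
        (λ eq → case-1≢2 (next-injective 2F 1F (trans eq (sym next-1F))))
        where
        case-0≢2 : _≢_ {A = Fin N} 2F 0F
        case-0≢2 ()
        case-1≢2 : _≢_ {A = Fin N} 2F 1F
        case-1≢2 ()
        avoid : ∀ t → t ≢ 1F → t ≢ 2F → R t ≡ false
        avoid 0F                    _   _   = refl
        avoid 1F                    ≢1F _   = contradiction refl ≢1F
        avoid 2F                    _   ≢2F = contradiction refl ≢2F
        avoid (suc (suc (suc _)))   _   _   = refl

      balanced : ∀ t → cellSum (λ c → ⟦ α t c ⟧) ≡ P × cellSum (λ c → ⟦ not (α t c) ⟧) ≡ P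
      balanced t = gadget-balanced {a} bounded bounded¬ (t ⊕ i)

      ∧-idem : ∀ x → ⟦ x ∧ x ⟧ ≡ ⟦ x ⟧
      ∧-idem true  = refl
      ∧-idem false = refl

      ∧-not : ∀ x → ⟦ x ∧ not x ⟧ ≡ 0
      ∧-not true  = refl
      ∧-not false = refl

      weight-a : ∑[ t < N ] weight i R C a t ≡ P + ((1 + P) + (1 + P))
      weight-a = trans (sum-three (weight i R C a) (λ _ → cellSum-zero p))
        (cong₂ _+_ (trans (cellSum-cong {p} λ c → ∧-idem (α 0F c)) (proj₁ (balanced 0F)))
          (cong₂ _+_ (cong₂ _+_ (cong ⟦_⟧ rim₁) (proj₁ (balanced 1F)))
                     (cong₂ _+_ (cong ⟦_⟧ rim₂) (trans (cellSum-cong {p} λ c → ∧-idem (α 2F c)) (proj₁ (balanced 2F))))))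

      weight-¬a : ∑[ t < N ] weight i R C (not ∘ a) t ≡ 0 + (P + 0)
      weight-¬a = trans (sum-three (weight i R C (not ∘ a)) (λ _ → cellSum-zero p))
        (cong₂ _+_ (trans (cellSum-cong {p} λ c → ∧-not (α 0F c)) (cellSum-zero p))
          (cong₂ _+_ (cong₂ _+_ (cong (⟦_⟧ ∘ not) rim₁) (proj₂ (balanced 1F)))
                     (cong₂ _+_ (cong (⟦_⟧ ∘ not) rim₂) (trans (cellSum-cong {p} λ c → ∧-not (α 2F c)) (cellSum-zero p)))))

      Q : Fin N → (Bool → ℕ) → ℕ
      Q t e = cellSum (λ c → ⟦ α t c ⟧ * exits (λ c → ⟦ not (α t c) ⟧) e c)

      exposed : Fin N → ℕ
      exposed t = rowSum {p} (λ r x → ⟦ not (α t (W r x)) ⟧)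

      cellCut-along : ∀ t e → (∀ c → C t c ≡ α t c) → ⟦ not (R t) ⟧ ≡ e false → ⟦ not (R (next t)) ⟧ ≡ e true →
                      cellCut i R C t ≡ Q t e
      cellCut-along t e C≡α left right = cellSum-cong {p} λ c →
        trans (localSum-cong {p} λ l → trans (⟦∧⟧ (C t c) (not (cellMember i R C t (partner l c))))
                 (cong₂ _*_ (cong ⟦_⟧ (C≡α c)) (member (partner l c))))
              (localSum-*ˡ ⟦ α t c ⟧ (λ l → [ (λ c → ⟦ not (α t c) ⟧) , e ]′ (partner l c)))
        where
        member : ∀ y → ⟦ not (cellMember i R C t y) ⟧ ≡ [ (λ c → ⟦ not (α t c) ⟧) , e ]′ y
        member (inj₁ c)     = cong (⟦_⟧ ∘ not) (C≡α c)
        member (inj₂ false) = left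
        member (inj₂ true)  = right

      -- Indicators of the rim vertex outside the set: gadget 0 has it on its left (`false`), gadget
      -- 2 on its right (`true`).
      leftOnly rightOnly : Bool → ℕ
      leftOnly  e = ⟦ not e ⟧
      rightOnly e = ⟦ e ⟧

      cellCut₀ : cellCut i R C 0F ≡ Q 0F leftOnly
      cellCut₀ = cellCut-along 0F leftOnly (λ _ → refl) refl (cong (⟦_⟧ ∘ not ∘ R) next-0F)

      cellCut₁ : cellCut i R C 1F ≡ 0
      cellCut₁ = trans (cellSum-cong {p} λ c → trans (localSum-cong {p} {G = λ _ → 0} λ l → inside (partner l c)) (localSum-zero p)) (cellSum-zero p)
        where
        inside : ∀ y → ⟦ not (cellMember i R C 1F y) ⟧ ≡ 0
        inside (inj₁ c)     = refl
        inside (inj₂ false) = refl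
        inside (inj₂ true)  = cong (⟦_⟧ ∘ not ∘ R) next-1F

      cellCut₂ : cellCut i R C 2F ≡ Q 2F rightOnly
      cellCut₂ = cellCut-along 2F rightOnly (λ _ → refl) refl (cong (⟦_⟧ ∘ not) R-next-2F)

      prev-1F : prev {M} 1F ≡ 0F
      prev-1F = trans (cong prev (sym next-0F)) (prev-next {M} 0F)

      prev-2F : prev {M} 2F ≡ 1F
      prev-2F = trans (cong prev (sym next-1F)) (prev-next {M} 1F)

      -- The 1 is the hub edge. The edges into gadget 1 stay inside the set; those back into gadget
      -- 0 leave it at the negative W cells.
      rimCut₁ : rimCut i R C 1F ≡ 1 + exposed 0F
      rimCut₁ = cong suc (cong₂ _+_ (cong₂ _+_ (sum-zero p) (sum-zero p))
        (trans (cong₂ _+_ (sum-cong-≗ {p} (through false)) (sum-cong-≗ {p} (through true)))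
               (sum-terminals true (λ c → ⟦ not (α 0F c) ⟧))))
        where
        through : ∀ b s → ⟦ not (C (prev {M} 1F) (terminal true b s)) ⟧ ≡ ⟦ not (α 0F (terminal true b s)) ⟧
        through b s = cong (λ t → ⟦ not (C t (terminal true b s)) ⟧) prev-1F

      rimCut₂ : rimCut i R C 2F ≡ 1 + exposed 2F
      rimCut₂ = cong suc (trans (cong₂ _+_ (sum-terminals false (λ c → ⟦ not (α 2F c) ⟧))
          (trans (cong₂ _+_ (sum-vanishing _ (through false)) (sum-vanishing _ (through true))) refl))
        (ℕ.+-identityʳ (exposed 2F)))
        where
        through : ∀ b s → ⟦ not (C (prev {M} 2F) (terminal true b s)) ⟧ ≡ 0
        through b s = cong (λ t → ⟦ not (C t (terminal true b s)) ⟧) prev-2F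

      cut : ∑[ t < N ] (rimCut i R C t + cellCut i R C t)
          ≡ Q 0F leftOnly + (((1 + exposed 0F) + 0) + ((1 + exposed 2F) + Q 2F rightOnly))
      cut = trans (sum-three (λ t → rimCut i R C t + cellCut i R C t)
                    (λ t → cong₂ _+_ (localSum-zero p) (trans (cellSum-cong {p} {g = λ _ → 0} (λ c → localSum-zero p)) (cellSum-zero p))))
        (cong₂ _+_ (cong₂ _+_ (localSum-zero p) cellCut₀)
          (cong₂ _+_ (cong₂ _+_ rimCut₁ cellCut₁) (cong₂ _+_ rimCut₂ cellCut₂)))

      -- The left side minus the right side is 2 (P - s), so it equals 4 for `s + 2 ≡ P` and would
      -- be 0 for a surplus of P.
      too-light : ∀ P s → s + 2 ≡ P →
        ¬ ((P + 1) * (P + ((1 + P) + (1 + P))) ≤ (2 + ((P * P + s + P) + (P * P + s + P))) + (P + 1) * (0 + (P + 0)))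
      too-light P s refl bound = ℕ.<⇒≱ (ℕ.m<m+n rhs (ℕ.s≤s ℕ.z≤n)) (ℕ.≤-trans (ℕ.≤-reflexive (sym (expand s))) bound)
        where
        rhs : ℕ
        rhs = (2 + ((P * P + s + P) + (P * P + s + P))) + (P + 1) * (0 + (P + 0))
        expand : ∀ s → (s + 2 + 1) * (s + 2 + ((1 + (s + 2)) + (1 + (s + 2)))) ≡
          (2 + (((s + 2) * (s + 2) + s + (s + 2)) + ((s + 2) * (s + 2) + s + (s + 2)))) + (s + 2 + 1) * (0 + ((s + 2) + 0)) + 4
        expand = solve-∀

    equal-neighbours-impossible : ⊥
    equal-neighbours-impossible = too-light P surplus surplus-small (begin
      (P + 1) * (P + ((1 + P) + (1 + P)))
        ≡⟨ cong ((P + 1) *_) weight-a ⟨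
      (P + 1) * ∑[ t < N ] weight i R C a t
        ≤⟨ pattern-bound i R C {a} bounded ⟩
      ∑[ t < N ] (rimCut i R C t + cellCut i R C t) + (P + 1) * ∑[ t < N ] weight i R C (not ∘ a) t
        ≡⟨ cong₂ (λ x y → x + (P + 1) * y) cut weight-¬a ⟩
      (Q 0F leftOnly + (((1 + exposed 0F) + 0) + ((1 + exposed 2F) + Q 2F rightOnly))) + (P + 1) * (0 + (P + 0))
        ≡⟨ cong (_+ (P + 1) * (0 + (P + 0))) (regroup (Q 0F leftOnly) (exposed 0F) (exposed 2F) (Q 2F rightOnly)) ⟩
      (2 + ((Q 0F leftOnly + exposed 0F) + (Q 2F rightOnly + exposed 2F))) + (P + 1) * (0 + (P + 0))
        ≤⟨ ℕ.+-monoˡ-≤ ((P + 1) * (0 + (P + 0))) (ℕ.+-monoʳ-≤ 2 (ℕ.+-mono-≤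
             (side-cut (α 0F) (proj₁ (balanced 0F)) (proj₂ (balanced 0F)) leftOnly refl)
             (side-cut (α 2F) (proj₁ (balanced 2F)) (proj₂ (balanced 2F)) rightOnly refl))) ⟩
      (2 + ((P * P + surplus + P) + (P * P + surplus + P))) + (P + 1) * (0 + (P + 0)) ∎)
      where
      open ℕ.≤-Reasoning
      regroup : ∀ a b c d → a + (((1 + b) + 0) + ((1 + c) + d)) ≡ 2 + ((a + b) + (d + c))
      regroup = solve-∀

  -- Alternating signs return after the first 4p steps around the rim, and the last of the 4p + 1
  -- steps flips them at the starting point.
  odd-cycle : ∀ (c : Fin N → Bool) → ¬ (∀ i → c (next i) ≡ not (c i))
  odd-cycle c alternating = fixed-point (c 0F) (begin
    c 0F                               ≡⟨ cong c full-turn ⟨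
    c (N mod N)                        ≡⟨ step ((2 * p) * 2) ⟩
    not (c (((2 * p) * 2) mod N))      ≡⟨ cong not (even (2 * p)) ⟩
    not (c 0F)                         ∎)
    where
    open ≡-Reasoning
    fixed-point : ∀ b → ¬ (b ≡ not b)
    fixed-point true  ()
    fixed-point false ()
    full-turn : N mod N ≡ 0F
    full-turn = Fin.toℕ-injective (trans (toℕ-mod N) (n%n≡0 N))
    next-mod : ∀ k → next (k mod N) ≡ suc k mod N
    next-mod k = Fin.toℕ-injective (begin
      toℕ (next (k mod N))       ≡⟨ toℕ-mod (toℕ (k mod N) + 1) ⟩
      (toℕ (k mod N) + 1) % N    ≡⟨ cong (λ z → (z + 1) % N) (toℕ-mod k) ⟩
      (k % N + 1) % N            ≡⟨ %-absorb-+ k 1 ⟩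
      (k + 1) % N                ≡⟨ cong (_% N) (ℕ.+-comm k 1) ⟩
      suc k % N                  ≡⟨ toℕ-mod (suc k) ⟨
      toℕ (suc k mod N)          ∎)
    step : ∀ k → c (suc k mod N) ≡ not (c (k mod N))
    step k = trans (cong c (sym (next-mod k))) (alternating (k mod N))
    even : ∀ k → c ((k * 2) mod N) ≡ c 0F
    even zero    = refl
    even (suc k) = trans (step (suc (k * 2))) (trans (cong not (step (k * 2)))
      (trans (not-involutive _) (even k)))

  no-bounded-signs : ∀ {a} → Bounded a → ¬ Bounded (not ∘ a)
  no-bounded-signs {a} bounded bounded¬ = odd-cycle (a ∘ rim) alternating
    where
    neighbours : ∀ {b} → Bounded b → Bounded (not ∘ b) → ∀ i → b (rim i) ≡ true → ¬ (b (rim (next i)) ≡ true)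
    -- The base is `prev i`, because the equal pair has to sit at offsets 1 and 2.
    neighbours {b} bd bd¬ i t₁ t₂ = equal-neighbours-impossible {b} bd bd¬ (prev i)
      (trans (cong (b ∘ rim) (next-prev i)) t₁) (trans (cong (b ∘ rim ∘ next) (next-prev i)) t₂)
    bounded¬¬ : Bounded (not ∘ not ∘ a)
    bounded¬¬ = Bounded-≗ {a} (λ v → sym (not-involutive (a v))) bounded
    alternate : ∀ x y → ¬ (x ≡ true × y ≡ true) → ¬ (not x ≡ true × not y ≡ true) → y ≡ not x
    alternate true  true  ¬both _        = contradiction (refl , refl) ¬both
    alternate true  false _     _        = refl
    alternate false true  _     _        = refl
    alternate false false _     ¬neither = contradiction (refl , refl) ¬neither
    alternating : ∀ i → a (rim (next i)) ≡ not (a (rim i))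
    alternating i = alternate (a (rim i)) (a (rim (next i)))
      (uncurry (neighbours {a} bounded bounded¬ i))
      (uncurry (neighbours {not ∘ a} bounded¬ bounded¬¬ i))

-- The signs of an orientation

-- Otherwise `o ≥ k + 2` and `i ≤ k − 1`, so that `k (k + 2) ≤ (k + 2) (k − 1)`; and `i < k` makes
-- `k` positive, which refutes this.
≤-suc : ∀ k o i → o + i ≡ 2 * k + 1 → k * o ≤ (k + 2) * i → o ≤ k + 1
≤-suc k o i o+i≡ bound with o ℕ.≤? k + 1
... | yes o≤ = o≤
... | no  o≰ = contradiction
  (ℕ.≤-trans (ℕ.*-monoʳ-≤ k k+2≤o) (ℕ.≤-trans bound (ℕ.*-monoʳ-≤ (k + 2) i≤)))
  (ℕ.<⇒≱ (strict k))
  where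
  k+2≤o : k + 2 ≤ o
  k+2≤o = subst (_≤ o) (sym (ℕ.+-suc k 1)) (ℕ.≰⇒> o≰)
  sum-eq : ∀ k i → k + 2 + i ≡ suc i + suc k
  sum-eq = solve-∀
  total : ∀ k → 2 * k + 1 ≡ k + suc k
  total = solve-∀
  i<k : suc i ≤ k
  i<k = ℕ.+-cancelʳ-≤ (suc k) (suc i) k (begin
    suc i + suc k    ≡⟨ sum-eq k i ⟨
    k + 2 + i        ≤⟨ ℕ.+-monoˡ-≤ i k+2≤o ⟩
    o + i            ≡⟨ o+i≡ ⟩
    2 * k + 1        ≡⟨ total k ⟩
    k + suc k        ∎)
    where open ℕ.≤-Reasoning
  i≤ : i ≤ ℕ.pred k
  i≤ = ℕ.pred-mono-≤ i<k
  strict : ∀ k → .{{_ : NonZero k}} → (k + 2) * ℕ.pred k < k * (k + 2)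
  strict (suc k) = subst ((suc k + 2) * k <_) (ℕ.*-comm (suc k + 2) (suc k)) (ℕ.*-monoʳ-< (suc k + 2) (ℕ.n<1+n k))
  instance
    k≢0 : NonZero k
    k≢0 = ℕ.>-nonZero (ℕ.≤-trans (ℕ.s≤s ℕ.z≤n) i<k)

-- Two numbers of sum 2k + 1, both at most k + 1, are k and k + 1. The equation says o - i = ±1,
-- with the sign determined by `i < o`.
excess : ∀ k o i → o + i ≡ 2 * k + 1 → o ≤ k + 1 → i ≤ k + 1 →
         o + ⟦ not (does (i ℕ.<? o)) ⟧ ≡ i + ⟦ does (i ℕ.<? o) ⟧
excess k o i o+i≡ o≤ i≤ with i ℕ.<? o
... | yes i<o rewrite dec-true (i ℕ.<? o) i<o = trans (ℕ.+-identityʳ o) (trans o≡ (cong (_+ 1) (sym i≡)))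
  where
  total : ∀ k → 2 * k + 1 ≡ k + (k + 1)
  total = solve-∀
  k≤i : k ≤ i
  k≤i = ℕ.+-cancelʳ-≤ (k + 1) k i (ℕ.≤-trans (ℕ.≤-reflexive (trans (sym (total k)) (trans (sym o+i≡) (ℕ.+-comm o i)))) (ℕ.+-monoʳ-≤ i o≤))
  i≡ : i ≡ k
  i≡ = ℕ.≤-antisym (ℕ.s≤s⁻¹ (ℕ.≤-trans i<o (ℕ.≤-trans o≤ (ℕ.≤-reflexive (ℕ.+-comm k 1))))) k≤i
  o≡ : o ≡ k + 1
  o≡ = ℕ.+-cancelʳ-≡ k o (k + 1) (trans (trans (cong (o +_) (sym i≡)) o+i≡) (trans (total k) (ℕ.+-comm k (k + 1))))
... | no  i≮o rewrite dec-false (i ℕ.<? o) i≮o = trans (cong (_+ 1) o≡) (trans (sym i≡) (sym (ℕ.+-identityʳ i)))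
  where
  total : ∀ k → 2 * k + 1 ≡ k + (k + 1)
  total = solve-∀
  k≤o : k ≤ o
  k≤o = ℕ.+-cancelʳ-≤ (k + 1) k o (ℕ.≤-trans (ℕ.≤-reflexive (trans (sym (total k)) (sym o+i≡))) (ℕ.+-monoʳ-≤ o i≤))
  o≢ : o ≢ k + 1
  o≢ refl = i≮o (ℕ.≤-reflexive (ℕ.+-cancelˡ-≡ (k + 1) (suc i) (k + 1) (trans (ℕ.+-suc (k + 1) i) (trans (cong suc o+i≡) (twice k)))))
    where
    twice : ∀ k → suc (2 * k + 1) ≡ k + 1 + (k + 1)
    twice = solve-∀
  o≡ : o ≡ k
  o≡ = ℕ.≤-antisym (ℕ.s≤s⁻¹ (subst (suc o ≤_) (ℕ.+-comm k 1) (ℕ.≤∧≢⇒< o≤ o≢))) k≤o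
  i≡ : i ≡ k + 1
  i≡ = ℕ.+-cancelˡ-≡ k i (k + 1) (trans (cong (_+ i) (sym o≡)) (trans o+i≡ (total k)))

-- The hypothesis reads O - I = w(X), and `k O ≤ (k + 2) I` is equivalent to (k + 1) (O - I) ≤ O +
-- I.
signed-cut : ∀ k O I #a #¬ → O + #¬ ≡ I + #a → k * O ≤ (k + 2) * I → (k + 1) * #a ≤ O + I + (k + 1) * #¬
signed-cut k O I #a #¬ O+#¬≡ bound = ℕ.+-cancelˡ-≤ ((k + 1) * I) _ _ (begin
  (k + 1) * I + (k + 1) * #a           ≡⟨ ℕ.*-distribˡ-+ (k + 1) I #a ⟨
  (k + 1) * (I + #a)                   ≡⟨ cong ((k + 1) *_) O+#¬≡ ⟨
  (k + 1) * (O + #¬)                   ≡⟨ expand k O #¬ ⟩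
  k * O + (O + (k + 1) * #¬)           ≤⟨ ℕ.+-monoˡ-≤ (O + (k + 1) * #¬) bound ⟩
  (k + 2) * I + (O + (k + 1) * #¬)     ≡⟨ regroup k I O ((k + 1) * #¬) ⟩
  (k + 1) * I + (O + I + (k + 1) * #¬) ∎)
  where
  open ℕ.≤-Reasoning
  expand : ∀ k O b → (k + 1) * (O + b) ≡ k * O + (O + (k + 1) * b)
  expand = solve-∀
  regroup : ∀ k I O b → (k + 2) * I + (O + b) ≡ (k + 1) * I + (O + I + b)
  regroup = solve-∀

SignBounded : (G : Multigraph) → ℕ → (Vertex G → Bool) → Set
SignBounded G k a = ∀ X →
  (k + 1) * ∑[ v < Multigraph.#V G ] ⟦ X v ∧ a v ⟧ ≤ crossing G X + (k + 1) * ∑[ v < Multigraph.#V G ] ⟦ X v ∧ not (a v) ⟧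

module _ (G : Multigraph) (k : ℕ) (regular : Regular (2 * k + 1) G) (D : Orientation G)
         (cuts : ∀ X → k * outflow G D X ≤ (k + 2) * inflow G D X) where
  open Multigraph G using (#V; #E; end₁; end₂; loopless; incident?; degree)

  private
    outdegree indegree : Vertex G → ℕ
    outdegree v = ∑[ e < #E ] ⟦ does (tail G D e Fin.≟ v) ⟧
    indegree  v = ∑[ e < #E ] ⟦ does (head G D e Fin.≟ v) ⟧

  tail≢head : ∀ e → tail G D e ≢ head G D e
  tail≢head e with D e
  ... | true  = loopless e
  ... | false = loopless e ∘ sym

  outdegree+indegree : ∀ v → outdegree v + indegree v ≡ 2 * k + 1
  outdegree+indegree v = begin
    outdegree v + indegree v
      ≡⟨ ∑-distrib-+ (λ e → ⟦ does (tail G D e Fin.≟ v) ⟧) (λ e → ⟦ does (head G D e Fin.≟ v) ⟧) ⟨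
    ∑[ e < #E ] (⟦ does (tail G D e Fin.≟ v) ⟧ + ⟦ does (head G D e Fin.≟ v) ⟧)
      ≡⟨ sum-cong-≗ ends ⟩
    ∑[ e < #E ] ⟦ does (incident? v e) ⟧
      ≡⟨ length-filter-allFin (incident? v) ⟨
    degree v
      ≡⟨ regular v ⟩
    2 * k + 1 ∎
    where
    open ≡-Reasoning
    ends : ∀ e → ⟦ does (tail G D e Fin.≟ v) ⟧ + ⟦ does (head G D e Fin.≟ v) ⟧ ≡ ⟦ does (incident? v e) ⟧
    ends e = trans (oriented (D e)) (sym (⟦⊎-dec⟧ (end₁ e Fin.≟ v) (end₂ e Fin.≟ v)
        λ end₁≡v end₂≡v → loopless e (trans end₁≡v (sym end₂≡v))))
      where
      oriented : ∀ b → ⟦ does ((if b then end₁ e else end₂ e) Fin.≟ v) ⟧ + ⟦ does ((if b then end₂ e else end₁ e) Fin.≟ v) ⟧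
                     ≡ ⟦ does (end₁ e Fin.≟ v) ⟧ + ⟦ does (end₂ e Fin.≟ v) ⟧
      oriented true  = refl
      oriented false = ℕ.+-comm ⟦ does (end₂ e Fin.≟ v) ⟧ ⟦ does (end₁ e Fin.≟ v) ⟧

  -- The complement of `X` has the same cut with the directions exchanged.
  cuts-reversed : ∀ X → k * inflow G D X ≤ (k + 2) * outflow G D X
  cuts-reversed X = subst₂ (λ x y → k * x ≤ (k + 2) * y)
    (sum-cong-≗ λ e → swap (X (tail G D e)) (X (head G D e)))
    (sum-cong-≗ λ e → swap (X (head G D e)) (X (tail G D e)))
    (cuts (not ∘ X))
    where
    swap : ∀ s t → ⟦ not s ∧ not (not t) ⟧ ≡ ⟦ t ∧ not s ⟧
    swap true  true  = refl
    swap true  false = refl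
    swap false true  = refl
    swap false false = refl

  outflow-vertex : ∀ v → outflow G D (λ u → does (u Fin.≟ v)) ≡ outdegree v
  outflow-vertex v = sum-cong-≗ λ e → simplify (tail G D e) (head G D e) (tail≢head e)
    where
    simplify : ∀ s t → s ≢ t → ⟦ does (s Fin.≟ v) ∧ not (does (t Fin.≟ v)) ⟧ ≡ ⟦ does (s Fin.≟ v) ⟧
    simplify s t s≢t with s Fin.≟ v | t Fin.≟ v
    ... | yes s≡v | yes t≡v = contradiction (trans s≡v (sym t≡v)) s≢t
    ... | yes _   | no  _   = refl
    ... | no  _   | _       = refl

  inflow-vertex : ∀ v → inflow G D (λ u → does (u Fin.≟ v)) ≡ indegree v
  inflow-vertex v = sum-cong-≗ λ e → simplify (head G D e) (tail G D e) (tail≢head e ∘ sym)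
    where
    simplify : ∀ s t → s ≢ t → ⟦ does (s Fin.≟ v) ∧ not (does (t Fin.≟ v)) ⟧ ≡ ⟦ does (s Fin.≟ v) ⟧
    simplify s t s≢t with s Fin.≟ v | t Fin.≟ v
    ... | yes s≡v | yes t≡v = contradiction (trans s≡v (sym t≡v)) s≢t
    ... | yes _   | no  _   = refl
    ... | no  _   | _       = refl

  sign : Vertex G → Bool
  sign v = does (indegree v ℕ.<? outdegree v)

  degree-excess : ∀ v → outdegree v + ⟦ not (sign v) ⟧ ≡ indegree v + ⟦ sign v ⟧
  degree-excess v = excess k (outdegree v) (indegree v) (outdegree+indegree v)
    (≤-suc k (outdegree v) (indegree v) (outdegree+indegree v)
      (subst₂ (λ x y → k * x ≤ (k + 2) * y) (outflow-vertex v) (inflow-vertex v) (cuts (λ u → does (u Fin.≟ v)))))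
    (≤-suc k (indegree v) (outdegree v) (trans (ℕ.+-comm (indegree v) (outdegree v)) (outdegree+indegree v))
      (subst₂ (λ x y → k * x ≤ (k + 2) * y) (inflow-vertex v) (outflow-vertex v) (cuts-reversed (λ u → does (u Fin.≟ v)))))

  sum-degrees : ∀ (t : Edge G → Vertex G) X →
    ∑[ v < #V ] (⟦ X v ⟧ * ∑[ e < #E ] ⟦ does (t e Fin.≟ v) ⟧) ≡ ∑[ e < #E ] ⟦ X (t e) ⟧
  sum-degrees t X = trans
    (sum-cong-≗ λ v → trans (times (X v) _) (cong (λ s → if X v then s else 0) (sum-cong-≗ λ e → indicator (does (t e Fin.≟ v)))))
    (trans (∑-fibres t X (λ _ → 1)) (sum-cong-≗ λ e → sym (indicator (X (t e)))))
    where
    open Gather ℕ.+-0-commutativeMonoid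
    times : ∀ b s → ⟦ b ⟧ * s ≡ (if b then s else 0)
    times true  s = ℕ.+-identityʳ s
    times false s = refl
    indicator : ∀ b → ⟦ b ⟧ ≡ (if b then 1 else 0)
    indicator true  = refl
    indicator false = refl

  -- Summing outdegree minus indegree over `X` cancels the edges inside `X` and leaves the outflow
  -- minus the inflow, while each vertex contributes ±1 by `degree-excess`.
  net-outflow : ∀ X → outflow G D X + ∑[ v < #V ] ⟦ X v ∧ not (sign v) ⟧ ≡ inflow G D X + ∑[ v < #V ] ⟦ X v ∧ sign v ⟧
  net-outflow X = ℕ.+-cancelʳ-≡ heads _ _ (begin
    (outflow G D X + #¬) + heads    ≡⟨ swap (outflow G D X) #¬ heads ⟩
    (outflow G D X + heads) + #¬    ≡⟨ cong (_+ #¬) edges≡ ⟩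
    (inflow G D X + tails) + #¬     ≡⟨ ℕ.+-assoc (inflow G D X) tails #¬ ⟩
    inflow G D X + (tails + #¬)     ≡⟨ cong (inflow G D X +_) vertices≡ ⟩
    inflow G D X + (heads + #a)     ≡⟨ swap′ (inflow G D X) heads #a ⟩
    (inflow G D X + #a) + heads     ∎)
    where
    open ≡-Reasoning
    tails heads #a #¬ : ℕ
    tails = ∑[ e < #E ] ⟦ X (tail G D e) ⟧
    heads = ∑[ e < #E ] ⟦ X (head G D e) ⟧
    #a = ∑[ v < #V ] ⟦ X v ∧ sign v ⟧
    #¬ = ∑[ v < #V ] ⟦ X v ∧ not (sign v) ⟧
    swap : ∀ a b c → (a + b) + c ≡ (a + c) + b
    swap = solve-∀
    swap′ : ∀ a b c → a + (b + c) ≡ (a + c) + b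
    swap′ = solve-∀
    ends : ∀ s t → ⟦ s ∧ not t ⟧ + ⟦ t ⟧ ≡ ⟦ t ∧ not s ⟧ + ⟦ s ⟧
    ends true  true  = refl
    ends true  false = refl
    ends false true  = refl
    ends false false = refl
    edges≡ : outflow G D X + heads ≡ inflow G D X + tails
    edges≡ = trans (sym (∑-distrib-+ (λ e → Crosses X (tail G D e) (head G D e)) (λ e → ⟦ X (head G D e) ⟧)))
      (trans (sum-cong-≗ λ e → ends (X (tail G D e)) (X (head G D e)))
             (∑-distrib-+ (λ e → Crosses X (head G D e) (tail G D e)) (λ e → ⟦ X (tail G D e) ⟧)))
    at : ∀ v → ⟦ X v ⟧ * outdegree v + ⟦ X v ∧ not (sign v) ⟧ ≡ ⟦ X v ⟧ * indegree v + ⟦ X v ∧ sign v ⟧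
    at v = begin
      ⟦ X v ⟧ * outdegree v + ⟦ X v ∧ not (sign v) ⟧         ≡⟨ cong (⟦ X v ⟧ * outdegree v +_) (⟦∧⟧ (X v) (not (sign v))) ⟩
      ⟦ X v ⟧ * outdegree v + ⟦ X v ⟧ * ⟦ not (sign v) ⟧     ≡⟨ ℕ.*-distribˡ-+ ⟦ X v ⟧ (outdegree v) ⟦ not (sign v) ⟧ ⟨
      ⟦ X v ⟧ * (outdegree v + ⟦ not (sign v) ⟧)             ≡⟨ cong (⟦ X v ⟧ *_) (degree-excess v) ⟩
      ⟦ X v ⟧ * (indegree v + ⟦ sign v ⟧)                    ≡⟨ ℕ.*-distribˡ-+ ⟦ X v ⟧ (indegree v) ⟦ sign v ⟧ ⟩
      ⟦ X v ⟧ * indegree v + ⟦ X v ⟧ * ⟦ sign v ⟧            ≡⟨ cong (⟦ X v ⟧ * indegree v +_) (⟦∧⟧ (X v) (sign v)) ⟨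
      ⟦ X v ⟧ * indegree v + ⟦ X v ∧ sign v ⟧                ∎
    vertices≡ : tails + #¬ ≡ heads + #a
    vertices≡ = begin
      tails + #¬
        ≡⟨ cong (_+ #¬) (sum-degrees (tail G D) X) ⟨
      ∑[ v < #V ] (⟦ X v ⟧ * outdegree v) + #¬
        ≡⟨ ∑-distrib-+ (λ v → ⟦ X v ⟧ * outdegree v) (λ v → ⟦ X v ∧ not (sign v) ⟧) ⟨
      ∑[ v < #V ] (⟦ X v ⟧ * outdegree v + ⟦ X v ∧ not (sign v) ⟧)
        ≡⟨ sum-cong-≗ at ⟩
      ∑[ v < #V ] (⟦ X v ⟧ * indegree v + ⟦ X v ∧ sign v ⟧)
        ≡⟨ ∑-distrib-+ (λ v → ⟦ X v ⟧ * indegree v) (λ v → ⟦ X v ∧ sign v ⟧) ⟩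
      ∑[ v < #V ] (⟦ X v ⟧ * indegree v) + #a
        ≡⟨ cong (_+ #a) (sum-degrees (head G D) X) ⟩
      heads + #a ∎

  outflow+inflow : ∀ X → outflow G D X + inflow G D X ≡ crossing G X
  outflow+inflow X = trans
    (sym (∑-distrib-+ (λ e → Crosses X (tail G D e) (head G D e)) (λ e → Crosses X (head G D e) (tail G D e))))
    (sum-cong-≗ λ e → oriented (D e) (end₁ e) (end₂ e))
    where
    oriented : ∀ b s t → Crosses X (if b then s else t) (if b then t else s) + Crosses X (if b then t else s) (if b then s else t)
                       ≡ Crosses X s t + Crosses X t s
    oriented true  s t = refl
    oriented false s t = ℕ.+-comm (Crosses X t s) (Crosses X s t)

  sign-bounded : SignBounded G k sign
  sign-bounded X = subst (λ c → (k + 1) * ∑[ v < #V ] ⟦ X v ∧ sign v ⟧ ≤ c + (k + 1) * ∑[ v < #V ] ⟦ X v ∧ not (sign v) ⟧)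
    (outflow+inflow X)
    (signed-cut k (outflow G D X) (inflow G D X) _ _ (net-outflow X) (cuts X))

  sign-bounded-¬ : SignBounded G k (not ∘ sign)
  sign-bounded-¬ X = subst₂ (λ c s → (k + 1) * ∑[ v < #V ] ⟦ X v ∧ not (sign v) ⟧ ≤ c + (k + 1) * s)
    (trans (ℕ.+-comm (inflow G D X) (outflow G D X)) (outflow+inflow X))
    (sum-cong-≗ λ v → cong (λ s → ⟦ X v ∧ s ⟧) (sym (not-involutive (sign v))))
    (signed-cut k (inflow G D X) (outflow G D X) _ _ (sym (net-outflow X)) (cuts-reversed X))

-- The graph and its flow number

*2≡+ : ∀ h → h * 2 ≡ h + h
*2≡+ h = trans (ℕ.*-comm h 2) (cong (h +_) (ℕ.+-identityʳ h))

even-or-odd : ∀ n → (∃[ h ] n ≡ h * 2) ⊎ (∃[ h ] n ≡ suc (h + h))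
even-or-odd zero    = inj₁ (0 , refl)
even-or-odd (suc n) with even-or-odd n
... | inj₁ (h , n≡) = inj₂ (h , cong suc (trans n≡ (*2≡+ h)))
... | inj₂ (h , n≡) = inj₁ (suc h , cong suc (trans n≡ (cong suc (sym (*2≡+ h)))))

open import Data.Integer.Base using (+_)

module _ {m : ℕ} (𝓖 : Gadget m) where
  open Wheel 𝓖
  open Core 𝓖

  wheelOrder : ℕ
  wheelOrder = N * suc (2 * (2 * p))

  wheelFactorisation : Factorisation (suc wheelOrder) N
  wheelFactorisation = record
    { mate            = λ k v → nodeCode (mate k (nodeAt v))
    ; mate-involutive = λ k v → trans
        (cong (nodeCode ∘ mate k) (nodeAt-nodeCode (mate k (nodeAt v))))
        (trans (cong nodeCode (mate-involutive k (nodeAt v))) (nodeCode-nodeAt v))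
    ; mate-≢          = λ k v eq → mate-≢ k (nodeAt v)
        (trans (sym (nodeAt-nodeCode (mate k (nodeAt v)))) (cong nodeAt eq))
    }

  wheel : Multigraph
  wheel = factorGraph wheelFactorisation

  crossing-wheel : ∀ X → crossing wheel (X ∘ nodeAt) ≡ boundary X
  crossing-wheel X = begin
    crossing wheel (X ∘ nodeAt)
      ≡⟨ sum-crossing wheelFactorisation (X ∘ nodeAt) ⟩
    ∑[ k < N ] ∑[ v < suc wheelOrder ] Crosses (X ∘ nodeAt) v (nodeCode (mate k (nodeAt v)))
      ≡⟨ ∑-comm {N} {suc wheelOrder} (λ k v → Crosses (X ∘ nodeAt) v (nodeCode (mate k (nodeAt v)))) ⟩
    ∑[ v < suc wheelOrder ] ∑[ k < N ] Crosses (X ∘ nodeAt) v (nodeCode (mate k (nodeAt v)))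
      ≡⟨ sum-cong-≗ {suc wheelOrder} (λ v → sum-cong-≗ {N} λ k →
           cong (λ u → ⟦ X (nodeAt v) ∧ not (X u) ⟧) (nodeAt-nodeCode (mate k (nodeAt v)))) ⟩
    ∑[ v < suc wheelOrder ] ∑[ k < N ] Crosses X (nodeAt v) (mate k (nodeAt v))
      ≡⟨ sum-nodeAt {N} {p} (λ v → ∑[ k < N ] Crosses X v (mate k v)) ⟩
    boundary X ∎
    where open ≡-Reasoning

  -- The numbering of nodes is a bijection, so every set of nodes arises from a vertex set of
  -- `wheel` with the same cut and the same signed counts.
  sign-transfer : ∀ {a} → SignBounded wheel (2 * p) a → Bounded (a ∘ nodeCode)
  sign-transfer {a} bounded X = subst₂ _≤_
    (cong ((2 * p + 1) *_) (transfer id))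
    (cong₂ (λ x y → x + (2 * p + 1) * y) (crossing-wheel X) (transfer not))
    (bounded (X ∘ nodeAt))
    where
    transfer : ∀ (s : Bool → Bool) → ∑[ v < suc wheelOrder ] ⟦ X (nodeAt v) ∧ s (a v) ⟧
                                   ≡ nodeSum (λ v → ⟦ X v ∧ s (a (nodeCode v)) ⟧)
    transfer s = trans
      (sum-cong-≗ {suc wheelOrder} λ v → cong (λ u → ⟦ X (nodeAt v) ∧ s (a u) ⟧) (sym (nodeCode-nodeAt {N} {p} v)))
      (sum-nodeAt {N} {p} (λ v → ⟦ X v ∧ s (a (nodeCode v)) ⟧))

  no-signs : ∀ {a} → SignBounded wheel (2 * p) a → ¬ SignBounded wheel (2 * p) (not ∘ a)
  no-signs {a} bounded bounded¬ =
    no-bounded-signs {a ∘ nodeCode} (sign-transfer {a} bounded) (sign-transfer {not ∘ a} bounded¬)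

  module _ {k : ℕ} (k≡2p : k ≡ 2 * p) where
    N≡2k+1 : N ≡ 2 * k + 1
    N≡2k+1 = trans (count (2 * p)) (cong (λ z → 2 * z + 1) (sym k≡2p))
      where
      count : ∀ k → suc (k * 2) ≡ 2 * k + 1
      count = solve-∀

    wheel-regular : Regular (2 * k + 1) wheel
    wheel-regular v = trans (factorGraph-regular wheelFactorisation v) N≡2k+1

    wheel-flow-number : .{{_ : NonZero k}} → ((+ 2 / 1) ℚ.+ (+ 2 / k)) <ᵁ φc wheel
    wheel-flow-number = no-cuts⇒large-flow-number wheel k λ D cuts →
      no-signs {sign wheel k wheel-regular D cuts}
        (subst (λ z → SignBounded wheel z (sign wheel k wheel-regular D cuts)) k≡2p
               (sign-bounded wheel k wheel-regular D cuts))
        (subst (λ z → SignBounded wheel z (not ∘ sign wheel k wheel-regular D cuts)) k≡2p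
               (sign-bounded-¬ wheel k wheel-regular D cuts))

gadget⇒graph : ∀ {m} → Gadget m → ∀ k .{{_ : NonZero k}} → k ≡ 2 * suc m →
  Σ[ G ∈ Multigraph ] (Regular (2 * k + 1) G × Class1 G × ((+ 2 / 1) ℚ.+ (+ 2 / k)) <ᵁ φc G)
gadget⇒graph 𝓖 k k≡2p = factorisation⇒graph (wheelFactorisation 𝓖) zero (N≡2k+1 𝓖 k≡2p)
  (λ G → ((+ 2 / 1) ℚ.+ (+ 2 / k)) <ᵁ φc G) (wheel-flow-number 𝓖 k≡2p)

corollary3p5 : ∀ (p k : ℕ) .{{_ : NonZero k}} → 3 ≤ p → 2 ∤ p → k ≡ 2 * p →
    Σ[ G ∈ Multigraph ]
    (Regular (2 * k + 1) G × Class1 G × ((+ 2 / 1) ℚ.+ (+ 2 / k)) <ᵁ φc G)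
corollary3p5 p@(suc (suc (suc q))) k (s≤s (s≤s (s≤s _))) 2∤p k≡2p = construct (even-or-odd p)
  where
  construct : (∃[ h ] p ≡ h * 2) ⊎ (∃[ h ] p ≡ suc (h + h)) →
    Σ[ G ∈ Multigraph ] (Regular (2 * k + 1) G × Class1 G × ((+ 2 / 1) ℚ.+ (+ 2 / k)) <ᵁ φc G)
  construct (inj₁ (h , p≡)) = contradiction (divides h p≡) 2∤p
  -- Writing p as 2h + 1 provides the inverse h + 1 of 2 modulo p on which the terminals rest.
  construct (inj₂ (h , p≡)) = gadget⇒graph (twistedGadget q h p≡) k k≡2p
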